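{- For each $t\in\mathbb{C}$ there exists a $(2,2)$-color edge coloring model $h(t)\in (SV_2\otimes\bigwedge V_{2\ell})^*$ with $\ell=1$ (that is, $k=2$ and $2\ell=2$) such that its mixed partition function satisfies $p_{h(t)}(G)=p(G;t)$ for all graphs $G$ (having no component equal to the circle $\bigcirc$), where $p(G;t)=\det(tI-A)$ is the characteristic polynomial of $G$.
   Context: Conventions. $\mathbb{N}=\mathbb{Z}_{\ge 0}$ and $[n]=\{1,\dots,n\}$. All graphs are finite and may have loops and multiple edges. The circle $\bigcirc$ is the graph consisting of a single edge with empty vertex set; graphs here are assumed not to have $\bigcirc$ as a connected component. A loop at $v$ is incident with $v$ twice: it counts twice in the degree of $v$ and occurs twice among the edges incident with $v$. Characteristic polynomial. The adjacency matrix $A$ of a graph $G=(V,E)$ is the $V\times V$ matrix for which $A(i,j)$, $i\ne j$, is the multiplicity of the edge $\{i,j\}$ in $E$, and $A(i,i)$ is twice the number of loops at $i$. The characteristic polynomial is $p(G;t):=\det(tI-A)$. Algebra. For $k,\ell\in\mathbb{N}$, $V_k$ is a complex vector space with basis $e_1,\dots,e_k$, and $V_{2\ell}$ is a (separate) complex vector space with basis $f_1,\dots,f_{2\ell}$. $SV_k$ is the symmetric algebra of $V_k$ (product written $\odot$) and $\bigwedge V_{2\ell}$ is the exterior algebra of $V_{2\ell}$ (product $\wedge$); empty products equal $1$. $(\cdot)^*$ is the full linear dual. Define $g_i:=-f_{i+\ell}$ for $i\le \ell$ and $g_i:=f_{i-\ell}$ for $i>\ell$. Eulerian subsets, orientations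 and pairings. Let $G=(V,E)$ be a graph. A subset $F\subseteq E$ is Eulerian if every vertex has even degree in $G(F):=(V,F)$. An Eulerian orientation $\omega$ of $F$ is an orientation of the edges in $F$ such that at each vertex the number of incoming arcs equals the number of outgoing arcs (a loop is both incoming and outgoing at its vertex). A local pairing $\kappa$ of $G(F)$ is, for each $v\in V$, a decomposition $\kappa_v$ of the edges of $F$ incident with $v$ into ordered pairs; it is compatible with $\omega$ if for each $v\in V$ and each $(a_1,a_2)\in\kappa_v$, $a_1$ is incoming at $v$ and $a_2$ is outgoing at $v$ under $\omega$ (so $\kappa_v$ is a bijection from the arcs of $F$ incoming at $v$ to those outgoing at $v$). Following each arc $a_1$ by the arc $a_2$ with which it is paired at the head of $a_1$ decomposes $F$ into circuits; $c(\kappa)$ is the number of these circuits. Mixed partition functions. An element $h\in (SV_k\otimes\bigwedge V_{2\ell})^*$ is called a $(k,2\ell)$-color edge coloring model. For $F\subseteq E$ Eulerian, with Eulerian orientation $\omega$ and compatible local pairing $\kappa$, set $$s_h(G,F,\omega,\kappa):=(-1)^{c(\kappa)}\sum_{\substack{\phi:F\to[2\ell]\\ \psi:E\setminus F\to[k]}}\ \prod_{v\in V}h\Big(\bigodot_{a\in\delta_{E\setminus F}(v)}e_{\psi(a)}\otimes\bigwedge_{(a_1,a_2)\in\kappa_v} f_{\phi(a_1)}\wedge g_{\phi(a_2)}\Big),$$ where $\delta_{E\setminus F}(v)$ is the collection of edges incident with $v$ not in $F$ (loops occurring twice). This value is known to be independent of the choice of $\omega$ and $\kappa$ and is denoted $s_h(G,F)$.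 The (mixed) partition function of $h$ is $$p_h(G):=\sum_{F\subseteq E,\ F\text{ Eulerian}}s_h(G,F).$$ -}

module Defs where

open import Algebra.Bundles using (AbelianGroup; CommutativeRing)
import Algebra.Construct.DirectProduct as DirectProduct
open import Algebra.Module.Bundles using (LeftModule)
import Algebra.Module.Construct.TensorUnit as TensorUnit
open import Algebra.Module.Morphism.Structures using (module LeftModuleMorphisms)
import Algebra.Properties.CommutativeMonoid.Sum as Sum
import Algebra.Properties.Group as GroupProperties
import Algebra.Properties.Monoid.Mult as Mult
import Algebra.Properties.Ring as RingProperties
import Algebra.Properties.Semiring.Exp as Exp
import Algebra.Solver.Ring.NaturalCoefficients.Default as SemiringSolver
open import Data.Bool.Base using (Bool; true; false; if_then_else_)
open import Data.Fin.Base as Fin using (Fin; zero; suc; toℕ; splitAt; _↑ˡ_; _↑ʳ_; punchIn)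
open import Data.Fin.Permutation as Perm using (Permutation′; _⟨$⟩ʳ_; _∘ₚ_; transpose; lift₀)
import Data.Fin.Properties as FinP
open import Data.Fin.Properties using (_≟_; all?; any?)
open import Data.List.Base using (List; []; _∷_; [_]; _++_; map; foldr; filter; length; tabulate; allFin; cartesianProduct; cartesianProductWith)
open import Data.List.Properties using (length-++)
open import Data.Nat.Base as ℕ using (ℕ; zero; suc)
open import Data.Nat.GeneralisedArithmetic using (fold)
import Data.Nat.Properties as ℕP
import Data.Nat.Solver as ℕSolver
open import Data.Product.Base using (Σ; ∃; _×_; _,_; proj₁; proj₂)
open import Data.Rational.Base as ℚ using (ℚ; 0ℚ; 1ℚ; ½)
import Data.Rational.Properties as ℚP
open import Data.Rational.Solver using (module +-*-Solver)
open import Data.Sum.Base using (_⊎_; inj₁; inj₂; [_,_]′)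
open import Data.Vec.Base as Vec using (Vec; lookup)
open import Data.Vec.Functional using (Vector; updateAt)
import Data.Vec.Functional as Vector
open import Data.Vec.Functional.Properties using (updateAt-updates; updateAt-minimal)
open import Data.Vec.Relation.Unary.AllPairs using (allPairs?)
open import Data.Vec.Relation.Unary.Unique.Propositional using (Unique)
open import Function.Base using (_∘_; const; id)
open import Level using (0ℓ)
open import Relation.Binary.PropositionalEquality using (_≡_; _≢_; refl; sym; trans; cong; cong₂; subst; module ≡-Reasoning)
open import Relation.Nullary using (Dec; yes; no; does; ¬_; contradiction)
open import Relation.Nullary.Decidable using (¬?; _×-dec_; _⊎-dec_)
open import Relation.Unary using (Decidable)

-- The reals are the Cauchy sequences of rationals.  Two sequences are
-- identified when the differences of late terms, taken independently in
-- the two sequences, become small; "x ~ x" thus says that x is Cauchy.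

module Reals where
  open import Data.Rational.Base using (_<_; _≤_; _+_; _*_; -_; _-_; ∣_∣)
  open ℚP.≤-Reasoning

  infix 4 _~_

  record _~_ (x y : ℕ → ℚ) : Set where
    constructor close
    field
      closeness : ∀ ε → 0ℚ < ε → ∃ λ N → ∀ m n → N ℕ.≤ m → N ℕ.≤ n → ∣ x m - y n ∣ < ε

  open _~_ public

  record ℝ : Set where
    constructor real
    field
      seq    : ℕ → ℚ
      cauchy : seq ~ seq

  open ℝ public

  private
    half : ∀ {ε} → 0ℚ < ε → 0ℚ < ½ * ε
    half {ε} 0<ε = subst (_< ½ * ε) (ℚP.*-zeroʳ ½) (ℚP.*-monoʳ-<-pos ½ 0<ε)

    halves : ∀ ε → ½ * ε + ½ * ε ≡ ε
    halves ε = trans (sym (ℚP.*-distribʳ-+ ε ½ ½)) (ℚP.*-identityˡ ε)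

    triangle : ∀ p q r ε δ → ∣ p - q ∣ < ε → ∣ q - r ∣ < δ → ∣ p - r ∣ < ε + δ
    triangle p q r ε δ p~q q~r = begin-strict
      ∣ p - r ∣              ≡⟨ cong ∣_∣ (solve 3 (λ p q r → p :- r := (p :- q) :+ (q :- r)) refl p q r) ⟩
      ∣ (p - q) + (q - r) ∣  ≤⟨ ℚP.∣p+q∣≤∣p∣+∣q∣ (p - q) (q - r) ⟩
      ∣ p - q ∣ + ∣ q - r ∣  <⟨ ℚP.+-mono-< p~q q~r ⟩
      ε + δ                  ∎
      where open +-*-Solver

    ∣p-q∣≡∣q-p∣ : ∀ p q → ∣ p - q ∣ ≡ ∣ q - p ∣
    ∣p-q∣≡∣q-p∣ p q = trans (sym (ℚP.∣-p∣≡∣p∣ (p - q)))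
      (cong ∣_∣ (solve 2 (λ p q → :- (p :- q) := q :- p) refl p q))
      where open +-*-Solver

  ~-sym : ∀ {x y} → x ~ y → y ~ x
  ~-sym {x} {y} x~y = close λ ε 0<ε →
    let N , small = closeness x~y ε 0<ε
    in N , λ m n N≤m N≤n → subst (_< ε) (∣p-q∣≡∣q-p∣ (x n) (y m)) (small n m N≤n N≤m)

  ~-trans : ∀ {x y z} → x ~ y → y ~ z → x ~ z
  ~-trans {x} {y} {z} x~y y~z = close λ ε 0<ε →
    let M , small₁ = closeness x~y (½ * ε) (half 0<ε)
        N , small₂ = closeness y~z (½ * ε) (half 0<ε)
    in M ℕ.⊔ N , λ m n M⊔N≤m M⊔N≤n → subst (∣ x m - z n ∣ <_) (halves ε)
      (triangle (x m) (y (M ℕ.⊔ N)) (z n) (½ * ε) (½ * ε)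
        (small₁ m _ (ℕP.m⊔n≤o⇒m≤o M N M⊔N≤m) (ℕP.m≤m⊔n M N))
        (small₂ _ n (ℕP.m≤n⊔m M N) (ℕP.m⊔n≤o⇒n≤o M N M⊔N≤n)))

  ≗⇒~ : ∀ {x y} → x ~ x → (∀ n → x n ≡ y n) → x ~ y
  ≗⇒~ {x} {y} x~x x≗y = close λ ε 0<ε →
    let N , small = closeness x~x ε 0<ε
    in N , λ m n N≤m N≤n → subst (λ q → ∣ x m - q ∣ < ε) (x≗y n) (small m n N≤m N≤n)

  const-~ : ∀ q → (λ _ → q) ~ (λ _ → q)
  const-~ q = close λ ε 0<ε →
    0 , λ _ _ _ _ → subst (_< ε) (cong ∣_∣ (sym (ℚP.+-inverseʳ q))) 0<ε

  +-~ : ∀ {x x′ y y′} → x ~ x′ → y ~ y′ → (λ n → x n + y n) ~ (λ n → x′ n + y′ n)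
  +-~ {x} {x′} {y} {y′} x~x′ y~y′ = close λ ε 0<ε →
    let M , small₁ = closeness x~x′ (½ * ε) (half 0<ε)
        N , small₂ = closeness y~y′ (½ * ε) (half 0<ε)
    in M ℕ.⊔ N , λ m n M⊔N≤m M⊔N≤n → begin-strict
    ∣ (x m + y m) - (x′ n + y′ n) ∣    ≡⟨ cong ∣_∣ (solve 4 (λ a b c d → (a :+ b) :- (c :+ d) := (a :- c) :+ (b :- d)) refl (x m) (y m) (x′ n) (y′ n)) ⟩
    ∣ (x m - x′ n) + (y m - y′ n) ∣    ≤⟨ ℚP.∣p+q∣≤∣p∣+∣q∣ (x m - x′ n) (y m - y′ n) ⟩
    ∣ x m - x′ n ∣ + ∣ y m - y′ n ∣    <⟨ ℚP.+-mono-<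
                                            (small₁ m n (ℕP.m⊔n≤o⇒m≤o M N M⊔N≤m) (ℕP.m⊔n≤o⇒m≤o M N M⊔N≤n))
                                            (small₂ m n (ℕP.m⊔n≤o⇒n≤o M N M⊔N≤m) (ℕP.m⊔n≤o⇒n≤o M N M⊔N≤n)) ⟩
    ½ * ε + ½ * ε                      ≡⟨ halves ε ⟩
    ε                                  ∎
    where open +-*-Solver

  neg-~ : ∀ {x x′} → x ~ x′ → (λ n → - x n) ~ (λ n → - x′ n)
  neg-~ {x} {x′} x~x′ = close λ ε 0<ε →
    let N , small = closeness x~x′ ε 0<ε
    in N , λ m n N≤m N≤n → subst (_< ε)
      (trans (sym (ℚP.∣-p∣≡∣p∣ (x m - x′ n)))
             (cong ∣_∣ (solve 2 (λ p q → :- (p :- q) := (:- p) :- (:- q)) refl (x m) (x′ n))))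
      (small m n N≤m N≤n)
    where open +-*-Solver

  private
    bounded : ∀ {x y} → x ~ y → ∃ λ B → 0ℚ < B × ∃ λ N → ∀ m → N ℕ.≤ m → ∣ x m ∣ < B
    bounded {x} {y} x~y with closeness x~y 1ℚ (ℚP.positive⁻¹ 1ℚ)
    ... | N , small = 1ℚ + ∣ y N ∣ , ℚP.+-mono-<-≤ (ℚP.positive⁻¹ 1ℚ) (ℚP.0≤∣p∣ (y N)) , N , λ m N≤m → begin-strict
      ∣ x m ∣                  ≡⟨ cong ∣_∣ (solve 2 (λ p q → p := (p :- q) :+ q) refl (x m) (y N)) ⟩
      ∣ (x m - y N) + y N ∣    ≤⟨ ℚP.∣p+q∣≤∣p∣+∣q∣ (x m - y N) (y N) ⟩
      ∣ x m - y N ∣ + ∣ y N ∣  <⟨ ℚP.+-mono-<-≤ (small m N N≤m ℕP.≤-refl) (ℚP.≤-refl {∣ y N ∣}) ⟩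
      1ℚ + ∣ y N ∣             ∎
      where open +-*-Solver

    scale : ∀ {B ε} → 0ℚ < B → 0ℚ < ε → ∃ λ δ → 0ℚ < δ × B * δ ≡ ε
    scale {B} {ε} 0<B 0<ε = ℚ.1/ B * ε , 0<δ , Bδ≡ε
      where
      instance
        B>0 = ℚ.positive 0<B
        ε>0 = ℚ.positive 0<ε
        B≢0 = ℚP.pos⇒nonZero B
        B⁻¹>0 = ℚP.1/pos⇒pos B

      0<δ : 0ℚ < ℚ.1/ B * ε
      0<δ = ℚP.positive⁻¹ (ℚ.1/ B * ε) {{ℚP.pos*pos⇒pos (ℚ.1/ B) ε}}

      Bδ≡ε : B * (ℚ.1/ B * ε) ≡ ε
      Bδ≡ε = trans (sym (ℚP.*-assoc B (ℚ.1/ B) ε))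
        (trans (cong (_* ε) (ℚP.*-inverseʳ B)) (ℚP.*-identityˡ ε))

    ∣p*q∣-bound : ∀ p q B δ → 0ℚ < B → ∣ p ∣ < B → ∣ q ∣ < δ → ∣ p * q ∣ < B * δ
    ∣p*q∣-bound p q B δ 0<B ∣p∣<B ∣q∣<δ = begin-strict
      ∣ p * q ∣      ≡⟨ ℚP.∣p*q∣≡∣p∣*∣q∣ p q ⟩
      ∣ p ∣ * ∣ q ∣  ≤⟨ ℚP.*-monoʳ-≤-nonNeg ∣ q ∣ {{ℚP.∣-∣-nonNeg q}} (ℚP.<⇒≤ ∣p∣<B) ⟩
      B * ∣ q ∣      <⟨ ℚP.*-monoʳ-<-pos B {{ℚ.positive 0<B}} ∣q∣<δ ⟩
      B * δ          ∎

    *-distribˡ-- : ∀ p q r → p * (q - r) ≡ p * q - p * r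
    *-distribˡ-- p q r = trans (ℚP.*-distribˡ-+ p q (- r))
      (cong (p * q +_) (sym (ℚP.neg-distribʳ-* p r)))

    ∣ab-a′b′∣-bound : ∀ a a′ b b′ A B α β → 0ℚ < A → 0ℚ < B → ∣ a ∣ < A → ∣ b′ ∣ < B →
                     ∣ a - a′ ∣ < β → ∣ b - b′ ∣ < α → ∣ a * b - a′ * b′ ∣ < A * α + B * β
    ∣ab-a′b′∣-bound a a′ b b′ A B α β 0<A 0<B ∣a∣<A ∣b′∣<B a-small b-small =
      triangle (a * b) (a * b′) (a′ * b′) (A * α) (B * β)
        (subst (λ p → ∣ p ∣ < A * α) (*-distribˡ-- a b b′)
          (∣p*q∣-bound a (b - b′) A α 0<A ∣a∣<A b-small))
        (subst (λ p → ∣ p ∣ < B * β)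
          (trans (*-distribˡ-- b′ a a′) (cong₂ _-_ (ℚP.*-comm b′ a) (ℚP.*-comm b′ a′)))
          (∣p*q∣-bound b′ (a - a′) B β 0<B ∣b′∣<B a-small))

  *-~ : ∀ {x x′ y y′} → x ~ x′ → y ~ y′ → (λ n → x n * y n) ~ (λ n → x′ n * y′ n)
  *-~ {x} {x′} {y} {y′} x~x′ y~y′ = close λ ε 0<ε →
    let A , 0<A , K , x<A  = bounded x~x′
        B , 0<B , L , y′<B = bounded (~-sym y~y′)
        α , 0<α , Aα≡½ε    = scale 0<A (half 0<ε)
        β , 0<β , Bβ≡½ε    = scale 0<B (half 0<ε)
        M , x-close        = closeness x~x′ β 0<β
        N , y-close        = closeness y~y′ α 0<α
    in (K ℕ.⊔ L) ℕ.⊔ (M ℕ.⊔ N) , λ m n ≤m ≤n →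
      let M⊔N≤m = ℕP.m⊔n≤o⇒n≤o (K ℕ.⊔ L) (M ℕ.⊔ N) ≤m
          M⊔N≤n = ℕP.m⊔n≤o⇒n≤o (K ℕ.⊔ L) (M ℕ.⊔ N) ≤n
          K≤m = ℕP.m⊔n≤o⇒m≤o K L (ℕP.m⊔n≤o⇒m≤o (K ℕ.⊔ L) (M ℕ.⊔ N) ≤m)
          L≤n = ℕP.m⊔n≤o⇒n≤o K L (ℕP.m⊔n≤o⇒m≤o (K ℕ.⊔ L) (M ℕ.⊔ N) ≤n)
      in subst (∣ x m * y m - x′ n * y′ n ∣ <_)
        (trans (cong₂ _+_ Aα≡½ε Bβ≡½ε) (halves ε))
        (∣ab-a′b′∣-bound (x m) (x′ n) (y m) (y′ n) A B α β 0<A 0<B (x<A m K≤m) (y′<B n L≤n)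
          (x-close m n (ℕP.m⊔n≤o⇒m≤o M N M⊔N≤m) (ℕP.m⊔n≤o⇒m≤o M N M⊔N≤n))
          (y-close m n (ℕP.m⊔n≤o⇒n≤o M N M⊔N≤m) (ℕP.m⊔n≤o⇒n≤o M N M⊔N≤n)))

  private
    constant : ℚ → ℝ
    constant q = real (λ _ → q) (const-~ q)

  realRing : CommutativeRing 0ℓ 0ℓ
  realRing = record
    { Carrier = ℝ
    ; _≈_ = λ x y → seq x ~ seq y
    ; _+_ = λ x y → real (λ n → seq x n + seq y n) (+-~ (cauchy x) (cauchy y))
    ; _*_ = λ x y → real (λ n → seq x n * seq y n) (*-~ (cauchy x) (cauchy y))
    ; -_ = λ x → real (λ n → - seq x n) (neg-~ (cauchy x))
    ; 0# = constant 0ℚ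
    ; 1# = constant 1ℚ
    ; isCommutativeRing = record
      { isRing = record
        { +-isAbelianGroup = record
          { isGroup = record
            { isMonoid = record
              { isSemigroup = record
                { isMagma = record
                  { isEquivalence = record
                    { refl = λ {x} → cauchy x ; sym = ~-sym ; trans = ~-trans }
                  ; ∙-cong = +-~
                  }
                ; assoc = λ x y z → ≗⇒~ (+-~ (+-~ (cauchy x) (cauchy y)) (cauchy z))
                    (λ n → ℚP.+-assoc (seq x n) (seq y n) (seq z n))
                }
              ; identity = (λ x → ≗⇒~ (+-~ (const-~ 0ℚ) (cauchy x)) (λ n → ℚP.+-identityˡ (seq x n)))
                         , (λ x → ≗⇒~ (+-~ (cauchy x) (const-~ 0ℚ)) (λ n → ℚP.+-identityʳ (seq x n)))
              }
            ; inverse = (λ x → ≗⇒~ (+-~ (neg-~ (cauchy x)) (cauchy x)) (λ n → ℚP.+-inverseˡ (seq x n)))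
                      , (λ x → ≗⇒~ (+-~ (cauchy x) (neg-~ (cauchy x))) (λ n → ℚP.+-inverseʳ (seq x n)))
            ; ⁻¹-cong = neg-~
            }
          ; comm = λ x y → ≗⇒~ (+-~ (cauchy x) (cauchy y)) (λ n → ℚP.+-comm (seq x n) (seq y n))
          }
        ; *-cong = *-~
        ; *-assoc = λ x y z → ≗⇒~ (*-~ (*-~ (cauchy x) (cauchy y)) (cauchy z))
            (λ n → ℚP.*-assoc (seq x n) (seq y n) (seq z n))
        ; *-identity = (λ x → ≗⇒~ (*-~ (const-~ 1ℚ) (cauchy x)) (λ n → ℚP.*-identityˡ (seq x n)))
                     , (λ x → ≗⇒~ (*-~ (cauchy x) (const-~ 1ℚ)) (λ n → ℚP.*-identityʳ (seq x n)))
        ; distrib = (λ x y z → ≗⇒~ (*-~ (cauchy x) (+-~ (cauchy y) (cauchy z)))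
                      (λ n → ℚP.*-distribˡ-+ (seq x n) (seq y n) (seq z n)))
                  , (λ x y z → ≗⇒~ (*-~ (+-~ (cauchy y) (cauchy z)) (cauchy x))
                      (λ n → ℚP.*-distribʳ-+ (seq x n) (seq y n) (seq z n)))
        }
      ; *-comm = λ x y → ≗⇒~ (*-~ (cauchy x) (cauchy y)) (λ n → ℚP.*-comm (seq x n) (seq y n))
      }
    }

-- Adjoining a square root of -1: (a , b) stands for a + b·i.

module AdjoinI (R : CommutativeRing 0ℓ 0ℓ) where
  open CommutativeRing R renaming (refl to ≈-refl; sym to ≈-sym; trans to ≈-trans)
  open RingProperties ring using (-1*x≈-x; -0#≈0#)
  open SemiringSolver commutativeSemiring using (solve; _:=_; _:+_; _:*_)

  C : Set
  C = Carrier × Carrier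

  infix 4 _≈ᶜ_
  infixl 6 _+ᶜ_
  infixl 7 _*ᶜ_

  _≈ᶜ_ : C → C → Set
  (a , b) ≈ᶜ (c , d) = a ≈ c × b ≈ d

  _+ᶜ_ _*ᶜ_ : C → C → C
  (a , b) +ᶜ (c , d) = a + c , b + d
  (a , b) *ᶜ (c , d) = a * c - b * d , a * d + b * c

  -ᶜ_ : C → C
  -ᶜ (a , b) = - a , - b

  private
    neg : ∀ x → - x ≈ - 1# * x
    neg x = ≈-sym (-1*x≈-x x)

    minus : ∀ x y → x - y ≈ x + - 1# * y
    minus x y = +-congˡ (neg y)

  *ᶜ-cong : ∀ {x x′ y y′} → x ≈ᶜ x′ → y ≈ᶜ y′ → x *ᶜ y ≈ᶜ x′ *ᶜ y′
  *ᶜ-cong (a , b) (c , d) =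
    +-cong (*-cong a c) (-‿cong (*-cong b d)) , +-cong (*-cong a d) (*-cong b c)

  *ᶜ-assoc : ∀ x y z → (x *ᶜ y) *ᶜ z ≈ᶜ x *ᶜ (y *ᶜ z)
  *ᶜ-assoc (a , b) (c , d) (e , f) =
    ≈-trans (minus _ _) (≈-trans (+-congʳ (*-congʳ (minus _ _)))
      (≈-trans
        (solve 7 (λ n a b c d e f →
            (a :* c :+ n :* (b :* d)) :* e :+ n :* ((a :* d :+ b :* c) :* f)
            := a :* (c :* e :+ n :* (d :* f)) :+ n :* (b :* (c :* f :+ d :* e)))
          ≈-refl (- 1#) a b c d e f)
        (≈-sym (≈-trans (minus _ _) (+-congʳ (*-congˡ (minus _ _)))))))
    ,
    ≈-trans (+-congʳ (*-congʳ (minus _ _)))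
      (≈-trans
        (solve 7 (λ n a b c d e f →
            (a :* c :+ n :* (b :* d)) :* f :+ (a :* d :+ b :* c) :* e
            := a :* (c :* f :+ d :* e) :+ b :* (c :* e :+ n :* (d :* f)))
          ≈-refl (- 1#) a b c d e f)
        (≈-sym (+-congˡ (*-congˡ (minus _ _)))))

  *ᶜ-comm : ∀ x y → x *ᶜ y ≈ᶜ y *ᶜ x
  *ᶜ-comm (a , b) (c , d) =
    +-cong (*-comm a c) (-‿cong (*-comm b d)) ,
    ≈-trans (+-comm _ _) (+-cong (*-comm b c) (*-comm a d))

  *ᶜ-identityˡ : ∀ x → (1# , 0#) *ᶜ x ≈ᶜ x
  *ᶜ-identityˡ (a , b) =
    ≈-trans (+-cong (*-identityˡ a) (≈-trans (-‿cong (zeroˡ b)) -0#≈0#)) (+-identityʳ a) ,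
    ≈-trans (+-cong (*-identityˡ b) (zeroˡ a)) (+-identityʳ b)

  *ᶜ-distribˡ : ∀ x y z → x *ᶜ (y +ᶜ z) ≈ᶜ x *ᶜ y +ᶜ x *ᶜ z
  *ᶜ-distribˡ (a , b) (c , d) (e , f) =
    ≈-trans (minus _ _)
      (≈-trans
        (solve 7 (λ n a b c d e f →
            a :* (c :+ e) :+ n :* (b :* (d :+ f))
            := (a :* c :+ n :* (b :* d)) :+ (a :* e :+ n :* (b :* f)))
          ≈-refl (- 1#) a b c d e f)
        (≈-sym (+-cong (minus _ _) (minus _ _))))
    ,
    solve 6 (λ a b c d e f →
        a :* (d :+ f) :+ b :* (c :+ e) := (a :* d :+ b :* c) :+ (a :* f :+ b :* e))
      ≈-refl a b c d e f

  commutativeRing : CommutativeRing 0ℓ 0ℓ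
  commutativeRing = record
    { Carrier = C
    ; _≈_ = _≈ᶜ_
    ; _+_ = _+ᶜ_
    ; _*_ = _*ᶜ_
    ; -_ = -ᶜ_
    ; 0# = 0# , 0#
    ; 1# = 1# , 0#
    ; isCommutativeRing = record
      { isRing = record
        { +-isAbelianGroup = A.isAbelianGroup
        ; *-cong = *ᶜ-cong
        ; *-assoc = *ᶜ-assoc
        ; *-identity = *ᶜ-identityˡ , λ x → A.trans (*ᶜ-comm x _) (*ᶜ-identityˡ x)
        ; distrib = *ᶜ-distribˡ , λ x y z → A.trans (*ᶜ-comm (y +ᶜ z) x)
            (A.trans (*ᶜ-distribˡ x y z) (A.∙-cong (*ᶜ-comm x y) (*ᶜ-comm x z)))
        }
      ; *-comm = *ᶜ-comm
      }
    }
    where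
    module A = AbelianGroup (DirectProduct.abelianGroup +-abelianGroup +-abelianGroup)

complexRing : CommutativeRing 0ℓ 0ℓ
complexRing = AdjoinI.commutativeRing Reals.realRing

open import Data.Fin.Subset using (Subset; inside; outside; ∣_∣; ∁)
open import Data.Nat.Divisibility using (_∣_; _∣?_; ∣m+n∣m⇒∣n; m∣m*n; ∣1⇒≡1)

-- src and tgt merely name the two ends of an edge: the graph is
-- undirected.  An edge with equal ends is a loop.  Since every edge has
-- ends in the vertex set, no component is a vertexless circle.

record Graph : Set where
  field
    #V #E   : ℕ
    src tgt : Fin #E → Fin #V

open Graph public

-- The edges of F, in increasing order.

elements : ∀ {m} (F : Subset m) → Fin ∣ F ∣ → Fin m
elements (inside  Vec.∷ F) zero    = zero
elements (inside  Vec.∷ F) (suc a) = suc (elements F a)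
elements (outside Vec.∷ F) a       = suc (elements F a)

infixl 8 _↾_

_↾_ : (G : Graph) → Subset (#E G) → Graph
G ↾ F = record
  { #V  = #V G
  ; #E  = ∣ F ∣
  ; src = src G ∘ elements F
  ; tgt = tgt G ∘ elements F
  }

-- A loop at v occurs twice.

incident : (H : Graph) → Fin (#V H) → List (Fin (#E H))
incident H v = filter (λ e → src H e ≟ v) (allFin (#E H))
            ++ filter (λ e → tgt H e ≟ v) (allFin (#E H))

degree : (H : Graph) → Fin (#V H) → ℕ
degree H v = length (incident H v)

EvenDegrees : Graph → Set
EvenDegrees H = ∀ v → 2 ∣ degree H v

Eulerian : (G : Graph) → Subset (#E G) → Set
Eulerian G F = EvenDegrees (G ↾ F)

eulerian? : (G : Graph) → Decidable (Eulerian G)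
eulerian? G F = all? λ v → 2 ∣? degree (G ↾ F) v

record Orientation (H : Graph) : Set where
  field
    forward : Fin (#E H) → Bool

  tail head : Fin (#E H) → Fin (#V H)
  tail a = if forward a then src H a else tgt H a
  head a = if forward a then tgt H a else src H a

  incoming outgoing : Fin (#V H) → List (Fin (#E H))
  incoming v = filter (λ a → head a ≟ v) (allFin (#E H))
  outgoing v = filter (λ a → tail a ≟ v) (allFin (#E H))

record EulerianOrientation (H : Graph) : Set where
  field
    orientation : Orientation H

  open Orientation orientation public

  field
    balanced : ∀ v → length (incoming v) ≡ length (outgoing v)

-- Every arc is incoming at exactly one vertex and outgoing at exactly one
-- vertex, so the bijections κᵥ : incoming v → outgoing v together form a
-- permutation κ of the arcs; the pairs in κᵥ are the (a , κ a) with a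
-- incoming at v.

record CompatiblePairing {H : Graph} (ω : EulerianOrientation H) : Set where
  open EulerianOrientation ω
  field
    κ          : Permutation′ (#E H)
    compatible : ∀ a → tail (κ ⟨$⟩ʳ a) ≡ head a

-- The circuits are the orbits of κ, each counted at its least arc.

LeastInOrbit : ∀ {n} → Permutation′ n → Fin n → Set
LeastInOrbit {n} κ a = ∀ (j : Fin n) → a Fin.≤ fold a (κ ⟨$⟩ʳ_) (toℕ j)

leastInOrbit? : ∀ {n} (κ : Permutation′ n) → Decidable (LeastInOrbit κ)
leastInOrbit? κ a = all? λ j → a FinP.≤? fold a (κ ⟨$⟩ʳ_) (toℕ j)

circuits : ∀ {n} → Permutation′ n → ℕ
circuits {n} κ = length (filter (leastInOrbit? κ) (allFin n))

PairedOrientation : Graph → Set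
PairedOrientation H = Σ (EulerianOrientation H) CompatiblePairing

Joins : (G : Graph) → Fin (#V G) → Fin (#V G) → Fin (#E G) → Set
Joins G i j e = (src G e ≡ i × tgt G e ≡ j) ⊎ (src G e ≡ j × tgt G e ≡ i)

joins? : (G : Graph) → ∀ i j → Decidable (Joins G i j)
joins? G i j e = (src G e ≟ i ×-dec tgt G e ≟ j) ⊎-dec (src G e ≟ j ×-dec tgt G e ≟ i)

multiplicity : (G : Graph) → Fin (#V G) → Fin (#V G) → ℕ
multiplicity G i j = length (filter (joins? G i j) (allFin (#E G)))

adjacency : (G : Graph) → Fin (#V G) → Fin (#V G) → ℕ
adjacency G i j = if does (i ≟ j) then 2 ℕ.* multiplicity G i i else multiplicity G i j

-- Every graph with even degrees has a paired orientation: splitting off two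
-- edges at a vertex leaves a smaller such graph.

module Splitting where
  open Sum ℕP.+-0-commutativeMonoid
  open ≡-Reasoning

  ind : ∀ {n} → Fin n → Fin n → ℕ
  ind x v = if does (x ≟ v) then 1 else 0

  deg : ∀ {m n} → (Fin m → Fin n) → (Fin m → Fin n) → Fin n → ℕ
  deg s t v = sum λ a → ind (s a) v ℕ.+ ind (t a) v

  record Solution {m n} (s t : Fin m → Fin n) : Set where
    field
      tail head : Fin m → Fin n
      ends      : ∀ a → (tail a ≡ s a × head a ≡ t a) ⊎ (tail a ≡ t a × head a ≡ s a)
      κ         : Permutation′ m
      follows   : ∀ a → tail (κ ⟨$⟩ʳ a) ≡ head a

  ind-refl : ∀ {n} (v : Fin n) → ind v v ≡ 1
  ind-refl v with v ≟ v
  ... | yes _   = refl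
  ... | no v≢v = contradiction refl v≢v

  ind-≢ : ∀ {n} {x v : Fin n} → x ≢ v → ind x v ≡ 0
  ind-≢ {x = x} {v} x≢v with x ≟ v
  ... | yes x≡v = contradiction x≡v x≢v
  ... | no _    = refl

  double : ∀ n → 2 ∣ n ℕ.+ n
  double n = subst (2 ∣_) (cong (n ℕ.+_) (ℕP.+-identityʳ n)) (m∣m*n n)

  infixr 5 _◂_
  _◂_ : ∀ {A : Set} {m} → A → (Fin m → A) → Fin (suc m) → A
  _◂_ = Vector._∷_

  transpose-◂ : ∀ {m} {A : Set} (f : Fin m → A) (j : Fin m) (x : A) b →
    (f j ◂ updateAt f j (const x)) (transpose zero (suc j) ⟨$⟩ʳ b) ≡ (x ◂ f) b
  transpose-◂ f j x zero = updateAt-updates j f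
  transpose-◂ f j x (suc b) with b ≟ j
  ... | yes refl = refl
  ... | no b≢j   = updateAt-minimal b j f b≢j

  transpose-◂′ : ∀ {m} {A : Set} (f : Fin m → A) (j : Fin m) (x : A) b →
    (x ◂ f) (transpose zero (suc j) ⟨$⟩ʳ b) ≡ (f j ◂ updateAt f j (const x)) b
  transpose-◂′ f j x zero = refl
  transpose-◂′ f j x (suc b) with b ≟ j
  ... | yes refl = sym (updateAt-updates j f)
  ... | no b≢j   = sym (updateAt-minimal b j f b≢j)

  -- Edge zero joins u and v, edge suc j joins v and w.  In the smaller
  -- graph edge j joins u and w.

  module Split {m n} (s t : Fin (suc m) → Fin n) (j : Fin m) (w : Fin n)
    (vw : (s (suc j) ≡ t zero × t (suc j) ≡ w) ⊎ (t (suc j) ≡ t zero × s (suc j) ≡ w))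
    where

    u v : Fin n
    u = s zero
    v = t zero

    s′ t′ : Fin m → Fin n
    s′ = updateAt (s ∘ suc) j (const u)
    t′ = updateAt (t ∘ suc) j (const w)

    ends-vw : ∀ x → ind (s (suc j)) x ℕ.+ ind (t (suc j)) x ≡ ind v x ℕ.+ ind w x
    ends-vw x =
      [ (λ (p , q) → cong₂ (λ y z → ind y x ℕ.+ ind z x) p q)
      , (λ (p , q) → trans (ℕP.+-comm (ind (s (suc j)) x) _) (cong₂ (λ y z → ind y x ℕ.+ ind z x) p q))
      ]′ vw

    deg-split : ∀ x → deg s t x ≡ (ind v x ℕ.+ ind v x) ℕ.+ deg s′ t′ x
    deg-split x = at m j (s ∘ suc) (t ∘ suc) s′ t′ (ends-vw x)
        (cong₂ (λ y z → ind y x ℕ.+ ind z x) (updateAt-updates j (s ∘ suc)) (updateAt-updates j (t ∘ suc)))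
        (λ a a≢j → cong₂ (λ y z → ind y x ℕ.+ ind z x) (updateAt-minimal a j (s ∘ suc) a≢j) (updateAt-minimal a j (t ∘ suc) a≢j))
      where
      at : ∀ m (j : Fin m) (a b a′ b′ : Fin m → Fin n) →
        ind (a j) x ℕ.+ ind (b j) x ≡ ind v x ℕ.+ ind w x →
        ind (a′ j) x ℕ.+ ind (b′ j) x ≡ ind u x ℕ.+ ind w x →
        (∀ i → i ≢ j → ind (a′ i) x ℕ.+ ind (b′ i) x ≡ ind (a i) x ℕ.+ ind (b i) x) →
        (ind u x ℕ.+ ind v x) ℕ.+ deg a b x ≡ (ind v x ℕ.+ ind v x) ℕ.+ deg a′ b′ x
      at (suc m) j a b a′ b′ old new same = begin
        (U ℕ.+ V) ℕ.+ deg a b x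
          ≡⟨ cong ((U ℕ.+ V) ℕ.+_) (sum-remove {i = j} (λ i → ind (a i) x ℕ.+ ind (b i) x)) ⟩
        (U ℕ.+ V) ℕ.+ ((ind (a j) x ℕ.+ ind (b j) x) ℕ.+ rest)
          ≡⟨ cong (λ y → (U ℕ.+ V) ℕ.+ (y ℕ.+ rest)) old ⟩
        (U ℕ.+ V) ℕ.+ ((V ℕ.+ W) ℕ.+ rest)
          ≡⟨ solve 4 (λ U V W r → (U :+ V) :+ ((V :+ W) :+ r) := (V :+ V) :+ ((U :+ W) :+ r)) refl U V W rest ⟩
        (V ℕ.+ V) ℕ.+ ((U ℕ.+ W) ℕ.+ rest)
          ≡⟨ cong₂ (λ y z → (V ℕ.+ V) ℕ.+ (y ℕ.+ z)) new
               (sum-cong-≗ {m} (λ k → same (punchIn j k) (FinP.punchInᵢ≢i j k))) ⟨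
        (V ℕ.+ V) ℕ.+ ((ind (a′ j) x ℕ.+ ind (b′ j) x) ℕ.+ rest′)
          ≡⟨ cong ((V ℕ.+ V) ℕ.+_) (sum-remove {i = j} (λ i → ind (a′ i) x ℕ.+ ind (b′ i) x)) ⟨
        (V ℕ.+ V) ℕ.+ deg a′ b′ x ∎
        where
        open ℕSolver.+-*-Solver
        U V W rest rest′ : ℕ
        U = ind u x
        V = ind v x
        W = ind w x
        rest  = sum (Vector.removeAt (λ i → ind (a i) x ℕ.+ ind (b i) x) j)
        rest′ = sum (Vector.removeAt (λ i → ind (a′ i) x ℕ.+ ind (b′ i) x) j)

    module _ (sol : Solution s′ t′) where
      private
        module S = Solution sol

      ends-other : ∀ a → a ≢ j → (S.tail a ≡ s (suc a) × S.head a ≡ t (suc a))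
                               ⊎ (S.tail a ≡ t (suc a) × S.head a ≡ s (suc a))
      ends-other a a≢j with S.ends a
      ... | inj₁ (p , q) = inj₁ (trans p (updateAt-minimal a j (s ∘ suc) a≢j)
                                , trans q (updateAt-minimal a j (t ∘ suc) a≢j))
      ... | inj₂ (p , q) = inj₂ (trans p (updateAt-minimal a j (t ∘ suc) a≢j)
                                , trans q (updateAt-minimal a j (s ∘ suc) a≢j))

      uw : (S.tail j ≡ u × S.head j ≡ w) ⊎ (S.tail j ≡ w × S.head j ≡ u)
      uw with S.ends j
      ... | inj₁ (p , q) = inj₁ (trans p (updateAt-updates j (s ∘ suc)) , trans q (updateAt-updates j (t ∘ suc)))
      ... | inj₂ (p , q) = inj₂ (trans p (updateAt-updates j (t ∘ suc)) , trans q (updateAt-updates j (s ∘ suc)))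

      lifted : ∀ {x : Fin n} b → (x ◂ S.tail) (lift₀ S.κ ⟨$⟩ʳ b) ≡ (x ◂ S.head) b
      lifted zero    = refl
      lifted (suc b) = S.follows b

      merge : Solution s t
      merge with uw
      ... | inj₁ (tail≡u , head≡w) = record
        { tail = S.tail j ◂ updateAt S.tail j (const v)
        ; head = v ◂ S.head
        ; ends = λ { zero → inj₁ (tail≡u , refl) ; (suc a) → endsₐ a }
        ; κ = lift₀ S.κ ∘ₚ transpose zero (suc j)
        ; follows = λ a → trans (transpose-◂ S.tail j v (lift₀ S.κ ⟨$⟩ʳ a)) (lifted a)
        }
        where
        endsₐ : ∀ a → (updateAt S.tail j (const v) a ≡ s (suc a) × S.head a ≡ t (suc a))
                    ⊎ (updateAt S.tail j (const v) a ≡ t (suc a) × S.head a ≡ s (suc a))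
        endsₐ a with a ≟ j
        ... | no a≢j rewrite updateAt-minimal a j {const v} S.tail a≢j = ends-other a a≢j
        ... | yes refl rewrite updateAt-updates j {const v} S.tail =
          [ (λ (p , q) → inj₁ (sym p , trans head≡w (sym q)))
          , (λ (p , q) → inj₂ (sym p , trans head≡w (sym q))) ]′ vw
      ... | inj₂ (tail≡w , head≡u) = record
        { tail = v ◂ S.tail
        ; head = S.head j ◂ updateAt S.head j (const v)
        ; ends = λ { zero → inj₂ (refl , head≡u) ; (suc a) → endsₐ a }
        ; κ = transpose zero (suc j) ∘ₚ lift₀ S.κ
        ; follows = λ a → trans (lifted (transpose zero (suc j) ⟨$⟩ʳ a)) (transpose-◂′ S.head j v a)
        }
        where
        endsₐ : ∀ a → (S.tail a ≡ s (suc a) × updateAt S.head j (const v) a ≡ t (suc a))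
                    ⊎ (S.tail a ≡ t (suc a) × updateAt S.head j (const v) a ≡ s (suc a))
        endsₐ a with a ≟ j
        ... | no a≢j rewrite updateAt-minimal a j {const v} S.head a≢j = ends-other a a≢j
        ... | yes refl rewrite updateAt-updates j {const v} S.head =
          [ (λ (p , q) → inj₂ (trans tail≡w (sym q) , sym p))
          , (λ (p , q) → inj₁ (trans tail≡w (sym q) , sym p)) ]′ vw

  solution : ∀ {m n} (s t : Fin m → Fin n) → (∀ v → 2 ∣ deg s t v) → Solution s t
  solution {zero} s t even = record
    { tail = s ; head = t ; ends = λ () ; κ = Perm.id ; follows = λ () }
  solution {suc m} s t even with s zero ≟ t zero
  ... | yes u≡v = record
    { tail = s zero ◂ S.tail
    ; head = t zero ◂ S.head
    ; ends = λ { zero → inj₁ (refl , refl) ; (suc a) → S.ends a }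
    ; κ = lift₀ S.κ
    ; follows = λ { zero → u≡v ; (suc a) → S.follows a }
    }
    where
    module S = Solution (solution (s ∘ suc) (t ∘ suc) λ x →
      ∣m+n∣m⇒∣n (even x) (subst (λ v → 2 ∣ ind (s zero) x ℕ.+ ind v x) u≡v (double (ind (s zero) x))))
  ... | no u≢v with any? (λ j → (s (suc j) ≟ t zero) ⊎-dec (t (suc j) ≟ t zero))
  ...   | no none = contradiction (∣1⇒≡1 (subst (2 ∣_) odd (even v))) λ ()
    where
    v = t zero
    odd : deg s t v ≡ 1
    odd = cong₂ ℕ._+_ (cong₂ ℕ._+_ (ind-≢ u≢v) (ind-refl v))
      (trans (sum-cong-≗ {m} (λ j → cong₂ ℕ._+_ (ind-≢ (λ p → none (j , inj₁ p))) (ind-≢ (λ p → none (j , inj₂ p)))))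
             (sum-replicate-zero m))
  ...   | yes (j , touches) = merge (solution s′ t′ λ x →
            ∣m+n∣m⇒∣n (subst (2 ∣_) (deg-split x) (even x)) (double (ind (t zero) x)))
    where
    other : ∃ λ w → (s (suc j) ≡ t zero × t (suc j) ≡ w) ⊎ (t (suc j) ≡ t zero × s (suc j) ≡ w)
    other = [ (λ p → t (suc j) , inj₁ (p , refl)) , (λ p → s (suc j) , inj₂ (p , refl)) ]′ touches
    open Split s t j (proj₁ other) (proj₂ other)

  length-filter : ∀ {m n k} (f : Fin n → Fin k) (x : Fin m → Fin n) v →
    length (filter (λ a → f a ≟ v) (tabulate x)) ≡ sum (λ a → ind (f (x a)) v)
  length-filter {zero}  f x v = refl
  length-filter {suc m} f x v with f (x zero) ≟ v
  ... | yes _ = cong suc (length-filter f (x ∘ suc) v)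
  ... | no _  = length-filter f (x ∘ suc) v

pairedOrientation : ∀ H → EvenDegrees H → PairedOrientation H
pairedOrientation H even = record { orientation = orientation ; balanced = balanced }
                         , record { κ = S.κ ; compatible = compatible }
  where
  open Splitting
  open Sum ℕP.+-0-commutativeMonoid

  degree≡deg : ∀ v → degree H v ≡ deg (src H) (tgt H) v
  degree≡deg v = trans (length-++ (filter (λ e → src H e ≟ v) (allFin (#E H))))
    (trans (cong₂ ℕ._+_ (length-filter (src H) id v) (length-filter (tgt H) id v))
           (sym (∑-distrib-+ (λ a → ind (src H a) v) (λ a → ind (tgt H a) v))))

  module S = Solution (solution (src H) (tgt H) λ v → subst (2 ∣_) (degree≡deg v) (even v))

  forward : Fin (#E H) → Bool
  forward a = [ const true , const false ]′ (S.ends a)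

  orientation : Orientation H
  orientation = record { forward = forward }

  open Orientation orientation using (tail; head; incoming; outgoing)

  tail≡ : ∀ a → tail a ≡ S.tail a
  tail≡ a with S.ends a
  ... | inj₁ (p , _) = sym p
  ... | inj₂ (p , _) = sym p

  head≡ : ∀ a → head a ≡ S.head a
  head≡ a with S.ends a
  ... | inj₁ (_ , q) = sym q
  ... | inj₂ (_ , q) = sym q

  compatible : ∀ a → tail (S.κ ⟨$⟩ʳ a) ≡ head a
  compatible a = trans (tail≡ (S.κ ⟨$⟩ʳ a)) (trans (S.follows a) (sym (head≡ a)))

  balanced : ∀ v → length (incoming v) ≡ length (outgoing v)
  balanced v = trans (length-filter head id v)
    (trans (sum-cong-≗ (λ a → cong (λ x → ind x v) (sym (compatible a))))
    (trans (sym (sum-permute (λ a → ind (tail a) v) S.κ))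
           (sym (length-filter tail id v))))

module LinearAlgebra (K : CommutativeRing 0ℓ 0ℓ) where
  open CommutativeRing K renaming (refl to ≈-refl; sym to ≈-sym; trans to ≈-trans)
  open LeftModule using (Carrierᴹ)

  Mod : Set₁
  Mod = LeftModule ring 0ℓ 0ℓ

  record IsScaling (A : AbelianGroup 0ℓ 0ℓ) (_·_ : Carrier → AbelianGroup.Carrier A → AbelianGroup.Carrier A) : Set where
    open AbelianGroup A using (_∙_) renaming (_≈_ to _≃_)
    field
      ·-cong     : ∀ {r s x y} → r ≈ s → x ≃ y → (r · x) ≃ (s · y)
      ·-distribˡ : ∀ r x y → (r · (x ∙ y)) ≃ ((r · x) ∙ (r · y))
      ·-distribʳ : ∀ x r s → ((r + s) · x) ≃ ((r · x) ∙ (s · x))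
      ·-assoc    : ∀ r s x → ((r * s) · x) ≃ (r · (s · x))
      ·-identity : ∀ x → (1# · x) ≃ x

  mkModule : (A : AbelianGroup 0ℓ 0ℓ) {_·_ : Carrier → AbelianGroup.Carrier A → AbelianGroup.Carrier A} →
             IsScaling A _·_ → Mod
  mkModule A {_·_} isScaling = record
    { Carrierᴹ = A.Carrier
    ; _≈ᴹ_ = A._≈_
    ; _+ᴹ_ = A._∙_
    ; _*ₗ_ = _·_
    ; 0ᴹ = A.ε
    ; -ᴹ_ = A._⁻¹
    ; isLeftModule = record
      { isLeftSemimodule = record
        { +ᴹ-isCommutativeMonoid = A.isCommutativeMonoid
        ; isPreleftSemimodule = record
          { *ₗ-cong = ·-cong
          ; *ₗ-zeroˡ = λ x → identityʳ-unique (0# · x) (0# · x)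
              (A.trans (A.sym (·-distribʳ x 0# 0#)) (·-cong (+-identityˡ 0#) A.refl))
          ; *ₗ-distribʳ = ·-distribʳ
          ; *ₗ-identityˡ = ·-identity
          ; *ₗ-assoc = ·-assoc
          ; *ₗ-zeroʳ = λ r → identityʳ-unique (r · A.ε) (r · A.ε)
              (A.trans (A.sym (·-distribˡ r A.ε A.ε)) (·-cong ≈-refl (A.identityˡ A.ε)))
          ; *ₗ-distribˡ = ·-distribˡ
          }
        }
      ; -ᴹ‿cong = A.⁻¹-cong
      ; -ᴹ‿inverse = A.inverse
      }
    }
    where
    module A = AbelianGroup A
    open GroupProperties A.group using (identityʳ-unique)
    open IsScaling isScaling

  Free : ℕ → Mod
  Free n = mkModule
    (record
      { Carrier = Vector Carrier n
      ; _≈_ = λ x y → ∀ i → x i ≈ y i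
      ; _∙_ = λ x y i → x i + y i
      ; ε = λ _ → 0#
      ; _⁻¹ = λ x i → - x i
      ; isAbelianGroup = record
        { isGroup = record
          { isMonoid = record
            { isSemigroup = record
              { isMagma = record
                { isEquivalence = record
                  { refl = λ _ → ≈-refl
                  ; sym = λ p i → ≈-sym (p i)
                  ; trans = λ p q i → ≈-trans (p i) (q i)
                  }
                ; ∙-cong = λ p q i → +-cong (p i) (q i)
                }
              ; assoc = λ x y z i → +-assoc (x i) (y i) (z i)
              }
            ; identity = (λ x i → +-identityˡ (x i)) , (λ x i → +-identityʳ (x i))
            }
          ; inverse = (λ x i → -‿inverseˡ (x i)) , (λ x i → -‿inverseʳ (x i))
          ; ⁻¹-cong = λ p i → -‿cong (p i)
          }
        ; comm = λ x y i → +-comm (x i) (y i)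
        }
      })
    {λ r x i → r * x i}
    (record
      { ·-cong = λ r≈s p i → *-cong r≈s (p i)
      ; ·-distribˡ = λ r x y i → distribˡ r (x i) (y i)
      ; ·-distribʳ = λ x r s i → distribʳ (x i) r s
      ; ·-assoc = λ r s x i → *-assoc r s (x i)
      ; ·-identity = λ x i → *-identityˡ (x i)
      })

  basis : ∀ {n} → Fin n → Carrierᴹ (Free n)
  basis i j = if does (i ≟ j) then 1# else 0#

  module TensorAlgebra (M : Mod) where
    open LeftModule M using (_≈ᴹ_; _+ᴹ_; _*ₗ_)

    infixl 6 _⊕_
    infixl 7 _⊙_
    infixr 8 _·_
    infix  8 ⊖_

    data Tensor : Set where
      ι       : Carrierᴹ M → Tensor
      𝟘 𝟙     : Tensor
      _⊕_ _⊙_ : Tensor → Tensor → Tensor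
      ⊖_      : Tensor → Tensor
      _·_     : Carrier → Tensor → Tensor

    -- The least congruence containing _∼_ for which the terms form a unital
    -- associative K-algebra and ι is linear.

    module Quotient (_∼_ : Tensor → Tensor → Set) where
      infix 4 _≋_

      data _≋_ : Tensor → Tensor → Set where
        relation    : ∀ {x y} → x ∼ y → x ≋ y
        ≋-refl      : ∀ {x} → x ≋ x
        ≋-sym       : ∀ {x y} → x ≋ y → y ≋ x
        ≋-trans     : ∀ {x y z} → x ≋ y → y ≋ z → x ≋ z
        ι-cong      : ∀ {x y} → x ≈ᴹ y → ι x ≋ ι y
        ⊕-cong      : ∀ {x x′ y y′} → x ≋ x′ → y ≋ y′ → x ⊕ y ≋ x′ ⊕ y′
        ⊙-cong      : ∀ {x x′ y y′} → x ≋ x′ → y ≋ y′ → x ⊙ y ≋ x′ ⊙ y′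
        ⊖-cong      : ∀ {x y} → x ≋ y → ⊖ x ≋ ⊖ y
        ·-cong      : ∀ {r s x y} → r ≈ s → x ≋ y → r · x ≋ s · y
        ι-+         : ∀ x y → ι (x +ᴹ y) ≋ ι x ⊕ ι y
        ι-·         : ∀ r x → ι (r *ₗ x) ≋ r · ι x
        ⊕-assoc     : ∀ x y z → (x ⊕ y) ⊕ z ≋ x ⊕ (y ⊕ z)
        ⊕-comm      : ∀ x y → x ⊕ y ≋ y ⊕ x
        ⊕-identityˡ : ∀ x → 𝟘 ⊕ x ≋ x
        ⊖-inverseˡ  : ∀ x → ⊖ x ⊕ x ≋ 𝟘
        ·-distribˡ  : ∀ r x y → r · (x ⊕ y) ≋ r · x ⊕ r · y
        ·-distribʳ  : ∀ x r s → (r + s) · x ≋ r · x ⊕ s · x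
        ·-assoc     : ∀ r s x → (r * s) · x ≋ r · s · x
        ·-identity  : ∀ x → 1# · x ≋ x
        ⊙-assoc     : ∀ x y z → (x ⊙ y) ⊙ z ≋ x ⊙ (y ⊙ z)
        ⊙-identityˡ : ∀ x → 𝟙 ⊙ x ≋ x
        ⊙-identityʳ : ∀ x → x ⊙ 𝟙 ≋ x
        ⊙-distribˡ  : ∀ x y z → x ⊙ (y ⊕ z) ≋ x ⊙ y ⊕ x ⊙ z
        ⊙-distribʳ  : ∀ x y z → (y ⊕ z) ⊙ x ≋ y ⊙ x ⊕ z ⊙ x
        ·-⊙ˡ        : ∀ r x y → (r · x) ⊙ y ≋ r · (x ⊙ y)
        ·-⊙ʳ        : ∀ r x y → x ⊙ (r · y) ≋ r · (x ⊙ y)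

      quotient : Mod
      quotient = mkModule
        (record
          { Carrier = Tensor
          ; _≈_ = _≋_
          ; _∙_ = _⊕_
          ; ε = 𝟘
          ; _⁻¹ = ⊖_
          ; isAbelianGroup = record
            { isGroup = record
              { isMonoid = record
                { isSemigroup = record
                  { isMagma = record
                    { isEquivalence = record { refl = ≋-refl ; sym = ≋-sym ; trans = ≋-trans }
                    ; ∙-cong = ⊕-cong
                    }
                  ; assoc = ⊕-assoc
                  }
                ; identity = ⊕-identityˡ , λ x → ≋-trans (⊕-comm x 𝟘) (⊕-identityˡ x)
                }
              ; inverse = ⊖-inverseˡ , λ x → ≋-trans (⊕-comm x (⊖ x)) (⊖-inverseˡ x)
              ; ⁻¹-cong = ⊖-cong
              }
            ; comm = ⊕-comm
            }
          })
        {_·_}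
        (record
          { ·-cong = ·-cong
          ; ·-distribˡ = ·-distribˡ
          ; ·-distribʳ = ·-distribʳ
          ; ·-assoc = ·-assoc
          ; ·-identity = ·-identity
          })

    data Commuting : Tensor → Tensor → Set where
      commute : ∀ x y → Commuting (ι x ⊙ ι y) (ι y ⊙ ι x)

    data Alternating : Tensor → Tensor → Set where
      square : ∀ x → Alternating (ι x ⊙ ι x) 𝟘

    module Symmetric = Quotient Commuting
    module Exterior  = Quotient Alternating

    product : List Tensor → Tensor
    product = foldr _⊙_ 𝟙

  Sym Ext : Mod → Mod
  Sym M = TensorAlgebra.Symmetric.quotient M
  Ext M = TensorAlgebra.Exterior.quotient M

  module TensorProduct (M N : Mod) where
    private
      module M = LeftModule M
      module N = LeftModule N

    infixl 6 _⊕_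
    infixl 7 _⊗_
    infixr 8 _·_
    infix  8 ⊖_

    data Tensor : Set where
      _⊗_ : M.Carrierᴹ → N.Carrierᴹ → Tensor
      𝟘   : Tensor
      _⊕_ : Tensor → Tensor → Tensor
      ⊖_  : Tensor → Tensor
      _·_ : Carrier → Tensor → Tensor

    infix 4 _≋_

    data _≋_ : Tensor → Tensor → Set where
      ≋-refl      : ∀ {x} → x ≋ x
      ≋-sym       : ∀ {x y} → x ≋ y → y ≋ x
      ≋-trans     : ∀ {x y z} → x ≋ y → y ≋ z → x ≋ z
      ⊗-cong      : ∀ {x x′ y y′} → x M.≈ᴹ x′ → y N.≈ᴹ y′ → x ⊗ y ≋ x′ ⊗ y′
      ⊕-cong      : ∀ {x x′ y y′} → x ≋ x′ → y ≋ y′ → x ⊕ y ≋ x′ ⊕ y′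
      ⊖-cong      : ∀ {x y} → x ≋ y → ⊖ x ≋ ⊖ y
      ·-cong      : ∀ {r s x y} → r ≈ s → x ≋ y → r · x ≋ s · y
      ⊗-+ˡ        : ∀ x x′ y → (x M.+ᴹ x′) ⊗ y ≋ x ⊗ y ⊕ x′ ⊗ y
      ⊗-+ʳ        : ∀ x y y′ → x ⊗ (y N.+ᴹ y′) ≋ x ⊗ y ⊕ x ⊗ y′
      ⊗-·ˡ        : ∀ r x y → (r M.*ₗ x) ⊗ y ≋ r · (x ⊗ y)
      ⊗-·ʳ        : ∀ r x y → x ⊗ (r N.*ₗ y) ≋ r · (x ⊗ y)
      ⊕-assoc     : ∀ x y z → (x ⊕ y) ⊕ z ≋ x ⊕ (y ⊕ z)
      ⊕-comm      : ∀ x y → x ⊕ y ≋ y ⊕ x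
      ⊕-identityˡ : ∀ x → 𝟘 ⊕ x ≋ x
      ⊖-inverseˡ  : ∀ x → ⊖ x ⊕ x ≋ 𝟘
      ·-distribˡ  : ∀ r x y → r · (x ⊕ y) ≋ r · x ⊕ r · y
      ·-distribʳ  : ∀ x r s → (r + s) · x ≋ r · x ⊕ s · x
      ·-assoc     : ∀ r s x → (r * s) · x ≋ r · s · x
      ·-identity  : ∀ x → 1# · x ≋ x

    tensorProduct : Mod
    tensorProduct = mkModule
      (record
        { Carrier = Tensor
        ; _≈_ = _≋_
        ; _∙_ = _⊕_
        ; ε = 𝟘
        ; _⁻¹ = ⊖_
        ; isAbelianGroup = record
          { isGroup = record
            { isMonoid = record
              { isSemigroup = record
                { isMagma = record
                  { isEquivalence = record { refl = ≋-refl ; sym = ≋-sym ; trans = ≋-trans }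
                  ; ∙-cong = ⊕-cong
                  }
                ; assoc = ⊕-assoc
                }
              ; identity = ⊕-identityˡ , λ x → ≋-trans (⊕-comm x 𝟘) (⊕-identityˡ x)
              }
            ; inverse = ⊖-inverseˡ , λ x → ≋-trans (⊕-comm x (⊖ x)) (⊖-inverseˡ x)
            ; ⁻¹-cong = ⊖-cong
            }
          ; comm = ⊕-comm
          }
        })
      {_·_}
      (record
        { ·-cong = ·-cong
        ; ·-distribˡ = ·-distribˡ
        ; ·-distribʳ = ·-distribʳ
        ; ·-assoc = ·-assoc
        ; ·-identity = ·-identity
        })

  open TensorProduct using (tensorProduct)

  record Dual (M : Mod) : Set where
    field
      ⟦_⟧      : Carrierᴹ M → Carrier
      isLinear : LeftModuleMorphisms.IsLeftModuleHomomorphism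
                   (LeftModule.rawLeftModule M) (TensorUnit.rawLeftModule {R = rawRing}) ⟦_⟧

  infixr 5 ∑

  ∑ : ∀ {X : Set} → List X → (X → Carrier) → Carrier
  ∑ xs f = foldr (λ x s → f x + s) 0# xs

  syntax ∑ xs (λ x → e) = ∑[ x ∈ xs ] e

  ∏ : ∀ {n} → Vector Carrier n → Carrier
  ∏ = Sum.sum *-commutativeMonoid

  open Exp semiring using (_^_)
  open Mult +-monoid using () renaming (_×_ to _times_)

  -- words xs m lists the functions from an m-element set to xs.

  words : ∀ {X : Set} → List X → (m : ℕ) → List (Vec X m)
  words xs zero    = [ Vec.[] ]
  words xs (suc m) = cartesianProductWith Vec._∷_ xs (words xs m)

  unique? : ∀ {m n} → Decidable (Unique {A = Fin n} {n = m})
  unique? = allPairs? λ i j → ¬? (i ≟ j)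

  permutations : ∀ n → List (Vec (Fin n) n)
  permutations n = filter unique? (words (allFin n) n)

  Inverted : ∀ {n} → Vec (Fin n) n → Fin n × Fin n → Set
  Inverted σ (i , j) = i Fin.< j × lookup σ j Fin.< lookup σ i

  inverted? : ∀ {n} (σ : Vec (Fin n) n) → Decidable (Inverted σ)
  inverted? σ (i , j) = i FinP.<? j ×-dec lookup σ j FinP.<? lookup σ i

  inversions : ∀ {n} → Vec (Fin n) n → ℕ
  inversions {n} σ = length (filter (inverted? σ) (cartesianProduct (allFin n) (allFin n)))

  det : ∀ {n} → (Fin n → Fin n → Carrier) → Carrier
  det {n} A = ∑[ σ ∈ permutations n ] (- 1#) ^ inversions σ * ∏ (λ i → A i (lookup σ i))

  charPoly : Graph → Carrier → Carrier
  charPoly G t = det λ i j → (if does (i ≟ j) then t else 0#) - (adjacency G i j times 1#)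

  -- ColorModel k ℓ is the set of (k,2ℓ)-color edge coloring models, with
  -- V₂ₗ = K^(ℓ+ℓ).

  SymV : ℕ → Mod
  SymV k = Sym (Free k)

  ExtV : ℕ → Mod
  ExtV ℓ = Ext (Free (ℓ ℕ.+ ℓ))

  record ColorModel (k ℓ : ℕ) : Set where
    field
      form : Dual (tensorProduct (SymV k) (ExtV ℓ))
    open Dual form public

  e : ∀ {k} → Fin k → Carrierᴹ (SymV k)
  e i = TensorAlgebra.ι (basis i)

  f g : ∀ ℓ → Fin (ℓ ℕ.+ ℓ) → Carrierᴹ (ExtV ℓ)
  f ℓ i = TensorAlgebra.ι (basis i)
  g ℓ i = [ (λ j → TensorAlgebra.⊖ f ℓ (ℓ ↑ʳ j)) , (λ j → f ℓ (j ↑ˡ ℓ)) ]′ (splitAt ℓ i)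

  module _ {k ℓ : ℕ} (h : ColorModel k ℓ) (G : Graph) where
    open ColorModel h using (⟦_⟧)
    private
      module S = TensorAlgebra (Free k)
      module Λ = TensorAlgebra (Free (ℓ ℕ.+ ℓ))
      open TensorProduct (SymV k) (ExtV ℓ) using (_⊗_)

    s : (F : Subset (#E G)) → PairedOrientation (G ↾ F) → Carrier
    s F (ω , pairing) =
      (- 1#) ^ circuits κ *
      (∑[ φ ∈ words (allFin (ℓ ℕ.+ ℓ)) (#E (G ↾ F)) ]
       ∑[ ψ ∈ words (allFin k) (#E (G ↾ ∁ F)) ]
       ∏ λ v → ⟦ S.product (map (λ a → e (lookup ψ a)) (incident (G ↾ ∁ F) v))
               ⊗ Λ.product (map (λ a → f ℓ (lookup φ a) Λ.⊙ g ℓ (lookup φ (κ ⟨$⟩ʳ a))) (incoming v)) ⟧)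
      where
      open EulerianOrientation ω
      open CompatiblePairing pairing

    module _ (choice : ∀ F → Eulerian G F → PairedOrientation (G ↾ F)) where

      term : ∀ F → Dec (Eulerian G F) → Carrier
      term F (yes eulerian) = s F (choice F eulerian)
      term F (no  _)        = 0#

      -- The value does not depend on the choice of orientations and pairings,
      -- which is an explicit argument; pairedOrientation is one such choice.

      mixedPartition : Carrier
      mixedPartition = ∑[ F ∈ words (outside ∷ inside ∷ []) (#E G) ] term F (eulerian? G F)

open CommutativeRing complexRing public using (_≈_) renaming (Carrier to ℂ)
open LinearAlgebra complexRing public using (ColorModel; mixedPartition; charPoly)

-- Put h(e₁ᵃe₂ᵇ ⊗ 1) = t, i, 0 for b = 0, 1, ≥ 2 (with i² = -1), h(e₁ᵃe₂ᵇ ⊗ f₁∧f₂) = -1 for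
-- b = 0, and h = 0 on the remaining basis vectors.  In a nonzero term of s_h the
-- edges coloured e₂ form a matching on the vertices not covered by F, each of its
-- edges contributing i² = -1, while F has degree 0 or 2 everywhere and φ is
-- constant on the circuits of F.
--
-- Expanding the product over the rows of tI - A gives the same terms: each edge is
-- unused, used in both directions, or used in one of them, and the determinant
-- keeps the states in which the used arcs, together with the vertices on none of
-- them, form the cycles of a permutation of V.  The edges used in both directions
-- are the matching, the edges used once form F, and φ tells on which circuits the
-- orientation ω is reversed.  The signs agree because a permutation of m points
-- with c cycles has sign (-1)^(m + c), and reversing some cycles does not change c.

module Submission where

open import Defs hiding (_≈_; ColorModel; mixedPartition; charPoly)
open import Algebra.Bundles using (CommutativeMonoid; CommutativeRing)
open import Algebra.Module.Bundles using (LeftModule)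
import Algebra.Properties.CommutativeMonoid.Sum as Sum
import Algebra.Properties.CommutativeSemigroup as CommutativeSemigroupProperties
import Algebra.Properties.Monoid.Mult as Mult
import Algebra.Properties.Ring as RingProperties
import Algebra.Properties.Semiring.Exp as Exp
import Algebra.Properties.Semiring.Sum as SemiringSum
import Algebra.Solver.CommutativeMonoid as CommutativeMonoidSolver
import Algebra.Solver.Ring.NaturalCoefficients.Default as SemiringSolver
open import Data.Bool.Base using (Bool; true; false; not; if_then_else_)
import Data.Bool.Properties as BoolP
open import Data.Fin.Base as Fin using (Fin; zero; suc; toℕ; fromℕ<; punchIn; punchOut)
open import Data.Fin.Permutation as Perm using (Permutation′; _⟨$⟩ʳ_; _⟨$⟩ˡ_; _∘ₚ_; transpose; inverseˡ; inverseʳ)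
import Data.Fin.Properties as FinP
open import Data.Fin.Subset using (Subset; inside; outside; ∣_∣; ∁)
open import Data.List.Base as List using (List; []; _∷_; _++_; allFin; filter; length; cartesianProduct; cartesianProductWith)
open import Data.List.Properties using (length-++)
open import Data.Nat.Base as ℕ using (ℕ; zero; suc)
open import Data.Nat.Divisibility using (_∣_; _∣?_; divides)
open import Data.Nat.DivMod using (_/_; _%_; m≡m%n+[m/n]*n; m%n<n)
open import Data.Nat.GeneralisedArithmetic using (fold; fold-+)
import Data.Nat.Properties as ℕP
open import Data.Product using (Σ-syntax)
open import Data.Product.Base using (∃; ∃₂; _×_; _,_; proj₁; proj₂)
open import Data.Product.Properties using (≡-dec)
open import Data.Sum.Base using (_⊎_; inj₁; inj₂; [_,_]′)
open import Data.Vec.Base as Vec using (Vec; lookup)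
open import Data.Vec.Properties using (tabulate∘lookup; lookup∘tabulate)
open import Data.Vec.Relation.Unary.Unique.Propositional using (Unique)
open import Data.Vec.Relation.Unary.Unique.Propositional.Properties using (tabulate⁺; lookup-injective)
open import Function.Base using (_∘_; id)
open import Function.Bundles using (mk⇔)
open import Level using (0ℓ)
open import Relation.Binary.Definitions using (DecidableEquality; tri<; tri≈; tri>)
open import Relation.Binary.PropositionalEquality using (_≡_; _≢_; refl; sym; trans; cong; cong₂; subst)
open import Relation.Nullary using (Dec; yes; no; does; ¬_; contradiction)
open import Relation.Nullary.Decidable using (¬?; _×-dec_; _⊎-dec_; map′; dec-true; dec-false; does-⇔; decidable-stable)
open import Relation.Unary using (Decidable; Pred)

-- The comparison is made term by term, not only after summation: for fixed F, φ, ψ the product of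
-- the values of h, with its sign, equals the contribution of one state to the determinant, and a
-- configuration that is forbidden at a vertex kills both. Two devices make this local. The
-- determinant is summed over all words instead of permutations, since `sgn` vanishes on repeated
-- letters; the rows then expand independently. And "at most one" is encoded by dual numbers, ε² =
-- 0: they serve for the edges coloured e₂ at a vertex, for the span of 1 and f₁∧f₂, and for the
-- arcs used in one row. The constants: f_p∧g_q is -f₁∧f₂ for p = q and 0 otherwise, so the value -1
-- of h on f₁∧f₂ gives a vertex on F the weight 1. Its row in tI - A gives -1, and these signs, one
-- per arc of F, turn the sign of the cycles into (-1)^c. A matching edge is a 2-cycle with two
-- entries -1 and sign -1; h has to produce that -1 from two equal vertex weights, hence the square
-- root i. As φ is read relative to ω, after a bijective recolouring, the argument applies to every
-- choice of orientation and pairing.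

-- An arc is an edge with a direction: true points from src to tgt.

Arc : ℕ → Set
Arc m = Fin m × Bool

_≟ᵃ_ : ∀ {m} → DecidableEquality (Arc m)
_≟ᵃ_ = ≡-dec FinP._≟_ BoolP._≟_

anyArc? : ∀ {m} {P : Pred (Arc m) 0ℓ} → Decidable P → Dec (∃ P)
anyArc? P? = map′
  (λ { (e , inj₁ p) → (e , true) , p ; (e , inj₂ p) → (e , false) , p })
  (λ { ((e , true) , p) → e , inj₁ p ; ((e , false) , p) → e , inj₂ p })
  (FinP.any? λ e → P? (e , true) ⊎-dec P? (e , false))

-- These are the three cases that a product of dual numbers distinguishes: no factor in ε, exactly
-- one, or at least two, which make it vanish.
data Count {I : Set} (P : I → Set) : Set where
  none : (∀ a → ¬ P a) → Count P
  one  : ∀ a → P a → (∀ b → P b → b ≡ a) → Count P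
  many : ∀ a b → a ≢ b → P a → P b → Count P

module _ {I : Set} (_≟_ : DecidableEquality I)
         (find : {P : Pred I 0ℓ} → Decidable P → Dec (∃ P)) where

  count : {P : Pred I 0ℓ} → Decidable P → Count P
  count P? with find P?
  ... | no ¬∃ = none λ a p → ¬∃ (a , p)
  ... | yes (a , p) with find (λ b → P? b ×-dec ¬? (a ≟ b))
  ...   | yes (b , q , a≢b) = many a b a≢b p q
  ...   | no ¬∃ = one a p unique
    where
    unique : ∀ b → _ → b ≡ a
    unique b q with a ≟ b
    ... | yes a≡b = sym a≡b
    ... | no a≢b = contradiction (b , q , a≢b) ¬∃

-- Finite sums and products in a commutative monoid

module FiniteProducts (M : CommutativeMonoid 0ℓ 0ℓ) where
  open CommutativeMonoid M renaming (refl to ≈-refl; sym to ≈-sym; trans to ≈-trans)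
  open CommutativeSemigroupProperties commutativeSemigroup using (interchange)
  open Sum M using (sum; sum-cong-≋; sum-remove; sum-replicate-zero; ∑-comm; ∑-distrib-+) public

  -- Three laws suffice to isolate single factors, so products over `Fin m` and over arcs share all
  -- that follows. In `∏-pull` the family y is z with its entry at a replaced by the unit. For a
  -- multiplicative monoid the library's `sum` is a product.
  record Product {I : Set} (_≟_ : DecidableEquality I) (∏ : (I → Carrier) → Carrier) : Set where
    field
      ∏-cong : ∀ {y z} → (∀ a → y a ≈ z a) → ∏ y ≈ ∏ z
      ∏-ε    : ∏ (λ _ → ε) ≈ ε
      ∏-pull : ∀ {y z} a → y a ≈ ε → (∀ b → b ≢ a → y b ≈ z b) → ∏ z ≈ z a ∙ ∏ y

    ∏-trivial : ∀ {z} → (∀ a → z a ≈ ε) → ∏ z ≈ ε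
    ∏-trivial z≈ε = ≈-trans (∏-cong z≈ε) ∏-ε

    ∏-single : ∀ {z} a → (∀ b → b ≢ a → z b ≈ ε) → ∏ z ≈ z a
    ∏-single a z≈ε = ≈-trans (∏-pull a ≈-refl (λ b b≢a → ≈-sym (z≈ε b b≢a)))
      (≈-trans (∙-congˡ ∏-ε) (identityʳ _))

    _without_ : (I → Carrier) → I → I → Carrier
    (z without a) b = if does (b ≟ a) then ε else z b

    without-self : ∀ z a → (z without a) a ≈ ε
    without-self z a with a ≟ a
    ... | yes _ = ≈-refl
    ... | no a≢a = contradiction refl a≢a

    without-other : ∀ z a b → b ≢ a → (z without a) b ≈ z b
    without-other z a b b≢a with b ≟ a
    ... | yes b≡a = contradiction b≡a b≢a
    ... | no _ = ≈-refl

    ∏-factor : ∀ z a → ∏ z ≈ z a ∙ ∏ (z without a)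
    ∏-factor z a = ∏-pull a (without-self z a) (without-other z a)

    -- The cofactor r may stay unspecified: the lemma serves to exhibit a product of two multiples
    -- of ε, which is 0 whatever r is.
    ∏-factor₂ : ∀ z {a b} → a ≢ b → ∃ λ r → ∏ z ≈ z a ∙ (z b ∙ r)
    ∏-factor₂ z {a} {b} a≢b = _ , ≈-trans (∏-factor z a)
      (∙-congˡ (≈-trans (∏-factor (z without a) b) (∙-congʳ (without-other z a b (a≢b ∘ sym)))))

  fin : ∀ {m} → Product (FinP._≟_ {m}) sum
  fin {m} = record
    { ∏-cong = sum-cong-≋
    ; ∏-ε = sum-replicate-zero m
    ; ∏-pull = pull
    }
    where
    pull : ∀ {m} {y z : Fin m → Carrier} a → y a ≈ ε → (∀ b → b ≢ a → y b ≈ z b) →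
           sum z ≈ z a ∙ sum y
    pull {suc m} {y} {z} a ya≈ε y≈z = ≈-trans (sum-remove {i = a} z) (∙-congˡ
      (≈-sym (≈-trans (sum-remove {i = a} y) (≈-trans (∙-congʳ ya≈ε) (≈-trans (identityˡ _)
        (sum-cong-≋ λ b → y≈z (punchIn a b) (FinP.punchInᵢ≢i a b)))))))

  module Fin∏ {m} = Product (fin {m})

  -- Grouping the two arcs of an edge lets the product be peeled edge by edge, as the recursion over
  -- states requires.
  arcSum : ∀ {m} → (Arc m → Carrier) → Carrier
  arcSum z = sum λ e → z (e , true) ∙ z (e , false)

  arc : ∀ {m} → Product (_≟ᵃ_ {m}) arcSum
  arc {m} = record
    { ∏-cong = λ y≈z → sum-cong-≋ {m} λ e → ∙-cong (y≈z (e , true)) (y≈z (e , false))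
    ; ∏-ε = Fin∏.∏-trivial {m} λ _ → identityˡ ε
    ; ∏-pull = pull
    }
    where
    distinct : ∀ {e e′ : Fin m} {d d′ : Bool} → e ≢ e′ → (e , d) ≢ (e′ , d′)
    distinct e≢e′ refl = e≢e′ refl

    pull : {y z : Arc m → Carrier} → ∀ a → y a ≈ ε → (∀ b → b ≢ a → y b ≈ z b) →
           arcSum z ≈ z a ∙ arcSum y
    pull {y} {z} (e , d) ya≈ε y≈z = ≈-trans (Fin∏.∏-factor Z e)
      (≈-trans (∙-congʳ (at d ya≈ε y≈z)) (≈-trans (assoc _ _ _) (∙-congˡ (≈-sym
        (≈-trans (Fin∏.∏-factor Y e) (∙-congˡ (sum-cong-≋ others)))))))
      where
      Y Z : Fin m → Carrier
      Y e = y (e , true) ∙ y (e , false)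
      Z e = z (e , true) ∙ z (e , false)

      at : ∀ d → y (e , d) ≈ ε → (∀ b → b ≢ (e , d) → y b ≈ z b) → Z e ≈ z (e , d) ∙ Y e
      at true  ya≈ε y≈z = ∙-congˡ (≈-sym
        (≈-trans (∙-cong ya≈ε (y≈z (e , false) λ ())) (identityˡ _)))
      at false ya≈ε y≈z = ≈-trans (comm _ _) (∙-congˡ (≈-sym
        (≈-trans (∙-cong (y≈z (e , true) λ ()) ya≈ε) (identityʳ _))))

      others : ∀ b → (Y Fin∏.without e) b ≈ (Z Fin∏.without e) b
      others b with b FinP.≟ e
      ... | yes _ = ≈-refl
      ... | no b≢e = ∙-cong (y≈z _ (distinct b≢e)) (y≈z _ (distinct b≢e))

  module Arc∏ {m} = Product (arc {m})

  open Mult monoid using () renaming (_×_ to _times_)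

  -- Over the additive monoid this is definitionally the `∑` in which the partition function and the
  -- determinant are stated.
  listSum : ∀ {X : Set} → List X → (X → Carrier) → Carrier
  listSum xs f = List.foldr (λ x s → f x ∙ s) ε xs

  listSum-cong : ∀ {X : Set} (xs : List X) {f g : X → Carrier} → (∀ x → f x ≈ g x) →
                 listSum xs f ≈ listSum xs g
  listSum-cong []       f≈g = ≈-refl
  listSum-cong (x ∷ xs) f≈g = ∙-cong (f≈g x) (listSum-cong xs f≈g)

  listSum-++ : ∀ {X : Set} (f : X → Carrier) xs ys → listSum (xs ++ ys) f ≈ listSum xs f ∙ listSum ys f
  listSum-++ f []       ys = ≈-sym (identityˡ _)
  listSum-++ f (x ∷ xs) ys = ≈-trans (∙-congˡ (listSum-++ f xs ys)) (≈-sym (assoc _ _ _))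

  listSum-map : ∀ {X Y : Set} (f : Y → Carrier) (h : X → Y) xs → listSum (List.map h xs) f ≡ listSum xs (f ∘ h)
  listSum-map f h []       = refl
  listSum-map f h (x ∷ xs) = cong (f (h x) ∙_) (listSum-map f h xs)

  listSum-cartesian : ∀ {X Y Z : Set} (h : X → Y → Z) (f : Z → Carrier) xs ys →
                      listSum (cartesianProductWith h xs ys) f ≈ listSum xs λ x → listSum ys λ y → f (h x y)
  listSum-cartesian h f []       ys = ≈-refl
  listSum-cartesian h f (x ∷ xs) ys = ≈-trans (listSum-++ f (List.map (h x) ys) _)
    (∙-cong (reflexive (listSum-map f (h x) ys)) (listSum-cartesian h f xs ys))

  listSum-tabulate : ∀ {n} {X : Set} (f : X → Carrier) (h : Fin n → X) → listSum (List.tabulate h) f ≡ sum (f ∘ h)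
  listSum-tabulate {zero}  f h = refl
  listSum-tabulate {suc n} f h = cong (f (h zero) ∙_) (listSum-tabulate f (h ∘ suc))

  listSum-ε : ∀ {X : Set} (xs : List X) {f : X → Carrier} → (∀ x → f x ≈ ε) → listSum xs f ≈ ε
  listSum-ε []       f≈ε = ≈-refl
  listSum-ε (x ∷ xs) f≈ε = ≈-trans (∙-cong (f≈ε x) (listSum-ε xs f≈ε)) (identityˡ ε)

  listSum-∙ : ∀ {X : Set} (xs : List X) (f g : X → Carrier) →
              listSum xs (λ x → f x ∙ g x) ≈ listSum xs f ∙ listSum xs g
  listSum-∙ []       f g = ≈-sym (identityˡ ε)
  listSum-∙ (x ∷ xs) f g = ≈-trans (∙-congˡ (listSum-∙ xs f g)) (interchange _ _ _ _)

  listSum-comm : ∀ {X Y : Set} (xs : List X) (ys : List Y) (f : X → Y → Carrier) →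
                 listSum xs (λ x → listSum ys (f x)) ≈ listSum ys (λ y → listSum xs λ x → f x y)
  listSum-comm []       ys f = ≈-sym (listSum-ε ys λ _ → ≈-refl)
  listSum-comm (x ∷ xs) ys f = ≈-trans (∙-congˡ (listSum-comm xs ys f))
    (≈-sym (listSum-∙ ys (f x) _))

  listSum-filter : ∀ {X : Set} {P : Pred X 0ℓ} (P? : Decidable P) (f : X → Carrier) xs →
                   listSum (filter P? xs) f ≈ listSum xs λ x → if does (P? x) then f x else ε
  listSum-filter P? f []       = ≈-refl
  listSum-filter P? f (x ∷ xs) with does (P? x)
  ... | true  = ∙-congˡ (listSum-filter P? f xs)
  ... | false = ≈-trans (listSum-filter P? f xs) (≈-sym (identityˡ _))

  -- In the multiplicative monoid the left side is a power; this turns `(- 1#) ^ n`, where n counts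
  -- inversions or circuits, into a product of signs.
  times-length : ∀ {X : Set} (xs : List X) c → length xs times c ≈ listSum xs λ _ → c
  times-length []       c = ≈-refl
  times-length (x ∷ xs) c = ∙-congˡ (times-length xs c)

-- The edge coloring model: evaluation of tensors and construction of h

module Model (K : CommutativeRing 0ℓ 0ℓ) where
  open CommutativeRing K hiding (zero) renaming (refl to ≈-refl; sym to ≈-sym; trans to ≈-trans)
  open LinearAlgebra K using (Mod; Free; module TensorAlgebra; module TensorProduct; SymV; ExtV; ColorModel)
  open LeftModule using (Carrierᴹ)
  open RingProperties ring using (-1*x≈-x)
  open SemiringSolver commutativeSemiring using (solve; con; _:=_; _:+_; _:*_)

  record Multiplication (A : Mod) : Set where
    open LeftModule A using (_≈ᴹ_; _+ᴹ_; _*ₗ_)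
    infixl 7 _∙_
    field
      _∙_       : Carrierᴹ A → Carrierᴹ A → Carrierᴹ A
      𝟏         : Carrierᴹ A
      ∙-cong    : ∀ {x x′ y y′} → x ≈ᴹ x′ → y ≈ᴹ y′ → x ∙ y ≈ᴹ x′ ∙ y′
      assoc     : ∀ x y z → (x ∙ y) ∙ z ≈ᴹ x ∙ (y ∙ z)
      identityₗ : ∀ x → 𝟏 ∙ x ≈ᴹ x
      identityᵣ : ∀ x → x ∙ 𝟏 ≈ᴹ x
      distribₗ  : ∀ x y z → x ∙ (y +ᴹ z) ≈ᴹ x ∙ y +ᴹ x ∙ z
      distribᵣ  : ∀ x y z → (y +ᴹ z) ∙ x ≈ᴹ y ∙ x +ᴹ z ∙ x
      scaleₗ    : ∀ r x y → (r *ₗ x) ∙ y ≈ᴹ r *ₗ (x ∙ y)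
      scaleᵣ    : ∀ r x y → x ∙ (r *ₗ y) ≈ᴹ r *ₗ (x ∙ y)

  module Evaluation (M A : Mod) (multiplication : Multiplication A)
                    (v : Carrierᴹ M → Carrierᴹ A) where
    open TensorAlgebra M
    open Multiplication multiplication
    private
      module M = LeftModule M
      module A = LeftModule A

    eval : Tensor → A.Carrierᴹ
    eval (ι x)   = v x
    eval 𝟘       = A.0ᴹ
    eval 𝟙       = 𝟏
    eval (x ⊕ y) = eval x A.+ᴹ eval y
    eval (x ⊙ y) = eval x ∙ eval y
    eval (⊖ x)   = A.-ᴹ eval x
    eval (r · x) = r A.*ₗ eval x

    module Soundness (v-cong : ∀ {x y} → x M.≈ᴹ y → v x A.≈ᴹ v y)
                     (v-+ : ∀ x y → v (x M.+ᴹ y) A.≈ᴹ v x A.+ᴹ v y)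
                     (v-* : ∀ r x → v (r M.*ₗ x) A.≈ᴹ r A.*ₗ v x)
                     (_∼_ : Tensor → Tensor → Set)
                     (v-∼ : ∀ {x y} → x ∼ y → eval x A.≈ᴹ eval y) where
      open Quotient _∼_

      -- This is the universal property of a quotient of the tensor algebra: an algebra A satisfies
      -- all generating rules by itself, so only linearity of v and the added relation have to be
      -- supplied.
      eval-cong : ∀ {x y} → x ≋ y → eval x A.≈ᴹ eval y
      eval-cong (relation x∼y)      = v-∼ x∼y
      eval-cong ≋-refl              = A.≈ᴹ-refl
      eval-cong (≋-sym p)           = A.≈ᴹ-sym (eval-cong p)
      eval-cong (≋-trans p q)       = A.≈ᴹ-trans (eval-cong p) (eval-cong q)
      eval-cong (ι-cong p)          = v-cong p
      eval-cong (⊕-cong p q)        = A.+ᴹ-cong (eval-cong p) (eval-cong q)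
      eval-cong (⊙-cong p q)        = ∙-cong (eval-cong p) (eval-cong q)
      eval-cong (⊖-cong p)          = A.-ᴹ‿cong (eval-cong p)
      eval-cong (·-cong r≈s p)      = A.*ₗ-cong r≈s (eval-cong p)
      eval-cong (ι-+ x y)           = v-+ x y
      eval-cong (ι-· r x)           = v-* r x
      eval-cong (⊕-assoc x y z)     = A.+ᴹ-assoc _ _ _
      eval-cong (⊕-comm x y)        = A.+ᴹ-comm _ _
      eval-cong (⊕-identityˡ x)     = A.+ᴹ-identityˡ _
      eval-cong (⊖-inverseˡ x)      = A.-ᴹ‿inverseˡ _
      eval-cong (·-distribˡ r x y)  = A.*ₗ-distribˡ _ _ _
      eval-cong (·-distribʳ x r s)  = A.*ₗ-distribʳ _ _ _
      eval-cong (·-assoc r s x)     = A.*ₗ-assoc _ _ _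
      eval-cong (·-identity x)      = A.*ₗ-identityˡ _
      eval-cong (⊙-assoc x y z)     = assoc _ _ _
      eval-cong (⊙-identityˡ x)     = identityₗ _
      eval-cong (⊙-identityʳ x)     = identityᵣ _
      eval-cong (⊙-distribˡ x y z)  = distribₗ _ _ _
      eval-cong (⊙-distribʳ x y z)  = distribᵣ _ _ _
      eval-cong (·-⊙ˡ r x y)        = scaleₗ _ _ _
      eval-cong (·-⊙ʳ r x y)        = scaleᵣ _ _ _

  pattern 0F = zero
  pattern 1F = suc zero
  pattern 2F = suc (suc zero)
  pattern 3F = suc (suc (suc zero))

  -- The dual numbers over K: (p , q) stands for p + qε with ε² = 0.
  𝔻 : Set
  𝔻 = Carrier × Carrier

  infix 4 _≈ᴰ_
  infixl 7 _*ᴰ_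

  _≈ᴰ_ : 𝔻 → 𝔻 → Set
  x ≈ᴰ y = proj₁ x ≈ proj₁ y × proj₂ x ≈ proj₂ y

  _*ᴰ_ : 𝔻 → 𝔻 → 𝔻
  x *ᴰ y = proj₁ x * proj₁ y , proj₁ x * proj₂ y + proj₂ x * proj₁ y

  1ᴰ : 𝔻
  1ᴰ = 1# , 0#

  dualMonoid : CommutativeMonoid 0ℓ 0ℓ
  dualMonoid = record
    { Carrier = 𝔻
    ; _≈_ = _≈ᴰ_
    ; _∙_ = _*ᴰ_
    ; ε = 1ᴰ
    ; isCommutativeMonoid = record
      { isMonoid = record
        { isSemigroup = record
          { isMagma = record
            { isEquivalence = record
              { refl = ≈-refl , ≈-refl
              ; sym = λ (p , q) → ≈-sym p , ≈-sym q
              ; trans = λ (p , q) (p′ , q′) → ≈-trans p p′ , ≈-trans q q′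
              }
            ; ∙-cong = λ (p , q) (p′ , q′) → *-cong p p′ , +-cong (*-cong p q′) (*-cong q p′)
            }
          ; assoc = λ (a , b) (c , d) (e , f) → *-assoc a c e , solve 6 (λ a b c d e f →
              (a :* c) :* f :+ (a :* d :+ b :* c) :* e := a :* (c :* f :+ d :* e) :+ b :* (c :* e))
              ≈-refl a b c d e f
          }
        ; identity =
            (λ (a , b) → *-identityˡ a , solve 2 (λ a b → con 1 :* b :+ con 0 :* a := b) ≈-refl a b)
          , (λ (a , b) → *-identityʳ a , solve 2 (λ a b → a :* con 0 :+ b :* con 1 := b) ≈-refl a b)
        }
      ; comm = λ (a , b) (c , d) → *-comm a c , solve 4 (λ a b c d → a :* d :+ b :* c := c :* b :+ d :* a)
          ≈-refl a b c d
      }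
    }
  private
    module 𝔻M = CommutativeMonoid dualMonoid

  -- The dual numbers occur twice, as functions in `Free 2` where a module is needed and as pairs
  -- where a commutative monoid is needed.
  dual : Carrier → Carrier → Carrierᴹ (Free 2)
  dual p q 0F = p
  dual p q 1F = q

  pair : Carrierᴹ (Free 2) → 𝔻
  pair x = x 0F , x 1F

  components : ∀ {x y : 𝔻} → x ≈ᴰ y → ∀ j → dual (proj₁ x) (proj₂ x) j ≈ dual (proj₁ y) (proj₂ y) j
  components p 0F = proj₁ p
  components p 1F = proj₂ p

  _*²_ : Carrierᴹ (Free 2) → Carrierᴹ (Free 2) → Carrierᴹ (Free 2)
  x *² y = dual (proj₁ (pair x *ᴰ pair y)) (proj₂ (pair x *ᴰ pair y))

  dualMultiplication : Multiplication (Free 2)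
  dualMultiplication = record
    { _∙_ = _*²_
    ; 𝟏 = dual 1# 0#
    ; ∙-cong = λ { {x} {x′} {y} {y′} p q → components (𝔻M.∙-cong {pair x} {pair x′} {pair y} {pair y′}
                     (p 0F , p 1F) (q 0F , q 1F)) }
    ; assoc = λ x y z → components (𝔻M.assoc (pair x) (pair y) (pair z))
    ; identityₗ = λ { x 0F → *-identityˡ _ ; x 1F → proj₂ (𝔻M.identityˡ (pair x)) }
    ; identityᵣ = λ { x 0F → *-identityʳ _ ; x 1F → proj₂ (𝔻M.identityʳ (pair x)) }
    ; distribₗ = λ { x y z 0F → distribˡ _ _ _
                   ; x y z 1F → solve 6 (λ a b c d e f →
                       a :* (d :+ f) :+ b :* (c :+ e) := (a :* d :+ b :* c) :+ (a :* f :+ b :* e))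
                       ≈-refl (x 0F) (x 1F) (y 0F) (y 1F) (z 0F) (z 1F) }
    ; distribᵣ = λ { x y z 0F → distribʳ _ _ _
                   ; x y z 1F → solve 6 (λ a b c d e f →
                       (c :+ e) :* b :+ (d :+ f) :* a := (c :* b :+ d :* a) :+ (e :* b :+ f :* a))
                       ≈-refl (x 0F) (x 1F) (y 0F) (y 1F) (z 0F) (z 1F) }
    ; scaleₗ = λ { r x y 0F → *-assoc _ _ _
                 ; r x y 1F → solve 5 (λ r a b c d →
                     (r :* a) :* d :+ (r :* b) :* c := r :* (a :* d :+ b :* c))
                     ≈-refl r (x 0F) (x 1F) (y 0F) (y 1F) }
    ; scaleᵣ = λ { r x y 0F → solve 3 (λ r a c → a :* (r :* c) := r :* (a :* c)) ≈-refl r (x 0F) (y 0F)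
                 ; r x y 1F → solve 5 (λ r a b c d →
                     a :* (r :* d) :+ b :* (r :* c) := r :* (a :* d :+ b :* c))
                     ≈-refl r (x 0F) (x 1F) (y 0F) (y 1F) }
    }

  -- The exterior algebra of K², with basis 1, f₁, f₂, f₁∧f₂.

  _∧_ : Carrierᴹ (Free 4) → Carrierᴹ (Free 4) → Carrierᴹ (Free 4)
  (x ∧ y) 0F = x 0F * y 0F
  (x ∧ y) 1F = x 0F * y 1F + x 1F * y 0F
  (x ∧ y) 2F = x 0F * y 2F + x 2F * y 0F
  (x ∧ y) 3F = (x 0F * y 3F + x 3F * y 0F) + (x 1F * y 2F + - 1# * (x 2F * y 1F))

  exteriorMultiplication : Multiplication (Free 4)
  exteriorMultiplication = record
    { _∙_ = _∧_
    ; 𝟏 = λ { 0F → 1# ; (suc _) → 0# }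
    ; ∙-cong = λ { p q 0F → *-cong (p 0F) (q 0F)
                 ; p q 1F → +-cong (*-cong (p 0F) (q 1F)) (*-cong (p 1F) (q 0F))
                 ; p q 2F → +-cong (*-cong (p 0F) (q 2F)) (*-cong (p 2F) (q 0F))
                 ; p q 3F → +-cong (+-cong (*-cong (p 0F) (q 3F)) (*-cong (p 3F) (q 0F)))
                                   (+-cong (*-cong (p 1F) (q 2F)) (*-congˡ (*-cong (p 2F) (q 1F)))) }
    ; assoc = λ { x y z 0F → *-assoc _ _ _
                ; x y z 1F → assoc₁ (x 0F) (x 1F) (y 0F) (y 1F) (z 0F) (z 1F)
                ; x y z 2F → assoc₁ (x 0F) (x 2F) (y 0F) (y 2F) (z 0F) (z 2F)
                ; x y z 3F → solve 13 (λ n a b c d a′ b′ c′ d′ a″ b″ c″ d″ →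
                    ((a :* a′) :* d″ :+ ((a :* d′ :+ d :* a′) :+ (b :* c′ :+ n :* (c :* b′))) :* a″)
                    :+ ((a :* b′ :+ b :* a′) :* c″ :+ n :* ((a :* c′ :+ c :* a′) :* b″))
                    := (a :* ((a′ :* d″ :+ d′ :* a″) :+ (b′ :* c″ :+ n :* (c′ :* b″))) :+ d :* (a′ :* a″))
                    :+ (b :* (a′ :* c″ :+ c′ :* a″) :+ n :* (c :* (a′ :* b″ :+ b′ :* a″))))
                    ≈-refl (- 1#) (x 0F) (x 1F) (x 2F) (x 3F) (y 0F) (y 1F) (y 2F) (y 3F)
                    (z 0F) (z 1F) (z 2F) (z 3F) }
    ; identityₗ = λ { x 0F → *-identityˡ _
                    ; x 1F → identity₁ (x 0F) (x 1F)
                    ; x 2F → identity₁ (x 0F) (x 2F)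
                    ; x 3F → solve 5 (λ n a b c d →
                        (con 1 :* d :+ con 0 :* a) :+ (con 0 :* c :+ n :* (con 0 :* b)) := d)
                        ≈-refl (- 1#) (x 0F) (x 1F) (x 2F) (x 3F) }
    ; identityᵣ = λ { x 0F → *-identityʳ _
                    ; x 1F → identity₂ (x 0F) (x 1F)
                    ; x 2F → identity₂ (x 0F) (x 2F)
                    ; x 3F → solve 5 (λ n a b c d →
                        (a :* con 0 :+ d :* con 1) :+ (b :* con 0 :+ n :* (c :* con 0)) := d)
                        ≈-refl (- 1#) (x 0F) (x 1F) (x 2F) (x 3F) }
    ; distribₗ = λ { x y z 0F → distribˡ _ _ _
                   ; x y z 1F → distrib₁ (x 0F) (x 1F) (y 0F) (y 1F) (z 0F) (z 1F)
                   ; x y z 2F → distrib₁ (x 0F) (x 2F) (y 0F) (y 2F) (z 0F) (z 2F)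
                   ; x y z 3F → solve 13 (λ n a b c d a′ b′ c′ d′ a″ b″ c″ d″ →
                       (a :* (d′ :+ d″) :+ d :* (a′ :+ a″)) :+ (b :* (c′ :+ c″) :+ n :* (c :* (b′ :+ b″)))
                       := ((a :* d′ :+ d :* a′) :+ (b :* c′ :+ n :* (c :* b′)))
                       :+ ((a :* d″ :+ d :* a″) :+ (b :* c″ :+ n :* (c :* b″))))
                       ≈-refl (- 1#) (x 0F) (x 1F) (x 2F) (x 3F) (y 0F) (y 1F) (y 2F) (y 3F)
                       (z 0F) (z 1F) (z 2F) (z 3F) }
    ; distribᵣ = λ { x y z 0F → distribʳ _ _ _
                   ; x y z 1F → distrib₂ (x 0F) (x 1F) (y 0F) (y 1F) (z 0F) (z 1F)
                   ; x y z 2F → distrib₂ (x 0F) (x 2F) (y 0F) (y 2F) (z 0F) (z 2F)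
                   ; x y z 3F → solve 13 (λ n a b c d a′ b′ c′ d′ a″ b″ c″ d″ →
                       ((a′ :+ a″) :* d :+ (d′ :+ d″) :* a) :+ ((b′ :+ b″) :* c :+ n :* ((c′ :+ c″) :* b))
                       := ((a′ :* d :+ d′ :* a) :+ (b′ :* c :+ n :* (c′ :* b)))
                       :+ ((a″ :* d :+ d″ :* a) :+ (b″ :* c :+ n :* (c″ :* b))))
                       ≈-refl (- 1#) (x 0F) (x 1F) (x 2F) (x 3F) (y 0F) (y 1F) (y 2F) (y 3F)
                       (z 0F) (z 1F) (z 2F) (z 3F) }
    ; scaleₗ = λ { r x y 0F → *-assoc _ _ _
                 ; r x y 1F → scale₁ r (x 0F) (x 1F) (y 0F) (y 1F)
                 ; r x y 2F → scale₁ r (x 0F) (x 2F) (y 0F) (y 2F)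
                 ; r x y 3F → solve 10 (λ n r a b c d a′ b′ c′ d′ →
                     ((r :* a) :* d′ :+ (r :* d) :* a′) :+ ((r :* b) :* c′ :+ n :* ((r :* c) :* b′))
                     := r :* ((a :* d′ :+ d :* a′) :+ (b :* c′ :+ n :* (c :* b′))))
                     ≈-refl (- 1#) r (x 0F) (x 1F) (x 2F) (x 3F) (y 0F) (y 1F) (y 2F) (y 3F) }
    ; scaleᵣ = λ { r x y 0F → solve 3 (λ r a c → a :* (r :* c) := r :* (a :* c)) ≈-refl r (x 0F) (y 0F)
                 ; r x y 1F → scale₂ r (x 0F) (x 1F) (y 0F) (y 1F)
                 ; r x y 2F → scale₂ r (x 0F) (x 2F) (y 0F) (y 2F)
                 ; r x y 3F → solve 10 (λ n r a b c d a′ b′ c′ d′ →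
                     (a :* (r :* d′) :+ d :* (r :* a′)) :+ (b :* (r :* c′) :+ n :* (c :* (r :* b′)))
                     := r :* ((a :* d′ :+ d :* a′) :+ (b :* c′ :+ n :* (c :* b′))))
                     ≈-refl (- 1#) r (x 0F) (x 1F) (x 2F) (x 3F) (y 0F) (y 1F) (y 2F) (y 3F) }
    }
    where
    -- Coordinates 0 and 1 multiply like dual numbers, and so do coordinates 0 and 2; their laws are
    -- therefore borrowed.
    module D = Multiplication dualMultiplication
    assoc₁ = λ a b c d e f → D.assoc (dual a b) (dual c d) (dual e f) 1F
    identity₁ = λ a b → D.identityₗ (dual a b) 1F
    identity₂ = λ a b → D.identityᵣ (dual a b) 1F
    distrib₁ = λ a b c d e f → D.distribₗ (dual a b) (dual c d) (dual e f) 1F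
    distrib₂ = λ a b c d e f → D.distribᵣ (dual a b) (dual c d) (dual e f) 1F
    scale₁ = λ r a b c d → D.scaleₗ r (dual a b) (dual c d) 1F
    scale₂ = λ r a b c d → D.scaleᵣ r (dual a b) (dual c d) 1F

  module SymEval = Evaluation (Free 2) (Free 2) dualMultiplication id

  embed : Carrierᴹ (Free 2) → Carrierᴹ (Free 4)
  embed x 0F = 0#
  embed x 1F = x 0F
  embed x 2F = x 1F
  embed x 3F = 0#

  module ExtEval = Evaluation (Free 2) (Free 4) exteriorMultiplication embed

  open SymEval using () renaming (eval to evalˢ)
  open ExtEval using () renaming (eval to evalᴱ)

  commuting : ∀ {x y} → TensorAlgebra.Commuting (Free 2) x y → ∀ j → evalˢ x j ≈ evalˢ y j
  commuting (TensorAlgebra.commute x y) = components (𝔻M.comm (pair x) (pair y))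

  module SymSound = SymEval.Soundness id (λ _ _ _ → ≈-refl) (λ _ _ _ → ≈-refl)
    (TensorAlgebra.Commuting (Free 2)) commuting

  embed-square : ∀ x j → (embed x ∧ embed x) j ≈ 0#
  embed-square x 0F = zeroˡ _
  embed-square x 1F = ≈-trans (+-cong (zeroˡ _) (zeroʳ _)) (+-identityˡ _)
  embed-square x 2F = ≈-trans (+-cong (zeroˡ _) (zeroʳ _)) (+-identityˡ _)
  embed-square x 3F = ≈-trans (+-cong (≈-trans (+-cong (zeroˡ _) (zeroˡ _)) (+-identityˡ _))
    (≈-trans (+-cong (*-comm _ _) (-1*x≈-x _)) (-‿inverseʳ _))) (+-identityˡ _)

  alternating : ∀ {x y} → TensorAlgebra.Alternating (Free 2) x y → ∀ j → evalᴱ x j ≈ evalᴱ y j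
  alternating (TensorAlgebra.square x) = embed-square x

  embed-cong : ∀ {x y : Carrierᴹ (Free 2)} → (∀ j → x j ≈ y j) → ∀ j → embed x j ≈ embed y j
  embed-cong p 0F = ≈-refl
  embed-cong p 1F = p 0F
  embed-cong p 2F = p 1F
  embed-cong p 3F = ≈-refl

  embed-+ : ∀ (x y : Carrierᴹ (Free 2)) j → embed (λ k → x k + y k) j ≈ embed x j + embed y j
  embed-+ x y 0F = ≈-sym (+-identityˡ _)
  embed-+ x y 1F = ≈-refl
  embed-+ x y 2F = ≈-refl
  embed-+ x y 3F = ≈-sym (+-identityˡ _)

  embed-* : ∀ r (x : Carrierᴹ (Free 2)) j → embed (λ k → r * x k) j ≈ r * embed x j
  embed-* r x 0F = ≈-sym (zeroʳ r)
  embed-* r x 1F = ≈-refl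
  embed-* r x 2F = ≈-refl
  embed-* r x 3F = ≈-sym (zeroʳ r)

  module ExtSound = ExtEval.Soundness embed-cong embed-+ embed-*
    (TensorAlgebra.Alternating (Free 2)) alternating

  -- The first factor reads e₁ as 1 and e₂ as ε.  The resulting p + q ε is paired
  -- with the coefficients of 1 and f₁∧f₂ of the second factor.

  module Form (t i : Carrier) where
    open TensorProduct (SymV 2) (ExtV 1)

    -- There is no term pairing the ε-part with c₁: it would stand for a vertex that lies both on a
    -- matching edge and on F.
    weight : 𝔻 → Carrier → Carrier → Carrier
    weight x c₀ c₁ = (t * proj₁ x + i * proj₂ x) * c₀ + - 1# * (proj₁ x * c₁)

    weight-cong : ∀ {x y c₀ c₁ d₀ d₁} → x ≈ᴰ y → c₀ ≈ d₀ → c₁ ≈ d₁ → weight x c₀ c₁ ≈ weight y d₀ d₁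
    weight-cong x≈y p q = +-cong (*-cong (+-cong (*-congˡ (proj₁ x≈y)) (*-congˡ (proj₂ x≈y))) p)
      (*-congˡ (*-cong (proj₁ x≈y) q))

    apply : Tensor → Carrier
    apply (x ⊗ y) = weight (pair (evalˢ x)) (evalᴱ y 0F) (evalᴱ y 3F)
    apply 𝟘       = 0#
    apply (x ⊕ y) = apply x + apply y
    apply (⊖ x)   = - apply x
    apply (r · x) = r * apply x

    apply-cong : ∀ {x y} → x ≋ y → apply x ≈ apply y
    apply-cong ≋-refl             = ≈-refl
    apply-cong (≋-sym p)          = ≈-sym (apply-cong p)
    apply-cong (≋-trans p q)      = ≈-trans (apply-cong p) (apply-cong q)
    apply-cong (⊗-cong p q)       = weight-cong (SymSound.eval-cong p 0F , SymSound.eval-cong p 1F) (ExtSound.eval-cong q 0F) (ExtSound.eval-cong q 3F)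
    apply-cong (⊕-cong p q)       = +-cong (apply-cong p) (apply-cong q)
    apply-cong (⊖-cong p)         = -‿cong (apply-cong p)
    apply-cong (·-cong r≈s p)     = *-cong r≈s (apply-cong p)
    apply-cong (⊗-+ˡ x x′ y)      = solve 9 (λ n t i p q p′ q′ c d →
      (t :* (p :+ p′) :+ i :* (q :+ q′)) :* c :+ n :* ((p :+ p′) :* d)
      := ((t :* p :+ i :* q) :* c :+ n :* (p :* d)) :+ ((t :* p′ :+ i :* q′) :* c :+ n :* (p′ :* d)))
      ≈-refl (- 1#) t i (evalˢ x 0F) (evalˢ x 1F) (evalˢ x′ 0F) (evalˢ x′ 1F) (evalᴱ y 0F) (evalᴱ y 3F)
    apply-cong (⊗-+ʳ x y y′)      = solve 9 (λ n t i p q c d c′ d′ →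
      (t :* p :+ i :* q) :* (c :+ c′) :+ n :* (p :* (d :+ d′))
      := ((t :* p :+ i :* q) :* c :+ n :* (p :* d)) :+ ((t :* p :+ i :* q) :* c′ :+ n :* (p :* d′)))
      ≈-refl (- 1#) t i (evalˢ x 0F) (evalˢ x 1F) (evalᴱ y 0F) (evalᴱ y 3F) (evalᴱ y′ 0F) (evalᴱ y′ 3F)
    apply-cong (⊗-·ˡ r x y)       = solve 8 (λ n t i r p q c d →
      (t :* (r :* p) :+ i :* (r :* q)) :* c :+ n :* ((r :* p) :* d)
      := r :* ((t :* p :+ i :* q) :* c :+ n :* (p :* d)))
      ≈-refl (- 1#) t i r (evalˢ x 0F) (evalˢ x 1F) (evalᴱ y 0F) (evalᴱ y 3F)
    apply-cong (⊗-·ʳ r x y)       = solve 8 (λ n t i r p q c d →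
      (t :* p :+ i :* q) :* (r :* c) :+ n :* (p :* (r :* d))
      := r :* ((t :* p :+ i :* q) :* c :+ n :* (p :* d)))
      ≈-refl (- 1#) t i r (evalˢ x 0F) (evalˢ x 1F) (evalᴱ y 0F) (evalᴱ y 3F)
    apply-cong (⊕-assoc x y z)    = +-assoc _ _ _
    apply-cong (⊕-comm x y)       = +-comm _ _
    apply-cong (⊕-identityˡ x)    = +-identityˡ _
    apply-cong (⊖-inverseˡ x)     = -‿inverseˡ _
    apply-cong (·-distribˡ r x y) = distribˡ _ _ _
    apply-cong (·-distribʳ x r s) = distribʳ _ _ _
    apply-cong (·-assoc r s x)    = *-assoc _ _ _
    apply-cong (·-identity x)     = *-identityˡ _

    model : ColorModel 2 1
    model = record { form = record
      { ⟦_⟧ = apply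
      ; isLinear = record
        { +ᴹ-isGroupHomomorphism = record
          { isMonoidHomomorphism = record
            { isMagmaHomomorphism = record
              { isRelHomomorphism = record { cong = apply-cong }
              ; homo = λ _ _ → ≈-refl
              }
            ; ε-homo = ≈-refl
            }
          ; ⁻¹-homo = λ _ → ≈-refl
          }
        ; *ₗ-homo = λ _ _ → ≈-refl
        }
      } }

-- Signs of words and the determinant

module Signs (K : CommutativeRing 0ℓ 0ℓ) where
  open CommutativeRing K hiding (zero) renaming (refl to ≈-refl; sym to ≈-sym; trans to ≈-trans)
  open RingProperties ring using (-1*x≈-x; -‿involutive)
  open SemiringSolver commutativeSemiring using (solve; _:=_; _:*_)
  open Exp semiring using (_^_)
  open LinearAlgebra K using (∑; ∏; words; unique?; inverted?; inversions; det)
  module Products = FiniteProducts *-commutativeMonoid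
  open Products using (module Fin∏; listSum; listSum-filter; listSum-cartesian; listSum-tabulate; times-length)
  open Fin∏ using (_without_)

  -1*-1≈1 : - 1# * - 1# ≈ 1#
  -1*-1≈1 = ≈-trans (-1*x≈-x _) (-‿involutive 1#)

  cancel-1 : ∀ x → - 1# * (- 1# * x) ≈ x
  cancel-1 x = ≈-trans (≈-sym (*-assoc _ _ _)) (≈-trans (*-congʳ -1*-1≈1) (*-identityˡ x))

  -- The sign of b - a. Multiplying it over all pairs of positions gives the sign of the Vandermonde
  -- product of a word, with no injectivity assumed.
  g≶ : ∀ {N} → Fin N → Fin N → Carrier
  g≶ a b with FinP.<-cmp a b
  ... | tri< _ _ _ = 1#
  ... | tri≈ _ _ _ = 0#
  ... | tri> _ _ _ = - 1#

  g≶-swap : ∀ {N} (a b : Fin N) → g≶ b a ≈ - 1# * g≶ a b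
  g≶-swap a b with FinP.<-cmp a b | FinP.<-cmp b a
  ... | tri< a<b _ _    | tri< b<a _ _    = contradiction b<a (ℕP.<⇒≯ a<b)
  ... | tri< _ a≢b _    | tri≈ _ b≡a _    = contradiction (sym b≡a) a≢b
  ... | tri< _ _ _      | tri> _ _ _      = ≈-sym (*-identityʳ _)
  ... | tri≈ _ a≡b _    | tri< _ b≢a _    = contradiction (sym a≡b) b≢a
  ... | tri≈ _ _ _      | tri≈ _ _ _      = ≈-sym (zeroʳ _)
  ... | tri≈ _ a≡b _    | tri> _ b≢a _    = contradiction (sym a≡b) b≢a
  ... | tri> _ _ _      | tri< _ _ _      = ≈-sym -1*-1≈1
  ... | tri> _ a≢b _    | tri≈ _ b≡a _    = contradiction (sym b≡a) a≢b
  ... | tri> _ _ b<a    | tri> _ _ a<b    = contradiction b<a (ℕP.<⇒≯ a<b)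

  g≶-equal : ∀ {N} {a b : Fin N} → a ≡ b → g≶ a b ≈ 0#
  g≶-equal {a = a} refl with FinP.<-cmp a a
  ... | tri< _ a≢a _ = contradiction refl a≢a
  ... | tri≈ _ _ _   = ≈-refl
  ... | tri> _ a≢a _ = contradiction refl a≢a

  g≶-less : ∀ {N} {a b : Fin N} → a Fin.< b → g≶ a b ≈ 1#
  g≶-less {a = a} {b} a<b with FinP.<-cmp a b
  ... | tri< _ _ _   = ≈-refl
  ... | tri≈ a≮b _ _ = contradiction a<b a≮b
  ... | tri> a≮b _ _ = contradiction a<b a≮b

  g≶-greater : ∀ {N} {a b : Fin N} → b Fin.< a → g≶ a b ≈ - 1#
  g≶-greater {a = a} {b} b<a with FinP.<-cmp a b
  ... | tri< _ _ b≮a = contradiction b<a b≮a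
  ... | tri≈ _ _ b≮a = contradiction b<a b≮a
  ... | tri> _ _ _   = ≈-refl

  -- For a word with a repeated letter sgn is 0.

  sgn : ∀ {n N} → (Fin n → Fin N) → Carrier
  sgn {zero}  w = 1#
  sgn {suc n} w = ∏ (λ k → g≶ (w zero) (w (suc k))) * sgn (w ∘ suc)

  sgn-cong : ∀ {n N} {v w : Fin n → Fin N} → (∀ i → v i ≡ w i) → sgn v ≈ sgn w
  sgn-cong {zero}  v≗w = ≈-refl
  sgn-cong {suc n} v≗w = *-cong
    (Fin∏.∏-cong {n} λ k → reflexive (cong₂ g≶ (v≗w zero) (v≗w (suc k))))
    (sgn-cong (v≗w ∘ suc))

  ∏-zero : ∀ {n} {z : Fin n → Carrier} i → z i ≈ 0# → ∏ z ≈ 0#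
  ∏-zero {z = z} i zi≈0 = ≈-trans (Fin∏.∏-factor z i) (≈-trans (*-congʳ zi≈0) (zeroˡ _))

  sgn-repeated : ∀ {n N} {w : Fin n → Fin N} i j → i ≢ j → w i ≡ w j → sgn w ≈ 0#
  sgn-repeated zero    zero    i≢j _     = contradiction refl i≢j
  sgn-repeated zero    (suc j) _   wi≡wj = ≈-trans (*-congʳ (∏-zero j (g≶-equal wi≡wj))) (zeroˡ _)
  sgn-repeated (suc i) zero    _   wi≡wj = ≈-trans (*-congʳ (∏-zero i (g≶-equal (sym wi≡wj)))) (zeroˡ _)
  sgn-repeated (suc i) (suc j) i≢j wi≡wj =
    ≈-trans (*-congˡ (sgn-repeated i j (i≢j ∘ cong suc) wi≡wj)) (zeroʳ _)

  sgn-increasing : ∀ {n N} {w : Fin n → Fin N} → (∀ i j → i Fin.< j → w i Fin.< w j) → sgn w ≈ 1#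
  sgn-increasing {zero}  _  = ≈-refl
  sgn-increasing {suc n} w< = ≈-trans
    (*-cong (Fin∏.∏-trivial {n} λ k → g≶-less (w< zero (suc k) ℕ.z<s))
            (sgn-increasing λ i j i<j → w< (suc i) (suc j) (ℕ.s<s i<j)))
    (*-identityˡ 1#)

  -- A relational form of "w is v after the transposition of i and j": it passes to the words
  -- without their first letter and avoids function extensionality.
  record Swapped {n} {A : Set} (i j : Fin n) (v w : Fin n → A) : Set where
    field
      atˡ   : w i ≡ v j
      atʳ   : w j ≡ v i
      other : ∀ k → k ≢ i → k ≢ j → w k ≡ v k

  swapped-flip : ∀ {n A} {i j : Fin n} {v w : Fin n → A} → Swapped i j v w → Swapped j i v w
  swapped-flip s = record { atˡ = atʳ ; atʳ = atˡ ; other = λ k k≢j k≢i → other k k≢i k≢j }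
    where open Swapped s

  swapped-suc : ∀ {n A} {i j : Fin n} {v w : Fin (suc n) → A} →
                Swapped (suc i) (suc j) v w → Swapped i j (v ∘ suc) (w ∘ suc)
  swapped-suc s = record { atˡ = atˡ ; atʳ = atʳ
    ; other = λ k k≢i k≢j → other (suc k) (k≢i ∘ FinP.suc-injective) (k≢j ∘ FinP.suc-injective) }
    where open Swapped s

  ∏-swapped : ∀ {n} {A : Set} {i j : Fin n} {v w : Fin n → A} (f : A → Carrier) → i ≢ j →
              Swapped i j v w → ∏ (f ∘ v) ≈ ∏ (f ∘ w)
  ∏-swapped {n} {i = i} {j} {v} {w} f i≢j s = ≈-trans (split (f ∘ v))
    (≈-trans (solve 3 (λ a b c → a :* (b :* c) := b :* (a :* c)) ≈-refl _ _ _)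
    (≈-trans (*-cong (reflexive (cong f (sym atˡ))) (*-cong (reflexive (cong f (sym atʳ)))
      (Fin∏.∏-cong {n} rest)))
    (≈-sym (split (f ∘ w)))))
    where
    open Swapped s
    split : ∀ z → ∏ z ≈ z i * (z j * ∏ ((z without i) without j))
    split z = ≈-trans (Fin∏.∏-factor z i) (*-congˡ (≈-trans (Fin∏.∏-factor (z without i) j)
      (*-congʳ (Fin∏.without-other z i j (i≢j ∘ sym)))))
    rest : ∀ k → (((f ∘ v) without i) without j) k ≈ (((f ∘ w) without i) without j) k
    rest k with k FinP.≟ j
    ... | yes _ = ≈-refl
    ... | no k≢j with k FinP.≟ i
    ...   | yes _ = ≈-refl
    ...   | no k≢i = reflexive (cong f (sym (other k k≢i k≢j)))

  -- Only the comparison of the first two letters with each other changes sign; their comparisons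
  -- with the later letters trade places.
  sgn-adjacent : ∀ {n N} {v w : Fin (suc (suc n)) → Fin N} →
                 Swapped zero (suc zero) v w → sgn w ≈ - 1# * sgn v
  sgn-adjacent {n} {v = v} {w} s = ≈-trans
    (*-cong (*-cong (≈-trans (reflexive (cong₂ g≶ atˡ atʳ)) (g≶-swap (v zero) (v (suc zero))))
                    (row atˡ))
            (*-cong (row atʳ) (sgn-cong rest)))
    (solve 5 (λ m a b c d → ((m :* a) :* b) :* (c :* d) := m :* ((a :* c) :* (b :* d)))
      ≈-refl _ _ _ _ _)
    where
    open Swapped s
    rest : ∀ k → w (suc (suc k)) ≡ v (suc (suc k))
    rest k = other (suc (suc k)) (λ ()) (λ ())
    row : ∀ {a b} → a ≡ b → ∏ (λ k → g≶ a (w (suc (suc k)))) ≈ ∏ (λ k → g≶ b (v (suc (suc k))))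
    row a≡b = Fin∏.∏-cong {n} λ k → reflexive (cong₂ g≶ a≡b (rest k))

  -- A transposition of position 0 with a later one is conjugated by the swap of positions 0 and 1
  -- to a transposition inside the tail: v to u, u to u′, u′ to w, three sign changes in all.
  sgn-swapped₀ : ∀ {n N} (j : Fin n) {v w : Fin (suc n) → Fin N} →
                 Swapped zero (suc j) v w → sgn w ≈ - 1# * sgn v
  sgn-swapped₀ zero s = sgn-adjacent s
  sgn-swapped₀ {suc n} {N} (suc j) {v} {w} s = begin
    sgn w                        ≈⟨ sgn-adjacent u′w ⟩
    - 1# * sgn u′                ≈⟨ *-congˡ (*-cong (≈-sym (∏-swapped (g≶ (v (suc zero))) (λ ()) uu′))
                                                    (sgn-swapped₀ j uu′)) ⟩
    - 1# * (∏ (λ k → g≶ (u zero) (u (suc k))) * (- 1# * sgn (u ∘ suc)))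
                                 ≈⟨ *-congˡ (solve 3 (λ m a b → a :* (m :* b) := m :* (a :* b)) ≈-refl _ _ _) ⟩
    - 1# * (- 1# * sgn u)        ≈⟨ *-congˡ (*-congˡ (sgn-adjacent vu)) ⟩
    - 1# * (- 1# * (- 1# * sgn v))  ≈⟨ cancel-1 _ ⟩
    - 1# * sgn v                 ∎
    where
    open import Relation.Binary.Reasoning.Setoid setoid
    open Swapped s
    u u′ : Fin (suc (suc n)) → Fin N
    u zero = v (suc zero)
    u (suc zero) = v zero
    u (suc (suc k)) = v (suc (suc k))
    u′ zero = v (suc zero)
    u′ (suc zero) = w zero
    u′ (suc (suc k)) = w (suc (suc k))
    vu : Swapped zero (suc zero) v u
    vu = record { atˡ = refl ; atʳ = refl ; other = λ
      { zero p _ → contradiction refl p ; (suc zero) _ p → contradiction refl p ; (suc (suc k)) _ _ → refl } }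
    u′w : Swapped zero (suc zero) u′ w
    u′w = record { atˡ = refl ; atʳ = other (suc zero) (λ ()) (λ ()) ; other = λ
      { zero p _ → contradiction refl p ; (suc zero) _ p → contradiction refl p ; (suc (suc k)) _ _ → refl } }
    uu′ : Swapped zero (suc j) (u ∘ suc) (u′ ∘ suc)
    uu′ = record { atˡ = atˡ ; atʳ = atʳ ; other = λ
      { zero p _ → contradiction refl p ; (suc k) _ k≢j → other (suc (suc k)) (λ ()) (k≢j ∘ FinP.suc-injective) } }

  sgn-swapped : ∀ {n N} {i j : Fin n} {v w : Fin n → Fin N} → i ≢ j →
                Swapped i j v w → sgn w ≈ - 1# * sgn v
  sgn-swapped {i = zero}  {zero}  i≢j s = contradiction refl i≢j
  sgn-swapped {i = zero}  {suc j} i≢j s = sgn-swapped₀ j s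
  sgn-swapped {i = suc i} {zero}  i≢j s = sgn-swapped₀ i (swapped-flip s)
  sgn-swapped {suc n} {i = suc i} {suc j} {v} {w} i≢j s = ≈-trans
    (*-cong (≈-trans (Fin∏.∏-cong {n} λ k → reflexive (cong (λ a → g≶ a (w (suc k)))
                        (Swapped.other s zero (λ ()) (λ ()))))
                     (≈-sym (∏-swapped (g≶ (v zero)) i≢j′ (swapped-suc s))))
            (sgn-swapped i≢j′ (swapped-suc s)))
    (solve 3 (λ m a b → a :* (m :* b) := m :* (a :* b)) ≈-refl _ _ _)
    where
    i≢j′ : i ≢ j
    i≢j′ = i≢j ∘ cong suc

  -- Padding with 1 on and below the diagonal spreads the product over the whole square, the shape
  -- in which `inversions` enumerates the pairs.
  upper : ∀ {n N} → (Fin n → Fin N) → Fin n → Fin n → Carrier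
  upper w i j = if does (i FinP.<? j) then g≶ (w i) (w j) else 1#

  sgn-upper : ∀ {n N} (w : Fin n → Fin N) → sgn w ≈ ∏ λ i → ∏ λ j → upper w i j
  sgn-upper {zero}  w = ≈-refl
  sgn-upper {suc n} w = *-cong (≈-sym (*-identityˡ _)) (≈-trans (sgn-upper (w ∘ suc))
    (Fin∏.∏-cong {n} λ i → ≈-sym (*-identityˡ _)))

  -- An inversion contributes -1 to both sides and any other pair 1; injectivity excludes equal
  -- letters, where `g≶` would be 0.
  sgn-inversions : ∀ {n} (σ : Vec (Fin n) n) → (∀ i j → lookup σ i ≡ lookup σ j → i ≡ j) →
                   (- 1#) ^ inversions σ ≈ sgn (lookup σ)
  sgn-inversions {n} σ injective = begin
    (- 1#) ^ inversions σ
      ≈⟨ times-length (filter (inverted? σ) pairs) (- 1#) ⟩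
    listSum (filter (inverted? σ) pairs) (λ _ → - 1#)
      ≈⟨ listSum-filter (inverted? σ) (λ _ → - 1#) pairs ⟩
    listSum pairs F
      ≈⟨ listSum-cartesian _,_ F (allFin n) (allFin n) ⟩
    listSum (allFin n) row
      ≡⟨ listSum-tabulate {n} row id ⟩
    ∏ row
      ≈⟨ Fin∏.∏-cong {n} (λ i → ≈-trans (reflexive (listSum-tabulate (λ j → F (i , j)) id))
           (Fin∏.∏-cong {n} (entry i))) ⟩
    ∏ (λ i → ∏ λ j → upper (lookup σ) i j)
      ≈⟨ sgn-upper (lookup σ) ⟨
    sgn (lookup σ) ∎
    where
    open import Relation.Binary.Reasoning.Setoid setoid
    pairs : List (Fin n × Fin n)
    pairs = cartesianProduct (allFin n) (allFin n)
    F : Fin n × Fin n → Carrier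
    F ij = if does (inverted? σ ij) then - 1# else 1#
    row : Fin n → Carrier
    row i = listSum (allFin n) λ j → F (i , j)
    entry : ∀ i j → F (i , j) ≈ upper (lookup σ) i j
    entry i j = compare (i FinP.<? j) (lookup σ j FinP.<? lookup σ i)
      where
      compare : (p : Dec (i Fin.< j)) (q : Dec (lookup σ j Fin.< lookup σ i)) →
                (if does (p ×-dec q) then - 1# else 1#) ≈
                (if does p then g≶ (lookup σ i) (lookup σ j) else 1#)
      compare (no _)    _           = ≈-refl
      compare (yes _)   (yes σj<σi) = ≈-sym (g≶-greater σj<σi)
      compare (yes i<j) (no σj≮σi)  = ≈-sym (g≶-less (ℕP.≤∧≢⇒< (ℕP.≮⇒≥ σj≮σi)
        λ p → ℕP.<⇒≢ i<j (cong toℕ (injective i j (FinP.toℕ-injective p)))))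

  repeated : ∀ {n N} (σ : Vec (Fin N) n) → ¬ Unique σ →
             ∃₂ λ i j → i ≢ j × lookup σ i ≡ lookup σ j
  repeated σ ¬unique with FinP.any? (λ i → FinP.any? λ j → ¬? (i FinP.≟ j) ×-dec (lookup σ i FinP.≟ lookup σ j))
  ... | yes p = p
  ... | no ¬p = contradiction (subst Unique (tabulate∘lookup σ) (tabulate⁺ λ {i} {j} q →
      decidable-stable (i FinP.≟ j) λ i≢j → ¬p (i , j , i≢j , q))) ¬unique

  ∑-filter : ∀ {X : Set} {P : Pred X 0ℓ} (P? : Decidable P) {F G : X → Carrier} →
             (∀ x → P x → F x ≈ G x) → (∀ x → ¬ P x → G x ≈ 0#) →
             ∀ xs → ∑ (filter P? xs) F ≈ ∑ xs G
  ∑-filter P? F≈G G≈0 []       = ≈-refl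
  ∑-filter P? F≈G G≈0 (x ∷ xs) with P? x
  ... | yes p = +-cong (F≈G x p) (∑-filter P? F≈G G≈0 xs)
  ... | no ¬p = ≈-trans (∑-filter P? F≈G G≈0 xs) (≈-sym (≈-trans (+-congʳ (G≈0 x ¬p)) (+-identityˡ _)))

  -- Words with a repeated letter have sign 0 and may be added freely. Without the constraint of
  -- being a permutation, each row can be expanded on its own.
  det-words : ∀ {n} (A : Fin n → Fin n → Carrier) →
              det A ≈ ∑ (words (allFin n) n) λ σ → sgn (lookup σ) * ∏ λ i → A i (lookup σ i)
  det-words {n} A = ∑-filter unique?
    (λ σ unique → *-congʳ (sgn-inversions σ (lookup-injective unique)))
    (λ σ ¬unique → let i , j , i≢j , p = repeated σ ¬unique
                   in ≈-trans (*-congʳ (sgn-repeated i j i≢j p)) (zeroˡ _))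
    (words (allFin n) n)

-- Transpositions, orbits and reversal of cycles

transpose-left : ∀ {n} (i j : Fin n) → transpose i j ⟨$⟩ʳ i ≡ j
transpose-left i j rewrite dec-true (i FinP.≟ i) refl = refl

transpose-right : ∀ {n} (i j : Fin n) → transpose i j ⟨$⟩ʳ j ≡ i
transpose-right i j with j FinP.≟ i
... | yes j≡i = j≡i
... | no _ rewrite dec-true (j FinP.≟ j) refl = refl

transpose-other : ∀ {n} (i j : Fin n) {k} → k ≢ i → k ≢ j → transpose i j ⟨$⟩ʳ k ≡ k
transpose-other i j {k} k≢i k≢j
  rewrite dec-false (k FinP.≟ i) k≢i | dec-false (k FinP.≟ j) k≢j = refl

transpose-natural : ∀ {m n} (ι : Fin m → Fin n) → (∀ {a b} → ι a ≡ ι b → a ≡ b) → ∀ y z a →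
                    transpose (ι y) (ι z) ⟨$⟩ʳ ι a ≡ ι (transpose y z ⟨$⟩ʳ a)
transpose-natural ι injective y z a = at (a FinP.≟ y) (a FinP.≟ z)
  where
  at : Dec (a ≡ y) → Dec (a ≡ z) → transpose (ι y) (ι z) ⟨$⟩ʳ ι a ≡ ι (transpose y z ⟨$⟩ʳ a)
  at (yes refl) _ = trans (transpose-left (ι a) (ι z)) (cong ι (sym (transpose-left a z)))
  at (no _) (yes refl) = trans (transpose-right (ι y) (ι a)) (cong ι (sym (transpose-right y a)))
  at (no a≢y) (no a≢z) = trans (transpose-other (ι y) (ι z) (a≢y ∘ injective) (a≢z ∘ injective))
    (cong ι (sym (transpose-other y z a≢y a≢z)))

permutation-injective : ∀ {m} (π : Permutation′ m) {a b} → π ⟨$⟩ʳ a ≡ π ⟨$⟩ʳ b → a ≡ b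
permutation-injective π p = trans (sym (inverseˡ π)) (trans (cong (π ⟨$⟩ˡ_) p) (inverseˡ π))

iterate : ∀ {m} → Permutation′ m → Fin m → ℕ → Fin m
iterate π a = fold a (π ⟨$⟩ʳ_)

iterate-injective : ∀ {m} (π : Permutation′ m) k {a b} → iterate π a k ≡ iterate π b k → a ≡ b
iterate-injective π zero    p = p
iterate-injective π (suc k) p = iterate-injective π k (permutation-injective π p)

-- Two of the iterates 0 to m agree by pigeonhole, and injectivity moves the coincidence back to a.
-- The bound by m matters because `LeastInOrbit` inspects only the first m iterates.
period : ∀ {m} (π : Permutation′ m) a → ∃ λ p → suc p ℕ.≤ m × iterate π a (suc p) ≡ a
period {m} π a with FinP.pigeonhole (ℕP.n<1+n m) (λ k → iterate π a (toℕ k))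
... | i , k , i<k , πⁱ≡πᵏ with ℕP.m≤n⇒∃[o]m+o≡n i<k
...   | o , i+o≡k = o
        , ℕP.≤-trans (ℕP.m≤n+m (suc o) (toℕ i)) (subst (ℕ._≤ m) (sym i+1+o≡k) (ℕP.≤-pred (FinP.toℕ<n k)))
        , sym (iterate-injective π (toℕ i) (trans πⁱ≡πᵏ
            (trans (cong (iterate π a) (sym i+1+o≡k)) (fold-+ a (π ⟨$⟩ʳ_) (toℕ i)))))
  where
  i+1+o≡k : toℕ i ℕ.+ suc o ≡ toℕ k
  i+1+o≡k = trans (ℕP.+-suc (toℕ i) o) i+o≡k

iterate-multiple : ∀ {m} (π : Permutation′ m) {a} p q → iterate π a p ≡ a → iterate π a (q ℕ.* p) ≡ a
iterate-multiple π p zero    πᵖ≡a = refl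
iterate-multiple π p (suc q) πᵖ≡a = trans (fold-+ _ (π ⟨$⟩ʳ_) p)
  (trans (cong (λ b → iterate π b p) (iterate-multiple π p q πᵖ≡a)) πᵖ≡a)

-- Reducing k modulo the period brings every iterate into the range that `LeastInOrbit` inspects.
least-in-orbit : ∀ {m} (π : Permutation′ m) {a} → LeastInOrbit π a → ∀ k → a Fin.≤ iterate π a k
least-in-orbit {m} π {a} least k with period π a
... | p , p<m , πᵖ≡a = subst (a Fin.≤_) (trans (cong (iterate π a) (FinP.toℕ-fromℕ< r<m)) reduce) (least (fromℕ< r<m))
  where
  r<m : k % suc p ℕ.< m
  r<m = ℕP.<-≤-trans (m%n<n k (suc p)) p<m
  reduce : iterate π a (k % suc p) ≡ iterate π a k
  reduce = trans (cong (λ b → iterate π b (k % suc p)) (sym (iterate-multiple π (suc p) (k / suc p) πᵖ≡a)))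
    (trans (sym (fold-+ a (π ⟨$⟩ʳ_) (k % suc p))) (cong (iterate π a) (sym (m≡m%n+[m/n]*n k (suc p)))))

Reaches : ∀ {m} → Permutation′ m → Fin m → Fin m → Set
Reaches π a b = ∃ λ k → b ≡ iterate π a k

reaches-trans : ∀ {m} (π : Permutation′ m) {a b c} → Reaches π a b → Reaches π b c → Reaches π a c
reaches-trans π (k , refl) (l , refl) = l ℕ.+ k , sym (fold-+ _ (π ⟨$⟩ʳ_) l)

-- Leastness depends on the orbit only as a set, and survives passing to a smaller orbit.
least-transfer : ∀ {m} (π ρ : Permutation′ m) a → (∀ k → Reaches π a (iterate ρ a k)) →
                 LeastInOrbit π a → LeastInOrbit ρ a
least-transfer π ρ a reach least j with reach (toℕ j)
... | l , p = subst (a Fin.≤_) (sym p) (least-in-orbit π least l)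

-- A step backwards is a step forwards repeated one time less than the period, so an orbit of the
-- inverse stays within the orbit of π.
reaches-backward : ∀ {m} (π : Permutation′ m) a k → Reaches π a (iterate (Perm.flip π) a k)
reaches-backward π a zero = 0 , refl
reaches-backward π a (suc k) = reaches-trans π (reaches-backward π a k) step
  where
  b = iterate (Perm.flip π) a k
  step : Reaches π b (π ⟨$⟩ˡ b)
  step with period π b
  ... | p , _ , πᵖ≡b = p , trans (cong (π ⟨$⟩ˡ_) (sym πᵖ≡b)) (inverseˡ π)

module Reversal {m} (π : Permutation′ m) (φ : Fin m → Bool) (φ-invariant : ∀ a → φ (π ⟨$⟩ʳ a) ≡ φ a) where

  φ-invariantˡ : ∀ a → φ (π ⟨$⟩ˡ a) ≡ φ a
  φ-invariantˡ a = trans (sym (φ-invariant (π ⟨$⟩ˡ a))) (cong φ (inverseʳ π))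

  turn : Bool → Fin m → Fin m
  turn b a = if b then π ⟨$⟩ˡ a else π ⟨$⟩ʳ a

  back : Bool → Fin m → Fin m
  back b a = if b then π ⟨$⟩ʳ a else π ⟨$⟩ˡ a

  φ-turn : ∀ b a → φ (turn b a) ≡ φ a
  φ-turn true  = φ-invariantˡ
  φ-turn false = φ-invariant

  φ-back : ∀ b a → φ (back b a) ≡ φ a
  φ-back true  = φ-invariant
  φ-back false = φ-invariantˡ

  turn-back : ∀ b a → turn b (back b a) ≡ a
  turn-back true  a = inverseˡ π
  turn-back false a = inverseʳ π

  back-turn : ∀ b a → back b (turn b a) ≡ a
  back-turn true  a = inverseʳ π
  back-turn false a = inverseˡ π

  -- Cycles on which φ is true are run backwards, the others forwards; as φ is constant along a
  -- cycle, the reading of φ before and after a step agrees and an inverse exists.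
  reversal : Permutation′ m
  reversal = Perm.permutation (λ a → turn (φ a) a) (λ a → back (φ a) a)
    (λ a → trans (cong (λ b → turn b (back (φ a) a)) (φ-back (φ a) a)) (turn-back (φ a) a))
    (λ a → trans (cong (λ b → back b (turn (φ a) a)) (φ-turn (φ a) a)) (back-turn (φ a) a))

  direction : Bool → Permutation′ m
  direction b = if b then Perm.flip π else π

  direction-turn : ∀ b a → direction b ⟨$⟩ʳ a ≡ turn b a
  direction-turn true  a = refl
  direction-turn false a = refl

  -- Invariance of φ fixes the direction for a whole orbit, which is therefore an orbit of π or of
  -- its inverse.
  iterate-reversal : ∀ a k → iterate reversal a k ≡ iterate (direction (φ a)) a k
                             × φ (iterate reversal a k) ≡ φ a
  iterate-reversal a zero = refl , refl
  iterate-reversal a (suc k) with iterate-reversal a k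
  ... | p , q = trans (cong (λ b → turn b (iterate reversal a k)) q)
                  (trans (cong (turn (φ a)) p) (sym (direction-turn (φ a) _)))
              , trans (φ-turn (φ (iterate reversal a k)) _) q

  reaches-direction : ∀ b a k → Reaches π a (iterate (direction b) a k)
  reaches-direction true  a k = reaches-backward π a k
  reaches-direction false a k = k , refl

  direction-reaches : ∀ b a k → Reaches (direction b) a (iterate π a k)
  direction-reaches true  a k = reaches-backward (Perm.flip π) a k
  direction-reaches false a k = k , refl

  least⇒least : ∀ a → LeastInOrbit π a → LeastInOrbit reversal a
  least⇒least a = least-transfer π reversal a λ k →
    subst (Reaches π a) (sym (proj₁ (iterate-reversal a k))) (reaches-direction (φ a) a k)

  least⇐least : ∀ a → LeastInOrbit reversal a → LeastInOrbit π a
  least⇐least a = least-transfer reversal π a λ k →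
    let l , p = direction-reaches (φ a) a k in l , trans p (sym (proj₁ (iterate-reversal a l)))

-- Short-cutting the largest point z that is moved turns it into a fixed point
-- and keeps the least points of all other orbits.

module ShortCut {m} (π : Permutation′ m) (z : Fin m) (z-moved : π ⟨$⟩ʳ z ≢ z)
                (fixed-above : ∀ a → z Fin.< a → π ⟨$⟩ʳ a ≡ a) where

  y : Fin m
  y = π ⟨$⟩ˡ z

  πy≡z : π ⟨$⟩ʳ y ≡ z
  πy≡z = inverseʳ π

  y≢z : y ≢ z
  y≢z p = z-moved (trans (cong (π ⟨$⟩ʳ_) (sym p)) πy≡z)

  y<z : y Fin.< z
  y<z = FinP.≤∧≢⇒< (ℕP.≮⇒≥ λ z<y → y≢z (trans (sym (fixed-above y z<y)) πy≡z)) y≢z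

  πz<z : π ⟨$⟩ʳ z Fin.< z
  πz<z = FinP.≤∧≢⇒< (ℕP.≮⇒≥ λ z<πz → z-moved (permutation-injective π (fixed-above _ z<πz))) z-moved

  -- `∘ₚ` applies its left factor first: y is sent past z to the image of z, and z to itself.
  shortcut : Permutation′ m
  shortcut = transpose y z ∘ₚ π

  shortcut-y : shortcut ⟨$⟩ʳ y ≡ π ⟨$⟩ʳ z
  shortcut-y = cong (π ⟨$⟩ʳ_) (transpose-left y z)

  shortcut-z : shortcut ⟨$⟩ʳ z ≡ z
  shortcut-z = trans (cong (π ⟨$⟩ʳ_) (transpose-right y z)) πy≡z

  shortcut-other : ∀ {a} → a ≢ y → a ≢ z → shortcut ⟨$⟩ʳ a ≡ π ⟨$⟩ʳ a
  shortcut-other a≢y a≢z = cong (π ⟨$⟩ʳ_) (transpose-other y z a≢y a≢z)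

  shortcut-fixed : ∀ a → z Fin.≤ a → shortcut ⟨$⟩ʳ a ≡ a
  shortcut-fixed a z≤a with a FinP.≟ z
  ... | yes refl = shortcut-z
  ... | no a≢z = trans (shortcut-other a≢y a≢z) (fixed-above a z<a)
    where
    z<a : z Fin.< a
    z<a = FinP.≤∧≢⇒< z≤a (a≢z ∘ sym)
    a≢y : a ≢ y
    a≢y p = a≢z (trans (sym (fixed-above a z<a)) (trans (cong (π ⟨$⟩ʳ_) p) πy≡z))

  least-z : LeastInOrbit shortcut z
  least-z j = ℕP.≤-reflexive (cong toℕ (sym (at (toℕ j))))
    where
    at : ∀ k → iterate shortcut z k ≡ z
    at zero    = refl
    at (suc k) = trans (cong (shortcut ⟨$⟩ʳ_) (at k)) shortcut-z

  ¬least-z : ¬ LeastInOrbit π z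
  ¬least-z least = ℕP.<⇒≱ πz<z (least-in-orbit π least 1)

  reaches-shortcut : ∀ a → a ≢ z → ∀ k → Reaches π a (iterate shortcut a k)
  reaches-shortcut a a≢z zero = 0 , refl
  reaches-shortcut a a≢z (suc k) = reaches-trans π (reaches-shortcut a a≢z k) (step _)
    where
    step : ∀ b → Reaches π b (shortcut ⟨$⟩ʳ b)
    step b = at (b FinP.≟ z) (b FinP.≟ y)
      where
      at : Dec (b ≡ z) → Dec (b ≡ y) → Reaches π b (shortcut ⟨$⟩ʳ b)
      at (yes refl) _ = 0 , shortcut-z
      at (no _) (yes refl) = 2 , trans shortcut-y (cong (π ⟨$⟩ʳ_) (sym πy≡z))
      at (no b≢z) (no b≢y) = 1 , shortcut-other b≢y b≢z

  shortcut-avoids : ∀ a → a ≢ z → ∀ k → iterate shortcut a k ≢ z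
  shortcut-avoids a a≢z zero    p = a≢z p
  shortcut-avoids a a≢z (suc k) p =
    shortcut-avoids a a≢z k (permutation-injective shortcut (trans p (sym shortcut-z)))

  -- An orbit of π either follows the short cut or is at the point z just cut out.

  shortcut-reaches : ∀ a → a ≢ z → ∀ k →
    Reaches shortcut a (iterate π a k) ⊎ (iterate π a k ≡ z × Reaches shortcut a y)
  shortcut-reaches a a≢z zero = inj₁ (0 , refl)
  shortcut-reaches a a≢z (suc k) with shortcut-reaches a a≢z k
  ... | inj₂ (p , l , y≡) = inj₁ (suc l , trans (cong (π ⟨$⟩ʳ_) p)
          (trans (sym shortcut-y) (cong (shortcut ⟨$⟩ʳ_) y≡)))
  ... | inj₁ (l , p) with iterate π a k FinP.≟ y
  ...   | yes q = inj₂ (trans (cong (π ⟨$⟩ʳ_) q) πy≡z , l , trans (sym q) p)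
  ...   | no q = inj₁ (suc l , trans (sym (shortcut-other q
            λ r → shortcut-avoids a a≢z l (trans (sym p) r))) (cong (shortcut ⟨$⟩ʳ_) p))

  least⇒least : ∀ a → a ≢ z → LeastInOrbit π a → LeastInOrbit shortcut a
  least⇒least a a≢z = least-transfer π shortcut a (reaches-shortcut a a≢z)

  -- The one point that the short cut can miss is z, and there a ≤ y < z. The inequality y < z is
  -- the reason for cutting out the largest moved point.
  least⇐least : ∀ a → a ≢ z → LeastInOrbit shortcut a → LeastInOrbit π a
  least⇐least a a≢z least j with shortcut-reaches a a≢z (toℕ j)
  ... | inj₁ (l , p) = subst (a Fin.≤_) (sym p) (least-in-orbit shortcut least l)
  ... | inj₂ (p , l , q) = subst (a Fin.≤_) (sym p)
          (ℕP.≤-trans (subst (a Fin.≤_) (sym q) (least-in-orbit shortcut least l)) (ℕP.<⇒≤ y<z))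

-- The sign of a permutation from its number of cycles

module PermutationSigns (K : CommutativeRing 0ℓ 0ℓ) where
  open CommutativeRing K hiding (zero) renaming (refl to ≈-refl; sym to ≈-sym; trans to ≈-trans)
  open Exp semiring using (_^_)
  open LinearAlgebra K using (∏)
  open Signs K
  open Products using (module Fin∏; ∑-distrib-+; listSum-filter; listSum-tabulate; times-length)
  open Fin∏ using (_without_)

  mark : ∀ {m} → Permutation′ m → Fin m → Carrier
  mark π a = if does (leastInOrbit? π a) then 1# else - 1#

  -- The sign in the form (-1)^(m - c): one factor -1 for each point that is not the least of its
  -- cycle.
  ε : ∀ {m} → Permutation′ m → Carrier
  ε π = ∏ (mark π)

  mark-cong : ∀ {m} (π ρ : Permutation′ m) {a} → (LeastInOrbit π a → LeastInOrbit ρ a) →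
              (LeastInOrbit ρ a → LeastInOrbit π a) → mark π a ≈ mark ρ a
  mark-cong π ρ {a} to from = reflexive (cong (if_then 1# else - 1#)
    (does-⇔ (mk⇔ to from) (leastInOrbit? π a) (leastInOrbit? ρ a)))

  mark-least : ∀ {m} (π : Permutation′ m) {a} → LeastInOrbit π a → mark π a ≈ 1#
  mark-least π {a} least = reflexive (cong (if_then 1# else - 1#) (dec-true (leastInOrbit? π a) least))

  mark-¬least : ∀ {m} (π : Permutation′ m) {a} → ¬ LeastInOrbit π a → mark π a ≈ - 1#
  mark-¬least π {a} ¬least = reflexive (cong (if_then 1# else - 1#) (dec-false (leastInOrbit? π a) ¬least))

  -- The mark of z alone changes: z is not least in its old cycle, since its image is smaller, but
  -- is least as a fixed point.
  ε-shortcut : ∀ {m} (π : Permutation′ m) z z-moved fixed-above →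
               ε π ≈ - 1# * ε (ShortCut.shortcut π z z-moved fixed-above)
  ε-shortcut {m} π z z-moved fixed-above = ≈-trans (Fin∏.∏-factor (mark π) z)
    (*-cong (mark-¬least π ¬least-z) (≈-sym (≈-trans (Fin∏.∏-factor (mark shortcut) z)
      (≈-trans (*-congʳ (mark-least shortcut least-z)) (≈-trans (*-identityˡ _)
        (Fin∏.∏-cong {m} rest))))))
    where
    open ShortCut π z z-moved fixed-above
    rest : ∀ a → (mark shortcut without z) a ≈ (mark π without z) a
    rest a with a FinP.≟ z
    ... | yes _ = ≈-refl
    ... | no a≢z = mark-cong shortcut π (least⇐least a a≢z) (least⇒least a a≢z)

  ε-reversal : ∀ {m} (π : Permutation′ m) φ φ-invariant → ε (Reversal.reversal π φ φ-invariant) ≈ ε π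
  ε-reversal {m} π φ φ-invariant = Fin∏.∏-cong {m} λ a → mark-cong reversal π (least⇐least a) (least⇒least a)
    where open Reversal π φ φ-invariant

  -- Start with -1 at each of the m points and insert one more -1 at the least point of every
  -- circuit; the two cancel there.
  ε-circuits : ∀ {m} (π : Permutation′ m) → ε π ≈ ∏ {m} (λ _ → - 1#) * (- 1#) ^ circuits π
  ε-circuits {m} π = ≈-sym (≈-trans
    (*-congˡ (≈-trans (times-length (filter (leastInOrbit? π) (allFin m)) (- 1#))
      (≈-trans (listSum-filter (leastInOrbit? π) (λ _ → - 1#) (allFin m))
        (reflexive (listSum-tabulate {m} sign id)))))
    (≈-trans (≈-sym (∑-distrib-+ {m} (λ _ → - 1#) sign)) (Fin∏.∏-cong {m} λ a → at (leastInOrbit? π a))))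
    where
    sign : Fin m → Carrier
    sign a = if does (leastInOrbit? π a) then - 1# else 1#
    at : ∀ {P : Set} (P? : Dec P) →
         - 1# * (if does P? then - 1# else 1#) ≈ (if does P? then 1# else - 1#)
    at (yes _) = -1*-1≈1
    at (no _)  = *-identityʳ _

  -- Here w arises from v by permuting the letters at the positions ι according to π. The induction
  -- runs over a bound b from which on π fixes every point: cutting out the largest moved point
  -- swaps two letters, which changes `sgn` and `ε` by the same sign.
  sgn-permuted : ∀ {m n N} (π : Permutation′ m) (ι : Fin m → Fin n) →
                 (∀ {a b} → ι a ≡ ι b → a ≡ b) → (v w : Fin n → Fin N) →
                 (∀ a → w (ι a) ≡ v (ι (π ⟨$⟩ʳ a))) →
                 (∀ i → (∀ a → ι a ≢ i) → w i ≡ v i) →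
                 sgn w ≈ ε π * sgn v
  sgn-permuted {m} {n} {N} π ι injective v w on off =
    bounded m ℕP.≤-refl π (λ a m≤a → contradiction (FinP.toℕ<n a) (ℕP.≤⇒≯ m≤a)) w on off
    where
    bounded : ∀ b → b ℕ.≤ m → (π : Permutation′ m) → (∀ a → b ℕ.≤ toℕ a → π ⟨$⟩ʳ a ≡ a) →
              (w : Fin n → Fin N) → (∀ a → w (ι a) ≡ v (ι (π ⟨$⟩ʳ a))) →
              (∀ i → (∀ a → ι a ≢ i) → w i ≡ v i) → sgn w ≈ ε π * sgn v
    bounded zero _ π fixed w on off = ≈-trans (sgn-cong w≗v)
      (≈-sym (≈-trans (*-congʳ (Fin∏.∏-trivial {m} λ a → mark-least π λ j →
        ℕP.≤-reflexive (cong toℕ (sym (iterate-fixed a (toℕ j)))))) (*-identityˡ _)))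
      where
      iterate-fixed : ∀ a k → iterate π a k ≡ a
      iterate-fixed a zero    = refl
      iterate-fixed a (suc k) = trans (cong (π ⟨$⟩ʳ_) (iterate-fixed a k)) (fixed a ℕ.z≤n)
      w≗v : ∀ i → w i ≡ v i
      w≗v i with FinP.any? (λ a → ι a FinP.≟ i)
      ... | yes (a , refl) = trans (on a) (cong (v ∘ ι) (fixed a ℕ.z≤n))
      ... | no ¬∃ = off i λ a p → ¬∃ (a , p)
    bounded (suc b) b<m π fixed w on off with π ⟨$⟩ʳ fromℕ< b<m FinP.≟ fromℕ< b<m
    ... | yes z-fixed = bounded b (ℕP.<⇒≤ b<m) π fixed′ w on off
      where
      fixed′ : ∀ a → b ℕ.≤ toℕ a → π ⟨$⟩ʳ a ≡ a
      fixed′ a b≤a with fromℕ< b<m FinP.≟ a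
      ... | yes refl = z-fixed
      ... | no z≢a = fixed a (ℕP.≤∧≢⇒< b≤a λ p → z≢a (FinP.toℕ-injective (trans (FinP.toℕ-fromℕ< b<m) p)))
    ... | no z-moved = begin
      sgn w                              ≈⟨ cancel-1 _ ⟨
      - 1# * (- 1# * sgn w)              ≈⟨ *-congˡ (sgn-swapped (y≢z ∘ injective) swapped) ⟨
      - 1# * sgn w′                      ≈⟨ *-congˡ (bounded b (ℕP.<⇒≤ b<m) shortcut
                                              (λ a b≤a → shortcut-fixed a (ℕP.≤-trans (ℕP.≤-reflexive z≡b) b≤a)) w′ on′ off′) ⟩
      - 1# * (ε shortcut * sgn v)        ≈⟨ *-assoc _ _ _ ⟨
      (- 1# * ε shortcut) * sgn v        ≈⟨ *-congʳ (ε-shortcut π z z-moved fixed-above) ⟨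
      ε π * sgn v                        ∎
      where
      open import Relation.Binary.Reasoning.Setoid setoid
      z : Fin m
      z = fromℕ< b<m
      z≡b : toℕ z ≡ b
      z≡b = FinP.toℕ-fromℕ< b<m
      fixed-above : ∀ a → z Fin.< a → π ⟨$⟩ʳ a ≡ a
      fixed-above a z<a = fixed a (subst (ℕ._< toℕ a) z≡b z<a)
      open ShortCut π z z-moved fixed-above
      w′ : Fin n → Fin N
      w′ i = w (transpose (ι y) (ι z) ⟨$⟩ʳ i)
      swapped : Swapped (ι y) (ι z) w w′
      swapped = record
        { atˡ = cong w (transpose-left (ι y) (ι z))
        ; atʳ = cong w (transpose-right (ι y) (ι z))
        ; other = λ k k≢y k≢z → cong w (transpose-other (ι y) (ι z) k≢y k≢z)
        }
      on′ : ∀ a → w′ (ι a) ≡ v (ι (shortcut ⟨$⟩ʳ a))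
      on′ a = trans (cong w (transpose-natural ι injective y z a)) (on (transpose y z ⟨$⟩ʳ a))
      off′ : ∀ i → (∀ a → ι a ≢ i) → w′ i ≡ v i
      off′ i i∉ι = trans (cong w (transpose-other (ι y) (ι z) (i∉ι y ∘ sym) (i∉ι z ∘ sym))) (off i i∉ι)

-- Expansion of the characteristic polynomial over edge states

tail head : (G : Graph) → Arc (#E G) → Fin (#V G)
tail G (e , d) = if d then src G e else tgt G e
head   G (e , d) = if d then tgt G e else src G e

-- A state of an edge says which of its two arcs are used, the forward one first.

State : Set
State = Bool × Bool

states : List State
states = (false , false) ∷ (true , true) ∷ (true , false) ∷ (false , true) ∷ []

used : ∀ {m} → Vec State m → Arc m → Bool
used x (e , d) = (if d then proj₁ else proj₂) (lookup x e)

module Expansion (K : CommutativeRing 0ℓ 0ℓ) where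
  open CommutativeRing K hiding (zero) renaming (refl to ≈-refl; sym to ≈-sym; trans to ≈-trans)
  open RingProperties ring using (-1*x≈-x)
  open SemiringSolver commutativeSemiring using (solve; con; _:=_; _:+_; _:*_)
  open LinearAlgebra K using (∑; ∏; words; det)
  open Model K
  open Signs K
  open Products using (module Fin∏)
  open SemiringSum semiring using (*-distribˡ-sum)
  module DP = FiniteProducts dualMonoid
  module Sums = FiniteProducts +-commutativeMonoid
  open DP using (arcSum)
  open CommutativeMonoid dualMonoid using () renaming
    (refl to ᴰ-refl; sym to ᴰ-sym; trans to ᴰ-trans; ∙-cong to *ᴰ-cong; ∙-congˡ to *ᴰ-congˡ;
     ∙-congʳ to *ᴰ-congʳ; assoc to *ᴰ-assoc; identityˡ to *ᴰ-identityˡ; identityʳ to *ᴰ-identityʳ)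

  ∑-scale : ∀ {X : Set} c (xs : List X) (f : X → Carrier) → ∑ xs (λ x → c * f x) ≈ c * ∑ xs f
  ∑-scale c []       f = ≈-sym (zeroʳ c)
  ∑-scale c (x ∷ xs) f = ≈-trans (+-congˡ (∑-scale c xs f)) (≈-sym (distribˡ c _ _))

  -- The number b is the diagonal entry, taken when no arc is chosen, and the ε-part the entry of
  -- the one chosen arc. On 1 + aε it gives b + a, the complete matrix entry.
  functional : Carrier → 𝔻 → Carrier
  functional b x = b * proj₁ x + proj₂ x

  functional-cong : ∀ b {x y} → x ≈ᴰ y → functional b x ≈ functional b y
  functional-cong b x≈y = +-cong (*-congˡ (proj₁ x≈y)) (proj₂ x≈y)

  -- In the row of its tail k an arc offers 1 + yε, in every other row 1. `part` keeps one of the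
  -- two summands: yε when the arc is used, 1 when it is not.
  full : ∀ {n} → Fin n → Carrier → Fin n → 𝔻
  full k y i = if does (k FinP.≟ i) then (1# , y) else 1ᴰ

  part : ∀ {n} → Bool → Fin n → Carrier → Fin n → 𝔻
  part true  k y i = if does (k FinP.≟ i) then (0# , y) else 1ᴰ
  part false k y i = 1ᴰ

  ∏-additive : ∀ {n} {f g h : Fin n → Carrier} k → h k ≈ f k + g k →
               (∀ i → i ≢ k → h i ≈ f i) → (∀ i → i ≢ k → h i ≈ g i) → ∏ h ≈ ∏ f + ∏ g
  ∏-additive {n} {f} {g} {h} k hₖ h≈f h≈g = begin
    ∏ h                        ≈⟨ Fin∏.∏-factor h k ⟩
    h k * r                    ≈⟨ *-congʳ hₖ ⟩
    (f k + g k) * r            ≈⟨ distribʳ r (f k) (g k) ⟩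
    f k * r + g k * r          ≈⟨ +-cong (Fin∏.∏-pull k self (other {f} h≈f)) (Fin∏.∏-pull k self (other {g} h≈g)) ⟨
    ∏ f + ∏ g                  ∎
    where
    open import Relation.Binary.Reasoning.Setoid setoid
    r : Carrier
    r = ∏ (h Fin∏.without k)
    self : (h Fin∏.without k) k ≈ 1#
    self = Fin∏.without-self h k
    other : ∀ {f : Fin n → Carrier} → (∀ i → i ≢ k → h i ≈ f i) → ∀ i → i ≢ k → (h Fin∏.without k) i ≈ f i
    other h≈f i i≢k = ≈-trans (Fin∏.without-other h k i i≢k) (h≈f i i≢k)

  -- An arc matters only in the row of its tail, and the product over the rows is additive in that
  -- row. The value y may vary with the row because it involves the column chosen there.
  split-arc : ∀ {n} (b : Fin n → Carrier) (u : Fin n → 𝔻) k (y : Fin n → Carrier) →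
    ∏ (λ i → functional (b i) (u i *ᴰ full k (y i) i))
    ≈ ∏ (λ i → functional (b i) (u i *ᴰ part true k (y i) i)) + ∏ (λ i → functional (b i) (u i *ᴰ part false k (y i) i))
  split-arc {n} b u k y = ∏-additive {n} {f} {g} {h} k at
    (λ i i≢k → reflexive (cong (λ z → functional (b i) (u i *ᴰ z)) (trans (full-off i i≢k) (sym (part-off i i≢k)))))
    (λ i i≢k → reflexive (cong (λ z → functional (b i) (u i *ᴰ z)) (full-off i i≢k)))
    where
    f g h : Fin n → Carrier
    f i = functional (b i) (u i *ᴰ part true k (y i) i)
    g i = functional (b i) (u i *ᴰ part false k (y i) i)
    h i = functional (b i) (u i *ᴰ full k (y i) i)
    full-off : ∀ i → i ≢ k → full k (y i) i ≡ 1ᴰ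
    full-off i i≢k rewrite dec-false (k FinP.≟ i) (i≢k ∘ sym) = refl
    part-off : ∀ i → i ≢ k → part true k (y i) i ≡ 1ᴰ
    part-off i i≢k rewrite dec-false (k FinP.≟ i) (i≢k ∘ sym) = refl
    at : functional (b k) (u k *ᴰ full k (y k) k)
         ≈ functional (b k) (u k *ᴰ part true k (y k) k) + functional (b k) (u k *ᴰ part false k (y k) k)
    at rewrite dec-true (k FinP.≟ k) refl = solve 4 (λ b p q y →
      b :* (p :* con 1) :+ (p :* y :+ q :* con 1)
      := (b :* (p :* con 0) :+ (p :* y :+ q :* con 0)) :+ (b :* (p :* con 1) :+ (p :* con 0 :+ q :* con 1)))
      ≈-refl (b k) (proj₁ (u k)) (proj₂ (u k)) (y k)

  -- Induction on the edges; u accumulates the choices already made, so that the statement applies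
  -- again to the remaining edges.
  expand : ∀ {n} m (b : Fin n → Carrier) (u : Fin n → 𝔻) (τ : Arc m → Fin n) (y : Arc m → Fin n → Carrier) →
    ∏ (λ i → functional (b i) (u i *ᴰ arcSum λ α → full (τ α) (y α i) i))
    ≈ ∑ (words states m) λ x → ∏ λ i → functional (b i) (u i *ᴰ arcSum λ α → part (used x α) (τ α) (y α i) i)
  expand zero    b u τ y = ≈-sym (+-identityʳ _)
  expand {n} (suc m) b u τ y = begin
    ∏ (λ i → functional (b i) (u i *ᴰ ((Fᵗ i *ᴰ Fᶠ i) *ᴰ R i)))
      ≈⟨ rearrange Fᵗ Fᶠ ⟩
    ∏ (λ i → functional (b i) (((u i *ᴰ R i) *ᴰ Fᵗ i) *ᴰ Fᶠ i))
      ≈⟨ split-arc b _ (τ (zero , false)) (y (zero , false)) ⟩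
    ∏ (λ i → functional (b i) (((u i *ᴰ R i) *ᴰ Fᵗ i) *ᴰ Pᶠ true i)) +
    ∏ (λ i → functional (b i) (((u i *ᴰ R i) *ᴰ Fᵗ i) *ᴰ Pᶠ false i))
      ≈⟨ +-cong (split true) (split false) ⟩
    (T true true + T false true) + (T true false + T false false)
      ≈⟨ solve 4 (λ tt ft tf ff → (tt :+ ft) :+ (tf :+ ff) := ff :+ (tt :+ (tf :+ (ft :+ con 0))))
           ≈-refl (T true true) (T false true) (T true false) (T false false) ⟩
    ∑ states (λ s → T (proj₁ s) (proj₂ s))
      ≈⟨ Sums.listSum-cong states term ⟩
    ∑ states (λ s → ∑ (words states m) λ x → W (s Vec.∷ x))
      ≈⟨ Sums.listSum-cartesian Vec._∷_ W states (words states m) ⟨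
    ∑ (words states (suc m)) W ∎
    where
    open import Relation.Binary.Reasoning.Setoid setoid
    open CommutativeMonoidSolver dualMonoid using (_⊕_; _⊜_) renaming (solve to solveᴰ)
    τ′ : Arc m → Fin n
    τ′ (e , d) = τ (suc e , d)
    y′ : Arc m → Fin n → Carrier
    y′ (e , d) = y (suc e , d)
    R Fᵗ Fᶠ : Fin n → 𝔻
    R i = arcSum λ α → full (τ′ α) (y′ α i) i
    Fᵗ i = full (τ (zero , true)) (y (zero , true) i) i
    Fᶠ i = full (τ (zero , false)) (y (zero , false) i) i
    Pᵗ Pᶠ : Bool → Fin n → 𝔻
    Pᵗ c i = part c (τ (zero , true)) (y (zero , true) i) i
    Pᶠ c i = part c (τ (zero , false)) (y (zero , false) i) i
    W : Vec State (suc m) → Carrier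
    W x = ∏ λ i → functional (b i) (u i *ᴰ arcSum λ α → part (used x α) (τ α) (y α i) i)
    T : Bool → Bool → Carrier
    T c d = ∏ λ i → functional (b i) ((u i *ᴰ (Pᵗ c i *ᴰ Pᶠ d i)) *ᴰ R i)
    rearrange : ∀ (f g : Fin n → 𝔻) → ∏ (λ i → functional (b i) (u i *ᴰ ((f i *ᴰ g i) *ᴰ R i)))
                        ≈ ∏ (λ i → functional (b i) (((u i *ᴰ R i) *ᴰ f i) *ᴰ g i))
    rearrange f g = Fin∏.∏-cong {n} λ i → functional-cong (b i)
      (solveᴰ 4 (λ u f g r → u ⊕ ((f ⊕ g) ⊕ r) ⊜ ((u ⊕ r) ⊕ f) ⊕ g) ᴰ-refl (u i) (f i) (g i) (R i))
    split : ∀ d → ∏ (λ i → functional (b i) (((u i *ᴰ R i) *ᴰ Fᵗ i) *ᴰ Pᶠ d i)) ≈ T true d + T false d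
    split d = ≈-trans
      (Fin∏.∏-cong {n} λ i → functional-cong (b i)
        (solveᴰ 4 (λ u r f p → ((u ⊕ r) ⊕ f) ⊕ p ⊜ ((u ⊕ r) ⊕ p) ⊕ f) ᴰ-refl (u i) (R i) (Fᵗ i) (Pᶠ d i)))
      (≈-trans (split-arc b _ (τ (zero , true)) (y (zero , true))) (+-cong (side true) (side false)))
      where
      side : ∀ c → ∏ (λ i → functional (b i) (((u i *ᴰ R i) *ᴰ Pᶠ d i) *ᴰ Pᵗ c i)) ≈ T c d
      side c = Fin∏.∏-cong {n} λ i → functional-cong (b i)
        (solveᴰ 4 (λ u r p q → ((u ⊕ r) ⊕ p) ⊕ q ⊜ (u ⊕ (q ⊕ p)) ⊕ r) ᴰ-refl (u i) (R i) (Pᶠ d i) (Pᵗ c i))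
    term : ∀ s → T (proj₁ s) (proj₂ s) ≈ ∑ (words states m) λ x → W (s Vec.∷ x)
    term (c , d) = ≈-trans (expand m b (λ i → u i *ᴰ (Pᵗ c i *ᴰ Pᶠ d i)) τ′ y′)
      (Sums.listSum-cong (words states m) λ x → Fin∏.∏-cong {n} λ i → functional-cong (b i) (*ᴰ-assoc _ _ _))

  -- (1 + aε)(1 + bε) = 1 + (a + b)ε, so a sum over edges becomes a product of dual numbers.
  ∏-unipotent : ∀ {m} (z : Fin m → 𝔻) (a : Fin m → Carrier) → (∀ e → z e ≈ᴰ (1# , a e)) →
                DP.sum z ≈ᴰ (1# , Sums.sum a)
  ∏-unipotent {zero}  z a z≈ = ᴰ-refl
  ∏-unipotent {suc m} z a z≈ = ᴰ-trans (*ᴰ-cong (z≈ zero) (∏-unipotent (z ∘ suc) (a ∘ suc) (z≈ ∘ suc)))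
    (*-identityˡ 1# , solve 2 (λ a s → con 1 :* s :+ a :* con 1 := a :+ s) ≈-refl (a zero) _)

  module Determinant (G : Graph) (t : Carrier) where

    δ : ∀ {n} → Fin n → Fin n → Carrier → Carrier
    δ i j c = if does (i FinP.≟ j) then c else 0#

    -- A row i offers the diagonal entry t, or one used arc starting at i: the
    -- dual numbers make a second such arc vanish.

    row : Vec State (#E G) → Fin (#V G) → Fin (#V G) → Carrier
    row x i j = functional (δ i j t) (arcSum λ α → part (used x α) (tail G α) (δ (head G α) j (- 1#)) i)

    contribution : Vec State (#E G) → Carrier
    contribution x = ∑ (words (allFin (#V G)) (#V G)) λ σ → sgn (lookup σ) * ∏ λ i → row x i (lookup σ i)

    private
      open Mult +-monoid using (×-homo-+) renaming (_×_ to _times_)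

      entry : Fin (#V G) → Fin (#V G) → Arc (#E G) → Carrier
      entry i j α = if does (tail G α FinP.≟ i) then δ (head G α) j (- 1#) else 0#

      joined : Fin (#V G) → Fin (#V G) → Fin (#E G) → Carrier
      joined i j e = if does (joins? G i j e) then 1# else 0#

      multiplicity-sum : ∀ i j → multiplicity G i j times 1# ≈ Sums.sum (joined i j)
      multiplicity-sum i j = ≈-trans (Sums.times-length (filter (joins? G i j) (allFin (#E G))) 1#)
        (≈-trans (Sums.listSum-filter (joins? G i j) (λ _ → 1#) (allFin (#E G)))
          (reflexive (Sums.listSum-tabulate (joined i j) id)))

      sum-negative : ∀ {m} (f : Fin m → Carrier) → Sums.sum (λ e → - 1# * f e) ≈ - Sums.sum f
      sum-negative {m} f = ≈-trans (≈-sym (*-distribˡ-sum {m} (- 1#) f)) (-1*x≈-x _)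

      -- A loop counts twice on the diagonal of the adjacency matrix, and both of its arcs run from
      -- i to i.
      diagonal : ∀ {P Q : Set} (p : Dec P) (q : Dec Q) →
        - 1# * ((if does ((p ×-dec q) ⊎-dec (p ×-dec q)) then 1# else 0#) +
                (if does ((p ×-dec q) ⊎-dec (p ×-dec q)) then 1# else 0#))
        ≈ (if does p then (if does q then - 1# else 0#) else 0#) +
          (if does q then (if does p then - 1# else 0#) else 0#)
      diagonal (yes _) (yes _) = solve 1 (λ n → n :* (con 1 :+ con 1) := n :+ n) ≈-refl (- 1#)
      diagonal (yes _) (no _)  = solve 1 (λ n → n :* (con 0 :+ con 0) := con 0 :+ con 0) ≈-refl (- 1#)
      diagonal (no _)  (yes _) = solve 1 (λ n → n :* (con 0 :+ con 0) := con 0 :+ con 0) ≈-refl (- 1#)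
      diagonal (no _)  (no _)  = solve 1 (λ n → n :* (con 0 :+ con 0) := con 0 :+ con 0) ≈-refl (- 1#)

      -- For i ≠ j at most one of the two arcs of an edge runs from i to j; the last argument rules
      -- out both.
      off-diagonal : ∀ {P Q R S : Set} (p : Dec P) (q : Dec Q) (r : Dec R) (s : Dec S) → (P → R → S → ¬ Q) →
        - 1# * (if does ((p ×-dec q) ⊎-dec (r ×-dec s)) then 1# else 0#)
        ≈ (if does p then (if does q then - 1# else 0#) else 0#) +
          (if does s then (if does r then - 1# else 0#) else 0#)
      off-diagonal (yes p) (yes q) (yes r) (yes s) ¬q = contradiction q (¬q p r s)
      off-diagonal (yes _) (yes _) (yes _) (no _)  _ = ≈-trans (*-identityʳ _) (≈-sym (+-identityʳ _))
      off-diagonal (yes _) (yes _) (no _)  (yes _) _ = ≈-trans (*-identityʳ _) (≈-sym (+-identityʳ _))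
      off-diagonal (yes _) (yes _) (no _)  (no _)  _ = ≈-trans (*-identityʳ _) (≈-sym (+-identityʳ _))
      off-diagonal (yes _) (no _)  (yes _) (yes _) _ = ≈-trans (*-identityʳ _) (≈-sym (+-identityˡ _))
      off-diagonal (yes _) (no _)  (yes _) (no _)  _ = ≈-trans (zeroʳ _) (≈-sym (+-identityˡ _))
      off-diagonal (yes _) (no _)  (no _)  (yes _) _ = ≈-trans (zeroʳ _) (≈-sym (+-identityˡ _))
      off-diagonal (yes _) (no _)  (no _)  (no _)  _ = ≈-trans (zeroʳ _) (≈-sym (+-identityˡ _))
      off-diagonal (no _)  _       (yes _) (yes _) _ = ≈-trans (*-identityʳ _) (≈-sym (+-identityˡ _))
      off-diagonal (no _)  _       (yes _) (no _)  _ = ≈-trans (zeroʳ _) (≈-sym (+-identityˡ _))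
      off-diagonal (no _)  _       (no _)  (yes _) _ = ≈-trans (zeroʳ _) (≈-sym (+-identityˡ _))
      off-diagonal (no _)  _       (no _)  (no _)  _ = ≈-trans (zeroʳ _) (≈-sym (+-identityˡ _))

      adjacency-sum : ∀ i j → - (adjacency G i j times 1#) ≈ Sums.sum λ e → entry i j (e , true) + entry i j (e , false)
      adjacency-sum i j with i FinP.≟ j
      ... | yes refl = ≈-trans (-‿cong (≈-trans (×-homo-+ 1# (multiplicity G i i) _)
              (≈-trans (+-cong (multiplicity-sum i i) (≈-trans (×-homo-+ 1# (multiplicity G i i) 0)
                (≈-trans (+-identityʳ _) (multiplicity-sum i i))))
              (≈-sym (Sums.∑-distrib-+ (joined i i) (joined i i))))))
            (≈-trans (≈-sym (sum-negative (λ e → joined i i e + joined i i e)))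
              (Sums.Fin∏.∏-cong {#E G} λ e → diagonal (src G e FinP.≟ i) (tgt G e FinP.≟ i)))
      ... | no i≢j = ≈-trans (-‿cong (multiplicity-sum i j)) (≈-trans (≈-sym (sum-negative (joined i j)))
              (Sums.Fin∏.∏-cong {#E G} λ e → off-diagonal (src G e FinP.≟ i) (tgt G e FinP.≟ j)
                (src G e FinP.≟ j) (tgt G e FinP.≟ i) λ p r _ _ → i≢j (trans (sym p) r)))

      full-row : ∀ i j → δ i j t - (adjacency G i j times 1#)
        ≈ functional (δ i j t) (1ᴰ *ᴰ arcSum λ α → full (tail G α) (δ (head G α) j (- 1#)) i)
      full-row i j = ≈-trans (+-cong (≈-sym (*-identityʳ _)) (adjacency-sum i j))
        (functional-cong (δ i j t) (ᴰ-sym (ᴰ-trans (*ᴰ-identityˡ _)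
          (∏-unipotent _ _ λ e → ᴰ-trans (*ᴰ-cong (unipotent (e , true)) (unipotent (e , false)))
            (*-identityˡ 1# , solve 2 (λ a b → con 1 :* b :+ a :* con 1 := a :+ b) ≈-refl _ _)))))
        where
        unipotent : ∀ α → full (tail G α) (δ (head G α) j (- 1#)) i ≈ᴰ (1# , entry i j α)
        unipotent α with does (tail G α FinP.≟ i)
        ... | true  = ᴰ-refl
        ... | false = ᴰ-refl

    -- For each word the product over the rows is a sum over states, and exchanging the two sums
    -- collects the words belonging to one state.
    charPoly-expansion : LinearAlgebra.charPoly K G t ≈ ∑ (words states (#E G)) contribution
    charPoly-expansion = begin
      det M
        ≈⟨ det-words M ⟩
      ∑ ws (λ σ → sgn (lookup σ) * ∏ λ i → M i (lookup σ i))
        ≈⟨ Sums.listSum-cong ws (λ σ → ≈-trans (*-congˡ (expanded σ)) (≈-sym (∑-scale (sgn (lookup σ)) xs _))) ⟩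
      ∑ ws (λ σ → ∑ xs λ x → sgn (lookup σ) * ∏ λ i → row x i (lookup σ i))
        ≈⟨ Sums.listSum-comm ws xs _ ⟩
      ∑ xs contribution ∎
      where
      open import Relation.Binary.Reasoning.Setoid setoid
      ws = words (allFin (#V G)) (#V G)
      xs = words states (#E G)
      M : Fin (#V G) → Fin (#V G) → Carrier
      M i j = δ i j t - (adjacency G i j times 1#)
      expanded : ∀ σ → ∏ (λ i → M i (lookup σ i)) ≈ ∑ xs λ x → ∏ λ i → row x i (lookup σ i)
      expanded σ = ≈-trans (Fin∏.∏-cong {#V G} λ i → full-row i (lookup σ i))
        (≈-trans (expand (#E G) (λ i → δ i (lookup σ i) t) (λ _ → 1ᴰ) (tail G)
                         (λ α i → δ (head G α) (lookup σ i) (- 1#)))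
          (Sums.listSum-cong xs λ x → Fin∏.∏-cong {#V G} λ i →
            functional-cong (δ i (lookup σ i) t) (*ᴰ-identityˡ _)))

-- The contribution of a single state

Used : ∀ {m} → Vec State m → Arc m → Set
Used x α = used x α ≡ true

-- Once v is removed from the codomain, n positions share n - 1 letters.
missed⇒repeated : ∀ {n} (w : Fin n → Fin n) v → (∀ i → w i ≢ v) → ∃₂ λ i j → i ≢ j × w i ≡ w j
missed⇒repeated {suc n} w v missed
  with FinP.pigeonhole (ℕP.n<1+n n) (λ i → punchOut (missed i ∘ sym))
... | i , j , i<j , p = i , j , (λ i≡j → ℕP.<⇒≢ i<j (cong toℕ i≡j)) , FinP.punchOut-injective (missed i ∘ sym) (missed j ∘ sym) p

module Evaluations (K : CommutativeRing 0ℓ 0ℓ) where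
  open CommutativeRing K hiding (zero) renaming (refl to ≈-refl; sym to ≈-sym; trans to ≈-trans)
  open SemiringSolver commutativeSemiring using (solve; con; _:=_; _:+_; _:*_)
  open LinearAlgebra K using (∑; ∏; words)
  open Model K
  open Signs K
  open Expansion K
  open Products using (module Fin∏)
  open DP using (module Arc∏)
  open CommutativeMonoid dualMonoid using () renaming (refl to ᴰ-refl; trans to ᴰ-trans; ∙-cong to *ᴰ-cong; reflexive to ᴰ-reflexive)

  part-on : ∀ {n} {k i : Fin n} {u} y → u ≡ true → k ≡ i → part u k y i ≡ (0# , y)
  part-on {k = k} y refl refl rewrite dec-true (k FinP.≟ k) refl = refl

  part-elsewhere : ∀ {n} {k i : Fin n} u y → k ≢ i → part u k y i ≡ 1ᴰ
  part-elsewhere false y k≢i = refl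
  part-elsewhere {k = k} {i} true y k≢i rewrite dec-false (k FinP.≟ i) k≢i = refl

  part-off : ∀ {n} {k i : Fin n} {u} y → (u ≡ true → k ≢ i) → part u k y i ≡ 1ᴰ
  part-off {u = false} y _  = refl
  part-off {u = true}  y off = part-elsewhere true y (off refl)

  -- The product (yε)(zε) vanishes; the hypothesis has the shape delivered by `∏-factor₂`.
  ε-square : ∀ {x a b : 𝔻} {y z r} → x ≈ᴰ a *ᴰ (b *ᴰ r) → a ≡ (0# , y) → b ≡ (0# , z) → x ≈ᴰ (0# , 0#)
  ε-square {y = y} {z} {r} p refl refl = ᴰ-trans p
    ( zeroˡ _
    , solve 4 (λ y z r s → con 0 :* (con 0 :* s :+ z :* r) :+ y :* (con 0 :* r) := con 0) ≈-refl y z (proj₁ r) (proj₂ r))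

  module Contributions (G : Graph) (t : Carrier) where
    open Determinant G t using (δ; row; contribution)

    δ-same : ∀ {n} {i j : Fin n} c → i ≡ j → δ i j c ≈ c
    δ-same {i = i} c refl rewrite dec-true (i FinP.≟ i) refl = ≈-refl

    δ-different : ∀ {n} {i j : Fin n} c → i ≢ j → δ i j c ≈ 0#
    δ-different {i = i} {j} c i≢j rewrite dec-false (i FinP.≟ j) i≢j = ≈-refl

    module _ (x : Vec State (#E G)) where

      private
        factors : Fin (#V G) → Fin (#V G) → Arc (#E G) → 𝔻
        factors i j α = part (used x α) (tail G α) (δ (head G α) j (- 1#)) i

      row-idle : ∀ {i} → (∀ α → Used x α → tail G α ≢ i) → ∀ j → row x i j ≈ δ i j t
      row-idle {i} idle j = ≈-trans
        (functional-cong (δ i j t) (Arc∏.∏-trivial {z = factors i j} λ α → ᴰ-reflexive (part-off _ (idle α))))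
        (≈-trans (+-identityʳ _) (*-identityʳ _))

      row-single : ∀ {i} α → Used x α → tail G α ≡ i → (∀ β → Used x β → tail G β ≡ i → β ≡ α) →
                   ∀ j → row x i j ≈ δ (head G α) j (- 1#)
      row-single {i} α u p unique j = ≈-trans
        (functional-cong (δ i j t) (ᴰ-trans
          (Arc∏.∏-single {z = factors i j} α λ β β≢α → ᴰ-reflexive (part-off _ λ v q → β≢α (unique β v q)))
          (ᴰ-reflexive (part-on _ u p))))
        (≈-trans (+-congʳ (zeroʳ _)) (+-identityˡ _))

      functional-zero : ∀ b {y} → y ≈ᴰ (0# , 0#) → functional b y ≈ 0#
      functional-zero b p = ≈-trans (functional-cong b p) (≈-trans (+-identityʳ _) (zeroʳ b))

      -- A used arc no longer offers the summand 1, so it forces the column of its row to be its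
      -- head.
      row-elsewhere : ∀ {i j} α → Used x α → tail G α ≡ i → head G α ≢ j → row x i j ≈ 0#
      row-elsewhere {i} {j} α u p q = functional-zero (δ i j t)
        (ᴰ-trans (Arc∏.∏-factor (factors i j) α) (ᴰ-trans (*ᴰ-cong {y = 0# , 0#}
          (ᴰ-trans (ᴰ-reflexive (part-on _ u p)) (≈-refl , δ-different (- 1#) q)) ᴰ-refl)
          (zeroˡ _ , ≈-trans (+-cong (zeroˡ _) (zeroˡ _)) (+-identityˡ 0#))))

      row-conflict : ∀ {i} α β → α ≢ β → Used x α → Used x β → tail G α ≡ i → tail G β ≡ i →
                     ∀ j → row x i j ≈ 0#
      row-conflict {i} α β α≢β u v p q j = functional-zero (δ i j t)
        (ε-square (proj₂ (Arc∏.∏-factor₂ (factors i j) α≢β)) (part-on _ u p) (part-on _ v q))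

      private
        n = #V G

        -- The vanishing results below all have this form: every word is killed by its sign or by
        -- one of its rows.
        vanish : (∀ (σ : Vec (Fin n) n) → sgn (lookup σ) ≈ 0# ⊎ ∃ λ i → row x i (lookup σ i) ≈ 0#) →
                 contribution x ≈ 0#
        vanish zeros = Sums.listSum-ε (words (allFin n) n) λ σ →
          [ (λ p → ≈-trans (*-congʳ p) (zeroˡ _))
          , (λ (i , p) → ≈-trans (*-congˡ (∏-zero i p)) (zeroʳ _)) ]′ (zeros σ)

      same-tail : ∀ α β → α ≢ β → Used x α → Used x β → tail G α ≡ tail G β → contribution x ≈ 0#
      same-tail α β α≢β u v p = vanish λ σ → inj₂ (tail G α , row-conflict α β α≢β u v refl (sym p) _)

      -- The word would have to take the common head as its letter at both tails, and a repeated
      -- letter has sign 0.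
      same-head : ∀ α β → α ≢ β → Used x α → Used x β → head G α ≡ head G β → contribution x ≈ 0#
      same-head α β α≢β u v p with tail G α FinP.≟ tail G β
      ... | yes q = same-tail α β α≢β u v q
      ... | no tails≢ = vanish zeros
        where
        zeros : ∀ σ → _ ⊎ _
        zeros σ with head G α FinP.≟ lookup σ (tail G α) | head G β FinP.≟ lookup σ (tail G β)
        ... | no q  | _     = inj₂ (tail G α , row-elsewhere α u refl q)
        ... | yes _ | no q  = inj₂ (tail G β , row-elsewhere β v refl q)
        ... | yes q | yes r = inj₁ (sgn-repeated (tail G α) (tail G β) tails≢ (trans (sym q) (trans p r)))

      -- Some position i must carry the letter `tail G α`. A used arc leaving i has another head; if
      -- no arc leaves i, the row allows only the letter i, but α leaves its own tail.
      source : ∀ α → Used x α → (∀ β → Used x β → head G β ≢ tail G α) → contribution x ≈ 0#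
      source α u no-head = vanish zeros
        where
        zeros : ∀ σ → _ ⊎ _
        zeros σ with FinP.any? (λ i → lookup σ i FinP.≟ tail G α)
        ... | no ¬∃ = let i , j , i≢j , p = missed⇒repeated (lookup σ) (tail G α) λ i p → ¬∃ (i , p)
                      in inj₁ (sgn-repeated i j i≢j p)
        ... | yes (i , p) with anyArc? (λ β → (used x β BoolP.≟ true) ×-dec (tail G β FinP.≟ i))
        ...   | yes (β , v , q) = inj₂ (i , row-elsewhere β v q λ r → no-head β v (trans r p))
        ...   | no ¬∃ = inj₂ (i , ≈-trans (row-idle (λ β v q → ¬∃ (β , v , q)) _)
                  (δ-different t λ q → ¬∃ (α , u , trans (sym p) (sym q))))

      -- No used arc leaves v, so v is a fixed point of the word, while α forces the letter v at a
      -- second position.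
      sink : ∀ α → Used x α → (∀ β → Used x β → tail G β ≢ head G α) → contribution x ≈ 0#
      sink α u no-tail = vanish zeros
        where
        v = head G α
        zeros : ∀ σ → _ ⊎ _
        zeros σ with v FinP.≟ lookup σ (tail G α) | v FinP.≟ lookup σ v
        ... | no q  | _     = inj₂ (tail G α , row-elsewhere α u refl q)
        ... | yes _ | no q  = inj₂ (v , ≈-trans (row-idle no-tail _) (δ-different t q))
        ... | yes q | yes r = inj₁ (sgn-repeated (tail G α) v (no-tail α u) (trans (sym q) r))

      -- H is arbitrary so that the induction can absorb the first letter into it.
      words-single : ∀ {n N} (s : Fin n → Fin N) (c : Fin n → Carrier) (H : Vec (Fin N) n → Carrier) →
        ∑ (words (allFin N) n) (λ σ → H σ * ∏ λ i → δ (s i) (lookup σ i) (c i)) ≈ H (Vec.tabulate s) * ∏ c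
      words-single {zero}  s c H = +-identityʳ _
      words-single {suc n} {N} s c H = begin
        ∑ (words (allFin N) (suc n)) (λ σ → H σ * ∏ λ i → δ (s i) (lookup σ i) (c i))
          ≈⟨ Sums.listSum-cartesian Vec._∷_ _ (allFin N) (words (allFin N) n) ⟩
        ∑ (allFin N) T
          ≡⟨ Sums.listSum-tabulate T id ⟩
        Sums.sum T
          ≈⟨ Sums.Fin∏.∏-cong {N} eval ⟩
        Sums.sum (λ j → δ (s zero) j (c zero) * rest j)
          ≈⟨ Sums.Fin∏.∏-single (s zero) (λ j j≢s → ≈-trans (*-congʳ (δ-different (c zero) (j≢s ∘ sym))) (zeroˡ _)) ⟩
        δ (s zero) (s zero) (c zero) * rest (s zero)
          ≈⟨ *-congʳ (δ-same {i = s zero} (c zero) refl) ⟩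
        c zero * (H (Vec.tabulate s) * ∏ (c ∘ suc))
          ≈⟨ solve 3 (λ a b c → a :* (b :* c) := b :* (a :* c)) ≈-refl _ _ _ ⟩
        H (Vec.tabulate s) * ∏ c ∎
        where
        open import Relation.Binary.Reasoning.Setoid setoid
        T rest : Fin N → Carrier
        T j = ∑ (words (allFin N) n) λ σ → H (j Vec.∷ σ) * (δ (s zero) j (c zero) * ∏ λ i → δ (s (suc i)) (lookup σ i) (c (suc i)))
        rest j = H (j Vec.∷ Vec.tabulate (s ∘ suc)) * ∏ (c ∘ suc)
        eval : ∀ j → T j ≈ δ (s zero) j (c zero) * rest j
        eval j = ≈-trans
          (Sums.listSum-cong (words (allFin N) n) λ σ → solve 3 (λ a b c → a :* (b :* c) := b :* (a :* c)) ≈-refl _ _ _)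
          (≈-trans (∑-scale _ (words (allFin N) n) _)
            (*-congˡ (words-single (s ∘ suc) (c ∘ suc) λ σ → H (j Vec.∷ σ))))

      contribution-single : (s : Fin n → Fin n) (c : Fin n → Carrier) →
        (∀ i j → row x i j ≈ δ (s i) j (c i)) → contribution x ≈ ∏ c * sgn s
      contribution-single s c rows = ≈-trans
        (Sums.listSum-cong (words (allFin n) n) λ σ → *-congˡ (Fin∏.∏-cong {n} λ i → rows i (lookup σ i)))
        (≈-trans (words-single s c (sgn ∘ lookup))
          (≈-trans (*-comm _ _) (*-congˡ (sgn-cong (lookup∘tabulate s)))))

-- States as a subset with colours inside and outside it

elements-injective : ∀ {m} (F : Subset m) {a b} → elements F a ≡ elements F b → a ≡ b
elements-injective (inside  Vec.∷ F) {zero}  {zero}  p = refl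
elements-injective (inside  Vec.∷ F) {suc a} {suc b} p = cong suc (elements-injective F (FinP.suc-injective p))
elements-injective (outside Vec.∷ F) p = elements-injective F (FinP.suc-injective p)

elements-disjoint : ∀ {m} (F : Subset m) a b → elements F a ≢ elements (∁ F) b
elements-disjoint (inside  Vec.∷ F) (suc a) b       p = elements-disjoint F a b (FinP.suc-injective p)
elements-disjoint (outside Vec.∷ F) a       (suc b) p = elements-disjoint F a b (FinP.suc-injective p)

elements-cover : ∀ {m} (F : Subset m) c → (∃ λ a → c ≡ elements F a) ⊎ (∃ λ b → c ≡ elements (∁ F) b)
elements-cover (inside  Vec.∷ F) zero = inj₁ (zero , refl)
elements-cover (outside Vec.∷ F) zero = inj₂ (zero , refl)
elements-cover (inside  Vec.∷ F) (suc c) with elements-cover F c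
... | inj₁ (a , p) = inj₁ (suc a , cong suc p)
... | inj₂ (b , p) = inj₂ (b , cong suc p)
elements-cover (outside Vec.∷ F) (suc c) with elements-cover F c
... | inj₁ (a , p) = inj₁ (a , cong suc p)
... | inj₂ (b , p) = inj₂ (suc b , cong suc p)

-- The colour of an edge in F selects one of its two arcs; the colour of an edge
-- outside F selects none or both.

arcState edgeState : Fin 2 → State
arcState zero       = true , false
arcState (suc zero) = false , true
edgeState zero       = false , false
edgeState (suc zero) = true , true

isSecond : Fin 2 → Bool
isSecond zero       = false
isSecond (suc zero) = true

isSecond-injective : ∀ p q → isSecond p ≡ isSecond q → p ≡ q
isSecond-injective zero       zero       _ = refl
isSecond-injective (suc zero) (suc zero) _ = refl
isSecond-injective zero       (suc zero) ()
isSecond-injective (suc zero) zero       ()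

combine : ∀ {m} (F : Subset m) → Vec (Fin 2) ∣ F ∣ → Vec (Fin 2) ∣ ∁ F ∣ → Vec State m
combine Vec.[]              φ           ψ           = Vec.[]
combine (inside  Vec.∷ F) (p Vec.∷ φ) ψ           = arcState p Vec.∷ combine F φ ψ
combine (outside Vec.∷ F) φ           (q Vec.∷ ψ) = edgeState q Vec.∷ combine F φ ψ

lookup-combine : ∀ {m} (F : Subset m) φ ψ a → lookup (combine F φ ψ) (elements F a) ≡ arcState (lookup φ a)
lookup-combine (inside  Vec.∷ F) (p Vec.∷ φ) ψ           zero    = refl
lookup-combine (inside  Vec.∷ F) (p Vec.∷ φ) ψ           (suc a) = lookup-combine F φ ψ a
lookup-combine (outside Vec.∷ F) φ           (q Vec.∷ ψ) a       = lookup-combine F φ ψ a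

lookup-combine-∁ : ∀ {m} (F : Subset m) φ ψ b → lookup (combine F φ ψ) (elements (∁ F) b) ≡ edgeState (lookup ψ b)
lookup-combine-∁ (inside  Vec.∷ F) (p Vec.∷ φ) ψ           b       = lookup-combine-∁ F φ ψ b
lookup-combine-∁ (outside Vec.∷ F) φ           (q Vec.∷ ψ) zero    = refl
lookup-combine-∁ (outside Vec.∷ F) φ           (q Vec.∷ ψ) (suc b) = lookup-combine-∁ F φ ψ b

-- The Boolean is the direction of an edge under ω. A colour meaning "as in ω" or "against ω"
-- becomes one meaning "from `src`" or "from `tgt`".
turnBy : Bool → Fin 2 → Fin 2
turnBy true  p          = p
turnBy false zero       = suc zero
turnBy false (suc zero) = zero

twist : ∀ {k} → (Fin k → Bool) → Vec (Fin 2) k → Vec (Fin 2) k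
twist w Vec.[]      = Vec.[]
twist w (p Vec.∷ φ) = turnBy (w zero) p Vec.∷ twist (w ∘ suc) φ

lookup-twist : ∀ {k} w (φ : Vec (Fin 2) k) a → lookup (twist w φ) a ≡ turnBy (w a) (lookup φ a)
lookup-twist w (p Vec.∷ φ) zero    = refl
lookup-twist w (p Vec.∷ φ) (suc a) = lookup-twist (w ∘ suc) φ a

swaps : ∀ {k n} → (Fin k → Bool) → (u v : Fin k → Fin n) → Fin n → Fin n
swaps {zero}  flag u v i = i
swaps {suc k} flag u v i = swaps (flag ∘ suc) (u ∘ suc) (v ∘ suc)
  (if flag zero then transpose (u zero) (v zero) ⟨$⟩ʳ i else i)

extremity : ∀ {k n} → (u v : Fin k → Fin n) → Arc k → Fin n
extremity u v (b , d) = if d then u b else v b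

shift : ∀ {k} → Arc k → Arc (suc k)
shift (b , d) = suc b , d

shift-injective : ∀ {k} {α β : Arc k} → shift α ≡ shift β → α ≡ β
shift-injective refl = refl

shift-≢-zero : ∀ {k} {α : Arc k} {c : Bool} → shift α ≢ (zero , c)
shift-≢-zero ()

-- The flagged pairs form a matching. Comparing the two ends of one pair shows in particular that no
-- flagged pair is a loop.
Disjoint : ∀ {k n} → (Fin k → Bool) → (u v : Fin k → Fin n) → Set
Disjoint flag u v = ∀ α β → flag (proj₁ α) ≡ true → flag (proj₁ β) ≡ true →
                    extremity u v α ≡ extremity u v β → α ≡ β

disjoint-suc : ∀ {k n} {flag : Fin (suc k) → Bool} {u v : Fin (suc k) → Fin n} →
               Disjoint flag u v → Disjoint (flag ∘ suc) (u ∘ suc) (v ∘ suc)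
disjoint-suc disjoint (a , d) (b , c) f g p = shift-injective (disjoint (suc a , d) (suc b , c) f g p)

swaps-fixed : ∀ {k n} (flag : Fin k → Bool) (u v : Fin k → Fin n) {i} →
              (∀ α → flag (proj₁ α) ≡ true → extremity u v α ≢ i) → swaps flag u v i ≡ i
swaps-fixed {zero}  flag u v off = refl
swaps-fixed {suc k} flag u v {i} off =
  trans (cong (swaps (flag ∘ suc) (u ∘ suc) (v ∘ suc)) (first (flag zero) refl))
    (swaps-fixed (flag ∘ suc) (u ∘ suc) (v ∘ suc) λ (b , d) → off (suc b , d))
  where
  first : ∀ c → flag zero ≡ c → (if c then transpose (u zero) (v zero) ⟨$⟩ʳ i else i) ≡ i
  first true  f = transpose-other (u zero) (v zero) (off (zero , true) f ∘ sym) (off (zero , false) f ∘ sym)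
  first false f = refl

-- By disjointness the transpositions before and after that of the pair itself leave the point
-- alone.
swaps-matched : ∀ {k n} (flag : Fin k → Bool) (u v : Fin k → Fin n) → Disjoint flag u v →
                ∀ α → flag (proj₁ α) ≡ true → swaps flag u v (extremity u v α) ≡ extremity v u α
swaps-matched {suc k} flag u v disjoint (zero , d) f rewrite f =
  trans (cong (swaps (flag ∘ suc) (u ∘ suc) (v ∘ suc)) (first d))
    (swaps-fixed (flag ∘ suc) (u ∘ suc) (v ∘ suc) λ (b , c) g p →
      shift-≢-zero (disjoint (suc b , c) (zero , not d) g f (trans p (other d))))
  where
  first : ∀ d → transpose (u zero) (v zero) ⟨$⟩ʳ extremity u v (zero , d) ≡ extremity v u (zero , d)
  first true  = transpose-left (u zero) (v zero)
  first false = transpose-right (u zero) (v zero)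
  other : ∀ d → extremity v u (zero , d) ≡ extremity u v (zero , not d)
  other true  = refl
  other false = refl
swaps-matched {suc k} {n} flag u v disjoint (suc b , d) f =
  trans (cong (swaps (flag ∘ suc) (u ∘ suc) (v ∘ suc)) (first (flag zero) refl))
    (swaps-matched (flag ∘ suc) (u ∘ suc) (v ∘ suc) (disjoint-suc {flag = flag} {u} {v} disjoint) (b , d) f)
  where
  i : Fin n
  i = extremity u v (suc b , d)
  first : ∀ c → flag zero ≡ c → (if c then transpose (u zero) (v zero) ⟨$⟩ʳ i else i) ≡ i
  first true  g = transpose-other (u zero) (v zero)
    (λ p → shift-≢-zero (disjoint (suc b , d) (zero , true) f g p))
    (λ p → shift-≢-zero (disjoint (suc b , d) (zero , false) f g p))
  first false g = refl

module Reindexing (K : CommutativeRing 0ℓ 0ℓ) where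
  open CommutativeRing K hiding (zero) renaming (refl to ≈-refl; sym to ≈-sym; trans to ≈-trans)
  open SemiringSolver commutativeSemiring using (solve; con; _:=_; _:+_)
  open LinearAlgebra K using (∑; ∏; words)
  open Signs K
  open Expansion K

  private
    subsets : ∀ m → List (Subset m)
    subsets m = words (outside ∷ inside ∷ []) m

    colors : ∀ k → List (Vec (Fin 2) k)
    colors k = words (allFin 2) k

  -- The four states of an edge are its two colours outside F and its two colours inside F, so
  -- summing over states includes the choice of F.
  ∑-combine : ∀ m (H : Vec State m → Carrier) →
    ∑ (words states m) H ≈ ∑ (subsets m) λ F → ∑ (colors ∣ F ∣) λ φ → ∑ (colors ∣ ∁ F ∣) λ ψ → H (combine F φ ψ)
  ∑-combine zero    H = ≈-sym (≈-trans (+-identityʳ _) (+-identityʳ _))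
  ∑-combine (suc m) H = begin
    ∑ (words states (suc m)) H
      ≈⟨ Sums.listSum-cartesian Vec._∷_ H states (words states m) ⟩
    ∑ states (λ st → ∑ (words states m) λ x → H (st Vec.∷ x))
      ≈⟨ Sums.listSum-cong states (λ st → ∑-combine m (λ x → H (st Vec.∷ x))) ⟩
    S (false , false) + (S (true , true) + (S (true , false) + (S (false , true) + 0#)))
      ≈⟨ solve 4 (λ a b c d → a :+ (b :+ (c :+ (d :+ con 0))) := (a :+ (b :+ con 0)) :+ ((c :+ (d :+ con 0)) :+ con 0))
           ≈-refl _ _ _ _ ⟩
    (S (edgeState zero) + (S (edgeState (suc zero)) + 0#)) +
    ((S (arcState zero) + (S (arcState (suc zero)) + 0#)) + 0#)
      ≈⟨ +-cong out (+-congʳ inn) ⟩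
    ∑ (outside ∷ inside ∷ []) (λ o → ∑ (subsets m) λ F → T (o Vec.∷ F))
      ≈⟨ Sums.listSum-cartesian Vec._∷_ T (outside ∷ inside ∷ []) (subsets m) ⟨
    ∑ (subsets (suc m)) T ∎
    where
    open import Relation.Binary.Reasoning.Setoid setoid
    T : Subset (suc m) → Carrier
    T F = ∑ (colors ∣ F ∣) λ φ → ∑ (colors ∣ ∁ F ∣) λ ψ → H (combine F φ ψ)
    A : State → ∀ F → Vec (Fin 2) ∣ F ∣ → Carrier
    A st F φ = ∑ (colors ∣ ∁ F ∣) λ ψ → H (st Vec.∷ combine F φ ψ)
    S : State → Carrier
    S st = ∑ (subsets m) λ F → ∑ (colors ∣ F ∣) (A st F)
    out : S (edgeState zero) + (S (edgeState (suc zero)) + 0#) ≈ ∑ (subsets m) λ F → T (outside Vec.∷ F)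
    out = ≈-trans (≈-sym (Sums.listSum-comm (subsets m) (allFin 2) λ F q → ∑ (colors ∣ F ∣) (A (edgeState q) F)))
      (Sums.listSum-cong (subsets m) λ F → ≈-trans
        (≈-sym (Sums.listSum-comm (colors ∣ F ∣) (allFin 2) λ φ q → A (edgeState q) F φ))
        (Sums.listSum-cong (colors ∣ F ∣) λ φ → ≈-sym (Sums.listSum-cartesian Vec._∷_
          (λ ψ → H (combine (outside Vec.∷ F) φ ψ)) (allFin 2) (colors ∣ ∁ F ∣))))
    inn : S (arcState zero) + (S (arcState (suc zero)) + 0#) ≈ ∑ (subsets m) λ F → T (inside Vec.∷ F)
    inn = ≈-trans (≈-sym (Sums.listSum-comm (subsets m) (allFin 2) λ F p → ∑ (colors ∣ F ∣) (A (arcState p) F)))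
      (Sums.listSum-cong (subsets m) λ F → ≈-sym (Sums.listSum-cartesian Vec._∷_
          (λ φ → ∑ (colors ∣ ∁ F ∣) λ ψ → H (combine (inside Vec.∷ F) φ ψ)) (allFin 2) (colors ∣ F ∣)))

  -- `twist w` only permutes the colour words; this permits reading φ relative to an arbitrary
  -- orientation.
  ∑-twist : ∀ k (w : Fin k → Bool) (H : Vec (Fin 2) k → Carrier) →
            ∑ (colors k) H ≈ ∑ (colors k) (H ∘ twist w)
  ∑-twist zero    w H = ≈-refl
  ∑-twist (suc k) w H = begin
    ∑ (colors (suc k)) H
      ≈⟨ Sums.listSum-cartesian Vec._∷_ H (allFin 2) (colors k) ⟩
    ∑ (allFin 2) (λ p → ∑ (colors k) λ φ → H (p Vec.∷ φ))
      ≈⟨ first (w zero) (λ p → ∑ (colors k) λ φ → H (p Vec.∷ φ)) ⟩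
    ∑ (allFin 2) (λ p → ∑ (colors k) λ φ → H (turnBy (w zero) p Vec.∷ φ))
      ≈⟨ Sums.listSum-cong (allFin 2) (λ p → ∑-twist k (w ∘ suc) λ φ → H (turnBy (w zero) p Vec.∷ φ)) ⟩
    ∑ (allFin 2) (λ p → ∑ (colors k) λ φ → H (twist w (p Vec.∷ φ)))
      ≈⟨ Sums.listSum-cartesian Vec._∷_ (H ∘ twist w) (allFin 2) (colors k) ⟨
    ∑ (colors (suc k)) (H ∘ twist w) ∎
    where
    open import Relation.Binary.Reasoning.Setoid setoid
    first : ∀ c (h : Fin 2 → Carrier) → ∑ (allFin 2) h ≈ ∑ (allFin 2) (h ∘ turnBy c)
    first true  h = ≈-refl
    first false h = solve 2 (λ a b → a :+ (b :+ con 0) := b :+ (a :+ con 0)) ≈-refl (h zero) (h (suc zero))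

  sgn-swaps : ∀ {k n} (flag : Fin k → Bool) (u v : Fin k → Fin n) →
              (∀ b → flag b ≡ true → u b ≢ v b) →
              sgn (swaps flag u v) ≈ ∏ λ b → if flag b then - 1# else 1#
  sgn-swaps {zero} {n} flag u v u≢v = sgn-increasing {n} {w = id} λ i j i<j → i<j
  sgn-swaps {suc k} flag u v u≢v = ≈-trans (first (flag zero) refl)
    (*-congˡ (sgn-swaps (flag ∘ suc) (u ∘ suc) (v ∘ suc) (u≢v ∘ suc)))
    where
    w : Fin _ → Fin _
    w = swaps (flag ∘ suc) (u ∘ suc) (v ∘ suc)
    first : ∀ c → flag zero ≡ c →
            sgn (λ i → w (if c then transpose (u zero) (v zero) ⟨$⟩ʳ i else i)) ≈ (if c then - 1# else 1#) * sgn w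
    first false _ = ≈-sym (*-identityˡ _)
    first true  f = sgn-swapped {v = w} (u≢v zero f) (record
      { atˡ = cong w (transpose-left (u zero) (v zero))
      ; atʳ = cong w (transpose-right (u zero) (v zero))
      ; other = λ i i≢u i≢v → cong w (transpose-other (u zero) (v zero) i≢u i≢v)
      })

-- Used arcs, and vanishing for subsets that are not Eulerian

opposite : ∀ {m} → Arc m → Arc m
opposite (e , d) = e , not d

tail-opposite : ∀ G α → tail G (opposite α) ≡ head G α
tail-opposite G (e , true)  = refl
tail-opposite G (e , false) = refl

head-opposite : ∀ G α → head G (opposite α) ≡ tail G α
head-opposite G (e , true)  = refl
head-opposite G (e , false) = refl

countFin : ∀ {m} {P : Fin m → Set} → (∀ a → Dec (P a)) → Count P
countFin = count FinP._≟_ FinP.any?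

countArc : ∀ {m} {P : Arc m → Set} → (∀ a → Dec (P a)) → Count P
countArc = count _≟ᵃ_ anyArc?

module UsedArcs (G : Graph) (F : Subset (#E G)) (φ : Vec (Fin 2) ∣ F ∣) (ψ : Vec (Fin 2) ∣ ∁ F ∣) where

  M : Graph
  M = G ↾ ∁ F

  x : Vec State (#E G)
  x = combine F φ ψ

  -- The edges coloured e₂, used in both directions, which are to form the matching.
  flag : Fin ∣ ∁ F ∣ → Bool
  flag b = isSecond (lookup ψ b)

  arcOf : Fin ∣ F ∣ → Arc (#E G)
  arcOf a = elements F a , not (isSecond (lookup φ a))

  edgeArc : Arc ∣ ∁ F ∣ → Arc (#E G)
  edgeArc (b , d) = elements (∁ F) b , d

  private
    read : Bool → State → Bool
    read d = if d then proj₁ else proj₂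

    arcState-used : ∀ p → read (not (isSecond p)) (arcState p) ≡ true
    arcState-used zero       = refl
    arcState-used (suc zero) = refl

    arcState-only : ∀ p d → read d (arcState p) ≡ true → d ≡ not (isSecond p)
    arcState-only zero       true  _ = refl
    arcState-only (suc zero) false _ = refl

    edgeState-used : ∀ q d → read d (edgeState q) ≡ isSecond q
    edgeState-used zero       true  = refl
    edgeState-used zero       false = refl
    edgeState-used (suc zero) true  = refl
    edgeState-used (suc zero) false = refl

  used-arcOf : ∀ a → Used x (arcOf a)
  used-arcOf a = trans (cong (read (not (isSecond (lookup φ a)))) (lookup-combine F φ ψ a))
    (arcState-used (lookup φ a))

  used-edgeArc : ∀ β → flag (proj₁ β) ≡ true → Used x (edgeArc β)
  used-edgeArc (b , d) f = trans (cong (read d) (lookup-combine-∁ F φ ψ b))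
    (trans (edgeState-used (lookup ψ b) d) f)

  used-arcs : ∀ α → Used x α → (∃ λ a → α ≡ arcOf a) ⊎ (∃ λ β → flag (proj₁ β) ≡ true × α ≡ edgeArc β)
  used-arcs (e , d) u with elements-cover F e
  ... | inj₁ (a , refl) = inj₁ (a , cong (elements F a ,_)
          (arcState-only (lookup φ a) d (trans (sym (cong (read d) (lookup-combine F φ ψ a))) u)))
  ... | inj₂ (b , refl) = inj₂ ((b , d)
          , trans (sym (edgeState-used (lookup ψ b) d)) (trans (sym (cong (read d) (lookup-combine-∁ F φ ψ b))) u)
          , refl)

  arcOf-injective : ∀ {a b} → a ≢ b → arcOf a ≢ arcOf b
  arcOf-injective a≢b p = a≢b (elements-injective F (cong proj₁ p))

  edgeArc-injective : ∀ {β γ} → β ≢ γ → edgeArc β ≢ edgeArc γ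
  edgeArc-injective {b , d} {c , d′} β≢γ p =
    β≢γ (cong₂ _,_ (elements-injective (∁ F) (cong proj₁ p)) (cong proj₂ p))

  arcOf≢edgeArc : ∀ {a β} → arcOf a ≢ edgeArc β
  arcOf≢edgeArc p = elements-disjoint F _ _ (cong proj₁ p)

  -- Arcs are counted, not edges: a flagged loop at v appears twice and is thereby excluded from a
  -- matching.
  MatchedAt : Fin (#V G) → Arc ∣ ∁ F ∣ → Set
  MatchedAt v β = flag (proj₁ β) ≡ true × tail M β ≡ v

  matchedAt? : ∀ v β → Dec (MatchedAt v β)
  matchedAt? v β = (flag (proj₁ β) BoolP.≟ true) ×-dec (tail M β FinP.≟ v)

module Degrees (K : CommutativeRing 0ℓ 0ℓ) (G : Graph) (t : CommutativeRing.Carrier K) where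
  open CommutativeRing K using (_≈_; 0#)
  open Evaluations.Contributions K G t using (same-tail; same-head; source; sink)
  open Expansion.Determinant K G t using (contribution)
  open Splitting using (ind; ind-refl; ind-≢; length-filter)
  module ℕSum = FiniteProducts ℕP.+-0-commutativeMonoid

  ind-none : ∀ {m} (f : Fin m → Fin (#V G)) v → (∀ a → f a ≢ v) → ℕSum.sum (λ a → ind (f a) v) ≡ 0
  ind-none f v absent = ℕSum.Fin∏.∏-trivial λ a → ind-≢ (absent a)

  ind-one : ∀ {m} (f : Fin m → Fin (#V G)) v a → f a ≡ v → (∀ b → f b ≡ v → b ≡ a) →
            ℕSum.sum (λ a → ind (f a) v) ≡ 1
  ind-one f v a refl unique = trans (ℕSum.Fin∏.∏-single {z = λ b → ind (f b) v} a λ b b≢a → ind-≢ (b≢a ∘ unique b)) (ind-refl v)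

  module _ (F : Subset (#E G)) (φ : Vec (Fin 2) ∣ F ∣) (ψ : Vec (Fin 2) ∣ ∁ F ∣) where
    open UsedArcs G F φ ψ

    -- Whichever direction an edge of F is used in, its two ends are one tail and one head.
    degree-arcs : ∀ v → degree (G ↾ F) v ≡
                  ℕSum.sum (λ a → ind (tail G (arcOf a)) v) ℕ.+ ℕSum.sum (λ a → ind (head G (arcOf a)) v)
    degree-arcs v = trans (length-++ (filter (λ e → src H e FinP.≟ v) (allFin (#E H))))
      (trans (cong₂ ℕ._+_ (length-filter (src H) id v) (length-filter (tgt H) id v))
      (trans (sym (ℕSum.∑-distrib-+ (λ a → ind (src H a) v) (λ a → ind (tgt H a) v)))
      (trans (ℕSum.Fin∏.∏-cong {∣ F ∣} λ a → ends (not (isSecond (lookup φ a))) (elements F a))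
             (ℕSum.∑-distrib-+ (λ a → ind (tail G (arcOf a)) v) (λ a → ind (head G (arcOf a)) v)))))
      where
      H = G ↾ F
      ends : ∀ d e → ind (src G e) v ℕ.+ ind (tgt G e) v ≡ ind (tail G (e , d)) v ℕ.+ ind (head G (e , d)) v
      ends true  e = refl
      ends false e = ℕP.+-comm (ind (src G e) v) _

    -- Unless two arcs collide, F has at most one arc into v and at most one out of v; odd degree
    -- leaves exactly one of these. A flagged edge at v then collides with it, and without one v is
    -- a source or a sink.
    odd-degree : ∀ v → ¬ 2 ∣ degree (G ↾ F) v → contribution x ≈ 0#
    odd-degree v odd with countFin (λ a → tail G (arcOf a) FinP.≟ v) | countFin (λ a → head G (arcOf a) FinP.≟ v)
    ... | many a b a≢b p q | _ = same-tail x (arcOf a) (arcOf b) (arcOf-injective a≢b) (used-arcOf a) (used-arcOf b) (trans p (sym q))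
    ... | _ | many a b a≢b p q = same-head x (arcOf a) (arcOf b) (arcOf-injective a≢b) (used-arcOf a) (used-arcOf b) (trans p (sym q))
    ... | none p | none q = contradiction (divides 0 (trans (degree-arcs v) (cong₂ ℕ._+_ (ind-none _ v p) (ind-none _ v q)))) odd
    ... | one a p uniq | one b q uniq′ = contradiction (divides 1 (trans (degree-arcs v)
            (cong₂ ℕ._+_ (ind-one _ v a p uniq) (ind-one _ v b q uniq′)))) odd
    ... | one a p uniq | none q with anyArc? (matchedAt? v)
    ...   | yes (β , f , r) = same-tail x (arcOf a) (edgeArc β) arcOf≢edgeArc (used-arcOf a) (used-edgeArc β f) (trans p (sym r))
    ...   | no ¬∃ = source x (arcOf a) (used-arcOf a) no-head
      where
      no-head : ∀ β → Used x β → head G β ≢ tail G (arcOf a)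
      no-head β u r with used-arcs β u
      ... | inj₁ (b , refl)     = q b (trans r p)
      ... | inj₂ (γ , f , refl) = ¬∃ (opposite γ , f , trans (tail-opposite M γ) (trans r p))
    odd-degree v odd | none p | one a q uniq with anyArc? (matchedAt? v)
    ...   | yes (β , f , r) = same-head x (arcOf a) (edgeArc (opposite β)) arcOf≢edgeArc (used-arcOf a)
              (used-edgeArc (opposite β) f) (trans q (sym (trans (head-opposite M β) r)))
    ...   | no ¬∃ = sink x (arcOf a) (used-arcOf a) no-tail
      where
      no-tail : ∀ β → Used x β → tail G β ≢ head G (arcOf a)
      no-tail β u r with used-arcs β u
      ... | inj₁ (b , refl)     = p b (trans r q)
      ... | inj₂ (γ , f , refl) = ¬∃ (γ , f , trans r q)

    non-eulerian : ¬ Eulerian G F → contribution x ≈ 0#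
    non-eulerian ¬eulerian with FinP.¬∀⟶∃¬ (#V G) _ (λ v → 2 ∣? degree (G ↾ F) v) ¬eulerian
    ... | v , odd = odd-degree v odd

-- Values of the model at a vertex

module LocalWeights (K : CommutativeRing 0ℓ 0ℓ) where
  open CommutativeRing K hiding (zero) renaming (refl to ≈-refl; sym to ≈-sym; trans to ≈-trans)
  open RingProperties ring using (-0#≈0#)
  open LinearAlgebra K using (e; f; g; Free; module TensorAlgebra)
  open Model K
  open Expansion K using (part; module DP)
  open CommutativeMonoid dualMonoid using () renaming (refl to ᴰ-refl; sym to ᴰ-sym; trans to ᴰ-trans; ∙-cong to *ᴰ-cong; reflexive to ᴰ-reflexive; ∙-congˡ to *ᴰ-congˡ)
  open SymEval using () renaming (eval to evalˢ)
  open ExtEval using () renaming (eval to evalᴱ)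
  private
    module T = TensorAlgebra (Free 2)

  eval-symmetric : ∀ {X : Set} (h : X → T.Tensor) xs →
    pair (evalˢ (T.product (List.map h xs))) ≈ᴰ DP.listSum xs (pair ∘ evalˢ ∘ h)
  eval-symmetric h []       = ᴰ-refl
  eval-symmetric h (y ∷ xs) = *ᴰ-congˡ (eval-symmetric h xs)

  -- The ends at v of edges outside F are the arcs leaving v, a loop giving two of them; each end
  -- coloured e₂ contributes ε and each end coloured e₁ contributes 1.
  symmetric-factor : ∀ (M : Graph) (ψ : Vec (Fin 2) (#E M)) v →
    pair (evalˢ (T.product (List.map (λ b → e (lookup ψ b)) (incident M v))))
    ≈ᴰ DP.arcSum λ α → part (isSecond (lookup ψ (proj₁ α))) (tail M α) 1# v
  symmetric-factor M ψ v = ᴰ-trans (eval-symmetric (λ b → e (lookup ψ b)) (incident M v))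
    (ᴰ-trans (DP.listSum-++ color (filter (λ b → src M b FinP.≟ v) (allFin (#E M))) _)
    (ᴰ-trans (*ᴰ-cong (side (src M)) (side (tgt M)))
      (ᴰ-sym (DP.∑-distrib-+ (λ b → part (isSecond (lookup ψ b)) (src M b) 1# v)
                             (λ b → part (isSecond (lookup ψ b)) (tgt M b) 1# v)))))
    where
    color : Fin (#E M) → 𝔻
    color b = pair (evalˢ (e (lookup ψ b)))
    at : ∀ p k → (if does (k FinP.≟ v) then pair (evalˢ (e p)) else 1ᴰ) ≡ part (isSecond p) k 1# v
    at (suc zero) k = refl
    at zero       k with does (k FinP.≟ v)
    ... | true  = refl
    ... | false = refl
    side : (end : Fin (#E M) → Fin (#V M)) →
           DP.listSum (filter (λ b → end b FinP.≟ v) (allFin (#E M))) color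
           ≈ᴰ DP.sum λ b → part (isSecond (lookup ψ b)) (end b) 1# v
    side end = ᴰ-trans (DP.listSum-filter (λ b → end b FinP.≟ v) color (allFin (#E M)))
      (ᴰ-trans (ᴰ-reflexive (DP.listSum-tabulate (λ b → if does (end b FinP.≟ v) then color b else 1ᴰ) id))
        (DP.Fin∏.∏-cong {#E M} λ b → ᴰ-reflexive (at (lookup ψ b) (end b))))

  scalars : (Fin 4 → Carrier) → 𝔻
  scalars y = y 0F , y 3F

  -- The span of 1 and f₁∧f₂ is another copy of the dual numbers. It is enough that the left factor
  -- has no part of degree one.
  scalars-∧ : ∀ z y → z 1F ≈ 0# → z 2F ≈ 0# → scalars (z ∧ y) ≈ᴰ scalars z *ᴰ scalars y
  scalars-∧ z y z₁ z₂ = ≈-refl , ≈-trans (+-congˡ (≈-trans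
    (+-cong (≈-trans (*-congʳ z₁) (zeroˡ _)) (≈-trans (*-congˡ (≈-trans (*-congʳ z₂) (zeroˡ _))) (zeroʳ _)))
    (+-identityˡ 0#))) (+-identityʳ _)

  agreement : Fin 2 → Fin 2 → Carrier
  agreement p q = if does (p FinP.≟ q) then - 1# else 0#

  record Bivector (z : Fin 4 → Carrier) (c : Carrier) : Set where
    field
      at₀ : z 0F ≈ 0#
      at₁ : z 1F ≈ 0#
      at₂ : z 2F ≈ 0#
      at₃ : z 3F ≈ c

  -- With g₁ = -f₂ and g₂ = f₁, both f₁∧g₁ and f₂∧g₂ equal -f₁∧f₂, while f₁∧g₂ and f₂∧g₁ contain a
  -- square.
  f∧g : ∀ p q → Bivector (evalᴱ (f 1 p T.⊙ g 1 q)) (agreement p q)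
  f∧g p q = record
    { at₀ = zeroˡ _
    ; at₁ = ≈-trans (+-cong (zeroˡ _) (≈-trans (*-congˡ (g₀ q)) (zeroʳ _))) (+-identityˡ 0#)
    ; at₂ = ≈-trans (+-cong (zeroˡ _) (≈-trans (*-congˡ (g₀ q)) (zeroʳ _))) (+-identityˡ 0#)
    ; at₃ = ≈-trans (+-congʳ (≈-trans (+-cong (zeroˡ _) (zeroˡ _)) (+-identityˡ 0#)))
              (≈-trans (+-identityˡ _) (coefficient p q))
    }
    where
    g₀ : ∀ q → evalᴱ (g 1 q) 0F ≈ 0#
    g₀ zero       = -0#≈0#
    g₀ (suc zero) = ≈-refl
    coefficient : ∀ p q → evalᴱ (f 1 p) 1F * evalᴱ (g 1 q) 2F + - 1# * (evalᴱ (f 1 p) 2F * evalᴱ (g 1 q) 1F)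
                          ≈ agreement p q
    coefficient zero q = ≈-trans (+-cong (*-identityˡ _) (≈-trans (*-congˡ (zeroˡ _)) (zeroʳ _)))
      (≈-trans (+-identityʳ _) (second q))
      where
      second : ∀ q → evalᴱ (g 1 q) 2F ≈ agreement zero q
      second zero       = ≈-refl
      second (suc zero) = ≈-refl
    coefficient (suc zero) q = ≈-trans (+-cong (zeroˡ _) (*-congˡ (*-identityˡ _)))
      (≈-trans (+-identityˡ _) (first q))
      where
      first : ∀ q → - 1# * evalᴱ (g 1 q) 1F ≈ agreement (suc zero) q
      first zero       = ≈-trans (*-congˡ -0#≈0#) (zeroʳ _)
      first (suc zero) = *-identityʳ _

  eval-exterior : ∀ {X : Set} (h : X → T.Tensor) (c : X → Carrier) → (∀ y → Bivector (evalᴱ (h y)) (c y)) → ∀ xs →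
    scalars (evalᴱ (T.product (List.map h xs))) ≈ᴰ DP.listSum xs λ y → 0# , c y
  eval-exterior h c bivector []       = ᴰ-refl
  eval-exterior h c bivector (y ∷ xs) = ᴰ-trans (scalars-∧ (evalᴱ (h y)) (evalᴱ (T.product (List.map h xs))) at₁ at₂)
    (*ᴰ-cong (at₀ , at₃) (eval-exterior h c bivector xs))
    where open Bivector (bivector y)

  -- Each arc of F into the vertex gives a multiple of f₁∧f₂, which is 0 if the colour changes
  -- there; two such arcs give a square and hence 0.
  exterior-factor : ∀ {m n} (φ κφ : Fin m → Fin 2) (end : Fin m → Fin n) v →
    scalars (evalᴱ (T.product (List.map (λ a → f 1 (φ a) T.⊙ g 1 (κφ a)) (filter (λ a → end a FinP.≟ v) (allFin m)))))
    ≈ᴰ DP.sum λ a → part true (end a) (agreement (φ a) (κφ a)) v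
  exterior-factor {m} φ κφ end v = ᴰ-trans
    (eval-exterior (λ a → f 1 (φ a) T.⊙ g 1 (κφ a)) (λ a → agreement (φ a) (κφ a)) (λ a → f∧g (φ a) (κφ a))
      (filter (λ a → end a FinP.≟ v) (allFin m)))
    (ᴰ-trans (DP.listSum-filter (λ a → end a FinP.≟ v) _ (allFin m))
      (ᴰ-reflexive (DP.listSum-tabulate (λ a → part true (end a) (agreement (φ a) (κφ a)) v) id)))

-- The colours 0 and 1 of an edge of F keep and turn its orientation under ω.

module OrientedArcs (G : Graph) (F : Subset (#E G)) (ω : EulerianOrientation (G ↾ F))
                    (φ : Vec (Fin 2) ∣ F ∣) (ψ : Vec (Fin 2) ∣ ∁ F ∣) where
  module ω = EulerianOrientation ω
  open UsedArcs G F (twist ω.forward φ) ψ public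

  rev : Fin ∣ F ∣ → Bool
  rev a = isSecond (lookup φ a)

  private
    kept : ∀ p c → isSecond p ≡ false → not (isSecond (turnBy c p)) ≡ c
    kept zero true  _ = refl
    kept zero false _ = refl
    kept (suc zero) _ ()

    turned : ∀ p c → isSecond p ≡ true → not (isSecond (turnBy c p)) ≡ not c
    turned (suc zero) true  _ = refl
    turned (suc zero) false _ = refl

    arc-kept : ∀ a → rev a ≡ false → arcOf a ≡ (elements F a , ω.forward a)
    arc-kept a r = cong (elements F a ,_) (trans (cong (not ∘ isSecond) (lookup-twist ω.forward φ a))
      (kept (lookup φ a) (ω.forward a) r))

    arc-turned : ∀ a → rev a ≡ true → arcOf a ≡ opposite (elements F a , ω.forward a)
    arc-turned a r = cong (elements F a ,_) (trans (cong (not ∘ isSecond) (lookup-twist ω.forward φ a))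
      (turned (lookup φ a) (ω.forward a) r))

  tail-kept : ∀ {a} → rev a ≡ false → tail G (arcOf a) ≡ ω.tail a
  tail-kept r = cong (tail G) (arc-kept _ r)

  head-kept : ∀ {a} → rev a ≡ false → head G (arcOf a) ≡ ω.head a
  head-kept r = cong (head G) (arc-kept _ r)

  tail-turned : ∀ {a} → rev a ≡ true → tail G (arcOf a) ≡ ω.head a
  tail-turned r = trans (cong (tail G) (arc-turned _ r)) (tail-opposite G _)

  head-turned : ∀ {a} → rev a ≡ true → head G (arcOf a) ≡ ω.tail a
  head-turned r = trans (cong (head G) (arc-turned _ r)) (head-opposite G _)

-- Comparison of the two sides for one coloring

module Colored (K : CommutativeRing 0ℓ 0ℓ) (t i : CommutativeRing.Carrier K)
               (i*i≈-1 : CommutativeRing._≈_ K (CommutativeRing._*_ K i i)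
                          (CommutativeRing.-_ K (CommutativeRing.1# K)))
               (G : Graph) (F : Subset (#E G)) (ω : EulerianOrientation (G ↾ F)) (pairing : CompatiblePairing ω)
               (φ : Vec (Fin 2) ∣ F ∣) (ψ : Vec (Fin 2) ∣ ∁ F ∣) where
  open CommutativeRing K hiding (zero) renaming (refl to ≈-refl; sym to ≈-sym; trans to ≈-trans)
  open SemiringSolver commutativeSemiring using (solve; con; _:=_; _:+_; _:*_)
  open Exp semiring using (_^_)
  open LinearAlgebra K using (∏)
  open Model K
  open Signs K
  open Products using (module Fin∏; module Arc∏; arcSum; ∑-comm; ∑-distrib-+)
  open PermutationSigns K
  open Expansion K using (part; module DP)
  open Expansion.Determinant K G t using (δ; row; contribution)
  open Evaluations K using (part-on; part-off; ε-square; module Contributions)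
  open Contributions G t
  open Reindexing K using (sgn-swaps)
  open LocalWeights K using (agreement)
  open Form t i using (weight; weight-cong)
  open OrientedArcs G F ω φ ψ
  open CompatiblePairing pairing using (κ; compatible)
  open CommutativeMonoid dualMonoid using () renaming (refl to ᴰ-refl; trans to ᴰ-trans; reflexive to ᴰ-reflexive)

  private
    V = Fin (#V G)

  edgeFactor : V → Arc ∣ ∁ F ∣ → 𝔻
  edgeFactor v β = part (flag (proj₁ β)) (tail M β) 1# v

  agree : Fin ∣ F ∣ → Carrier
  agree a = agreement (lookup φ a) (lookup φ (κ ⟨$⟩ʳ a))

  arcFactor : V → Fin ∣ F ∣ → 𝔻
  arcFactor v a = part true (ω.head a) (agree a) v

  local : V → Carrier
  local v = weight (DP.arcSum (edgeFactor v)) (proj₁ (DP.sum (arcFactor v))) (proj₂ (DP.sum (arcFactor v)))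

  agreement-same : ∀ {p q} → p ≡ q → agreement p q ≈ - 1#
  agreement-same {p} refl rewrite dec-true (p FinP.≟ p) refl = ≈-refl

  agreement-different : ∀ {p q} → p ≢ q → agreement p q ≈ 0#
  agreement-different {p} {q} p≢q rewrite dec-false (p FinP.≟ q) p≢q = ≈-refl

  -- The configurations that survive at a vertex: a fixed point of the permutation, an end of a
  -- matching edge, and a vertex passed once by F without change of colour.
  data Class (v : V) : Set where
    idle    : (∀ a → ω.head a ≢ v) → (∀ β → ¬ MatchedAt v β) → Class v
    matched : (∀ a → ω.head a ≢ v) → ∀ β → MatchedAt v β → (∀ γ → MatchedAt v γ → γ ≡ β) → Class v
    passing : ∀ a → ω.head a ≡ v → (∀ b → ω.head b ≡ v → b ≡ a) →
              lookup φ a ≡ lookup φ (κ ⟨$⟩ʳ a) → (∀ β → ¬ MatchedAt v β) → Class v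

  private
    edges-none : ∀ {v} → (∀ β → ¬ MatchedAt v β) → DP.arcSum (edgeFactor v) ≈ᴰ 1ᴰ
    edges-none {v} none-at = DP.Arc∏.∏-trivial {z = edgeFactor v} λ β →
      ᴰ-reflexive (part-off 1# λ f p → none-at β (f , p))

    edges-one : ∀ {v} β → MatchedAt v β → (∀ γ → MatchedAt v γ → γ ≡ β) → DP.arcSum (edgeFactor v) ≈ᴰ (0# , 1#)
    edges-one {v} β (f , p) unique = ᴰ-trans
      (DP.Arc∏.∏-single {z = edgeFactor v} β λ γ γ≢β → ᴰ-reflexive (part-off 1# λ g q → γ≢β (unique γ (g , q))))
      (ᴰ-reflexive (part-on 1# f p))

    edges-many : ∀ {v} β γ → β ≢ γ → MatchedAt v β → MatchedAt v γ → DP.arcSum (edgeFactor v) ≈ᴰ (0# , 0#)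
    edges-many {v} β γ β≢γ (f , p) (g , q) =
      ε-square (proj₂ (DP.Arc∏.∏-factor₂ (edgeFactor v) β≢γ)) (part-on 1# f p) (part-on 1# g q)

    edges-some : ∀ {v} β → MatchedAt v β → proj₁ (DP.arcSum (edgeFactor v)) ≈ 0#
    edges-some {v} β (f , p) = ≈-trans (proj₁ (DP.Arc∏.∏-factor (edgeFactor v) β))
      (≈-trans (*-congʳ (reflexive (cong proj₁ (part-on 1# f p)))) (zeroˡ _))

    arcs-none : ∀ {v} → (∀ a → ω.head a ≢ v) → DP.sum (arcFactor v) ≈ᴰ 1ᴰ
    arcs-none {v} none-at = DP.Fin∏.∏-trivial {z = arcFactor v} λ a → ᴰ-reflexive (part-off {u = true} (agree a) λ _ → none-at a)

    arcs-one : ∀ {v} a {c} → ω.head a ≡ v → (∀ b → ω.head b ≡ v → b ≡ a) →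
               agree a ≈ c → DP.sum (arcFactor v) ≈ᴰ (0# , c)
    arcs-one {v} a p unique c = ᴰ-trans
      (DP.Fin∏.∏-single {z = arcFactor v} a λ b b≢a → ᴰ-reflexive (part-off {u = true} (agree b) λ _ q → b≢a (unique b q)))
      (ᴰ-trans (ᴰ-reflexive (part-on (agree a) refl p)) (≈-refl , c))

    arcs-many : ∀ {v} a b → a ≢ b → ω.head a ≡ v → ω.head b ≡ v → DP.sum (arcFactor v) ≈ᴰ (0# , 0#)
    arcs-many {v} a b a≢b p q =
      ε-square (proj₂ (DP.Fin∏.∏-factor₂ (arcFactor v) a≢b)) (part-on (agree a) refl p) (part-on (agree b) refl q)

    weight-zeroˡ : ∀ {x c d} → x ≈ᴰ (0# , 0#) → weight x c d ≈ 0#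
    weight-zeroˡ {c = c} {d} p = ≈-trans (weight-cong p ≈-refl ≈-refl)
      (solve 5 (λ n t i c d → (t :* con 0 :+ i :* con 0) :* c :+ n :* (con 0 :* d) := con 0) ≈-refl (- 1#) t i c d)

    weight-zeroʳ : ∀ {x y} → y ≈ᴰ (0# , 0#) → weight x (proj₁ y) (proj₂ y) ≈ 0#
    weight-zeroʳ {x} (p , q) = ≈-trans (weight-cong {x} ᴰ-refl p q)
      (solve 5 (λ n t i p q → (t :* p :+ i :* q) :* con 0 :+ n :* (p :* con 0) := con 0)
        ≈-refl (- 1#) t i (proj₁ x) (proj₂ x))

    weight-ε : ∀ {x y} → proj₁ x ≈ 0# → proj₁ y ≈ 0# → weight x (proj₁ y) (proj₂ y) ≈ 0#
    weight-ε {x} {y} p q = ≈-trans (weight-cong {y = 0# , proj₂ x} (p , ≈-refl) q ≈-refl)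
      (solve 5 (λ n t i x y → (t :* con 0 :+ i :* x) :* con 0 :+ n :* (con 0 :* y) := con 0)
        ≈-refl (- 1#) t i (proj₂ x) (proj₂ y))

    by-rev : ∀ {A : Set} a → (rev a ≡ false → A) → (rev a ≡ true → A) → A
    by-rev a kept turned with rev a in r
    ... | false = kept refl
    ... | true  = turned refl

    rev-distinct : ∀ {a b} → rev a ≡ false → rev b ≡ true → a ≢ b
    rev-distinct r s refl with trans (sym r) s
    ... | ()

    heads-meet : ∀ {v a b} → a ≢ b → head G (arcOf a) ≡ v → head G (arcOf b) ≡ v → contribution x ≈ 0#
    heads-meet {v} {a} {b} a≢b p q = same-head x (arcOf a) (arcOf b) (arcOf-injective a≢b)
      (used-arcOf a) (used-arcOf b) (trans p (sym q))

    tails-meet : ∀ {v a b} → a ≢ b → tail G (arcOf a) ≡ v → tail G (arcOf b) ≡ v → contribution x ≈ 0#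
    tails-meet {v} {a} {b} a≢b p q = same-tail x (arcOf a) (arcOf b) (arcOf-injective a≢b)
      (used-arcOf a) (used-arcOf b) (trans p (sym q))

    -- If exactly one of a and its successor is turned, the two arcs both enter v or both leave it.
    mixed-conflict : ∀ {v} a → ω.head a ≡ v → lookup φ a ≢ lookup φ (κ ⟨$⟩ʳ a) → contribution x ≈ 0#
    mixed-conflict a p φ≢ = by-rev a
      (λ r → by-rev (κ ⟨$⟩ʳ a)
        (λ r′ → contradiction (isSecond-injective _ _ (trans r (sym r′))) φ≢)
        (λ r′ → heads-meet (rev-distinct r r′) (trans (head-kept r) p)
                  (trans (head-turned r′) (trans (compatible a) p))))
      (λ r → by-rev (κ ⟨$⟩ʳ a)
        (λ r′ → tails-meet (rev-distinct r′ r) (trans (tail-kept r′) (trans (compatible a) p))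
                  (trans (tail-turned r) p))
        (λ r′ → contradiction (isSecond-injective _ _ (trans r (sym r′))) φ≢))

    -- With equal colours one of a and its successor leaves v, and so does one direction of the
    -- matching edge.
    edge-conflict : ∀ {v} a → ω.head a ≡ v → lookup φ a ≡ lookup φ (κ ⟨$⟩ʳ a) → ∀ β → MatchedAt v β → contribution x ≈ 0#
    edge-conflict {v} a p φ≡ β (f , q) = by-rev a
      (λ r → at (κ ⟨$⟩ʳ a) (trans (tail-kept (trans (cong isSecond (sym φ≡)) r)) (trans (compatible a) p)))
      (λ r → at a (trans (tail-turned r) p))
      where
      at : ∀ b → tail G (arcOf b) ≡ v → contribution x ≈ 0#
      at b s = same-tail x (arcOf b) (edgeArc β) arcOf≢edgeArc (used-arcOf b) (used-edgeArc β f) (trans s (sym q))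

    -- The successor of a decides: kept, it leaves v together with the turned b; turned, it enters v
    -- together with a.
    turned-conflict : ∀ {v} a b → ω.head a ≡ v → ω.head b ≡ v → rev a ≡ false → rev b ≡ true → contribution x ≈ 0#
    turned-conflict a b p q r s = by-rev (κ ⟨$⟩ʳ a)
      (λ r′ → tails-meet (rev-distinct r′ s) (trans (tail-kept r′) (trans (compatible a) p)) (trans (tail-turned s) q))
      (λ r′ → heads-meet (rev-distinct r r′) (trans (head-kept r) p) (trans (head-turned r′) (trans (compatible a) p)))

    arcs-conflict : ∀ {v} a b → a ≢ b → ω.head a ≡ v → ω.head b ≡ v → contribution x ≈ 0#
    arcs-conflict a b a≢b p q = by-rev a
      (λ r → by-rev b
        (λ s → heads-meet a≢b (trans (head-kept r) p) (trans (head-kept s) q))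
        (λ s → turned-conflict a b p q r s))
      (λ r → by-rev b
        (λ s → turned-conflict b a q p s r)
        (λ s → tails-meet a≢b (trans (tail-turned r) p) (trans (tail-turned s) q)))

  -- What h forbids at a vertex, by a product with two factors ε, by clashing colours or by mixing F
  -- with the matching, appears in the determinant as two used arcs with a common tail or head. The
  -- two sides thus vanish together.
  classify : ∀ v → Class v ⊎ (local v ≈ 0# × contribution x ≈ 0#)
  classify v with countFin (λ a → ω.head a FinP.≟ v) | countArc (matchedAt? v)
  ... | none p         | none q               = inj₁ (idle p q)
  ... | none p         | one β m unique       = inj₁ (matched p β m unique)
  ... | none p         | many β γ β≢γ m m′    = inj₂
        ( weight-zeroˡ (edges-many β γ β≢γ m m′)
        , same-tail x (edgeArc β) (edgeArc γ) (edgeArc-injective β≢γ) (used-edgeArc β (proj₁ m))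
            (used-edgeArc γ (proj₁ m′)) (trans (proj₂ m) (sym (proj₂ m′))))
  ... | many a b a≢b p q | _                  = inj₂ (weight-zeroʳ (arcs-many a b a≢b p q) , arcs-conflict a b a≢b p q)
  ... | one a p unique | edges with lookup φ a FinP.≟ lookup φ (κ ⟨$⟩ʳ a)
  ...   | no φ≢  = inj₂ (weight-zeroʳ (arcs-one a p unique (agreement-different φ≢)) , mixed-conflict a p φ≢)
  ...   | yes φ≡ with edges
  ...     | none q         = inj₁ (passing a p unique φ≡ q)
  ...     | one β m _      = inj₂ (weight-ε (edges-some β m) (proj₁ (arcs-one a p unique ≈-refl)) , edge-conflict a p φ≡ β m)
  ...     | many β _ _ m _ = inj₂ (weight-ε (edges-some β m) (proj₁ (arcs-one a p unique ≈-refl)) , edge-conflict a p φ≡ β m)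

  module Classified (class : ∀ v → Class v) where

    -- Every arc enters some vertex, which must then be passing; hence the colour is constant on
    -- circuits, as `Reversal` requires.
    φ-invariant : ∀ a → lookup φ (κ ⟨$⟩ʳ a) ≡ lookup φ a
    φ-invariant a with class (ω.head a)
    ... | idle p _          = contradiction refl (p a)
    ... | matched p _ _ _   = contradiction refl (p a)
    ... | passing b _ unique φ≡ _ with unique a refl
    ...   | refl = sym φ≡

    head-injective : ∀ {a b} → ω.head a ≡ ω.head b → a ≡ b
    head-injective {a} {b} p with class (ω.head b)
    ... | idle q _               = contradiction refl (q b)
    ... | matched q _ _ _        = contradiction refl (q b)
    ... | passing _ _ unique _ _ = trans (unique a p) (sym (unique b refl))

    head-κ : ∀ a → ω.head (κ ⟨$⟩ˡ a) ≡ ω.tail a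
    head-κ a = trans (sym (compatible (κ ⟨$⟩ˡ a))) (cong ω.tail (inverseʳ κ))

    tail-injective : ∀ {a b} → ω.tail a ≡ ω.tail b → a ≡ b
    tail-injective {a} {b} p = trans (sym (inverseʳ κ)) (trans
      (cong (κ ⟨$⟩ʳ_) (head-injective (trans (head-κ a) (trans p (sym (head-κ b)))))) (inverseʳ κ))

    edges-avoid : ∀ a β → ¬ MatchedAt (ω.head a) β
    edges-avoid a with class (ω.head a)
    ... | idle q _               = contradiction refl (q a)
    ... | matched q _ _ _        = contradiction refl (q a)
    ... | passing _ _ _ _ absent = absent

    open Reversal κ rev (λ a → cong isSecond (φ-invariant a)) using (reversal)

    -- The only column that row v allows. A vertex on F is named by the arc leaving it under ω, and
    -- its successor by the next arc of the circuit, possibly reversed; this makes the vertex map a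
    -- transport of `reversal` along `ω.tail`, as `sgn-permuted` expects.
    target : ∀ {v} → Class v → V
    target {v} (idle _ _)          = v
    target     (matched _ β _ _)   = head M β
    target     (passing a _ _ _ _) = ω.tail (reversal ⟨$⟩ʳ (κ ⟨$⟩ʳ a))

    -- θ is the factor by which the determinant entry differs from the value of h: on F the entry is
    -- -1 against 1, and on the matching -1 = i * i against i.
    coefficient θ : ∀ {v} → Class v → Carrier
    coefficient (idle _ _)          = t
    coefficient (matched _ _ _ _)   = - 1#
    coefficient (passing _ _ _ _ _) = - 1#
    θ (idle _ _)          = 1#
    θ (matched _ _ _ _)   = i
    θ (passing _ _ _ _ _) = - 1#

    coefficient-local : ∀ {v} (c : Class v) → coefficient c ≈ local v * θ c
    coefficient-local (idle p q) = ≈-sym (≈-trans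
      (*-congʳ (weight-cong (edges-none q) (proj₁ (arcs-none p)) (proj₂ (arcs-none p))))
      (solve 3 (λ n t i → ((t :* con 1 :+ i :* con 0) :* con 1 :+ n :* (con 1 :* con 0)) :* con 1 := t) ≈-refl (- 1#) t i))
    coefficient-local (matched p β m unique) = ≈-sym (≈-trans
      (*-congʳ (weight-cong (edges-one β m unique) (proj₁ (arcs-none p)) (proj₂ (arcs-none p))))
      (≈-trans (solve 3 (λ n t i → ((t :* con 0 :+ i :* con 1) :* con 1 :+ n :* (con 0 :* con 0)) :* i := i :* i)
        ≈-refl (- 1#) t i) i*i≈-1))
    coefficient-local (passing a p unique φ≡ q) = ≈-sym (≈-trans
      (*-congʳ (weight-cong (edges-none q) (proj₁ at) (proj₂ at)))
      (≈-trans (solve 3 (λ n t i → ((t :* con 1 :+ i :* con 0) :* con 0 :+ n :* (con 1 :* n)) :* n := n :* (n :* n))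
        ≈-refl (- 1#) t i) (≈-trans (*-congˡ -1*-1≈1) (*-identityʳ _))))
      where at = arcs-one a p unique (agreement-same φ≡)

    -- At a passing vertex the used arc that leaves is the successor of a if the circuit keeps its
    -- direction, and a itself if it is turned.
    row-single-class : ∀ {v} (c : Class v) j → row x v j ≈ δ (target c) j (coefficient c)
    row-single-class {v} (idle p q) = row-idle x unused
      where
      unused : ∀ α → Used x α → tail G α ≢ v
      unused α u r with used-arcs α u
      ... | inj₂ (β , f , refl) = q β (f , r)
      ... | inj₁ (a , refl) = by-rev a
              (λ k → p (κ ⟨$⟩ˡ a) (trans (head-κ a) (trans (sym (tail-kept k)) r)))
              (λ k → p a (trans (sym (tail-turned k)) r))
    row-single-class {v} (matched p β (f , m) unique) = row-single x (edgeArc β) (used-edgeArc β f) m only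
      where
      only : ∀ α → Used x α → tail G α ≡ v → α ≡ edgeArc β
      only α u r with used-arcs α u
      ... | inj₂ (γ , g , refl) = cong edgeArc (unique γ (g , r))
      ... | inj₁ (a , refl) = by-rev a
              (λ k → contradiction (trans (head-κ a) (trans (sym (tail-kept k)) r)) (p (κ ⟨$⟩ˡ a)))
              (λ k → contradiction (trans (sym (tail-turned k)) r) (p a))
    row-single-class {v} (passing a p unique φ≡ q) j = by-rev a kept turned
      where
      kept : rev a ≡ false → row x v j ≈ δ (ω.tail (reversal ⟨$⟩ʳ (κ ⟨$⟩ʳ a))) j (- 1#)
      kept r = ≈-trans (row-single x (arcOf b) (used-arcOf b) (trans (tail-kept r′) (trans (compatible a) p)) only j)
        (reflexive (cong (λ k → δ k j (- 1#)) (trans (head-kept r′) (trans (sym (compatible b)) (cong ω.tail (sym turn))))))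
        where
        b = κ ⟨$⟩ʳ a
        r′ : rev b ≡ false
        r′ = trans (cong isSecond (sym φ≡)) r
        turn : reversal ⟨$⟩ʳ b ≡ κ ⟨$⟩ʳ b
        turn rewrite r′ = refl
        only : ∀ α → Used x α → tail G α ≡ v → α ≡ arcOf b
        only α u s with used-arcs α u
        ... | inj₂ (β , f , refl) = contradiction (f , s) (q β)
        ... | inj₁ (c , refl) = by-rev c
                (λ k → cong arcOf (tail-injective (trans (sym (tail-kept k)) (trans s (sym (trans (compatible a) p))))))
                (λ k → contradiction (sym (unique c (trans (sym (tail-turned k)) s))) (rev-distinct r k))
      turned : rev a ≡ true → row x v j ≈ δ (ω.tail (reversal ⟨$⟩ʳ (κ ⟨$⟩ʳ a))) j (- 1#)
      turned r = ≈-trans (row-single x (arcOf a) (used-arcOf a) (trans (tail-turned r) p) only j)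
        (reflexive (cong (λ k → δ k j (- 1#)) (trans (head-turned r) (cong ω.tail (sym turn)))))
        where
        r′ : rev (κ ⟨$⟩ʳ a) ≡ true
        r′ = trans (cong isSecond (sym φ≡)) r
        turn : reversal ⟨$⟩ʳ (κ ⟨$⟩ʳ a) ≡ a
        turn rewrite r′ = inverseˡ κ
        only : ∀ α → Used x α → tail G α ≡ v → α ≡ arcOf a
        only α u s with used-arcs α u
        ... | inj₂ (β , f , refl) = contradiction (f , s) (q β)
        ... | inj₁ (c , refl) = by-rev c
                (λ k → contradiction (tail-injective (trans (sym (tail-kept k)) (trans s (sym (trans (compatible a) p)))))
                         (rev-distinct k r′))
                (λ k → cong arcOf (unique c (trans (sym (tail-turned k)) s)))

    disjoint : Disjoint flag (src M) (tgt M)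
    disjoint (a , d) (b , c) f g p with class (tail M (b , c))
    ... | idle _ absent          = contradiction (g , refl) (absent (b , c))
    ... | passing _ _ _ _ absent = contradiction (g , refl) (absent (b , c))
    ... | matched _ _ _ unique   = trans (unique (a , d) (f , p)) (sym (unique (b , c) (g , refl)))

    exchange : V → V
    exchange = swaps flag (src M) (tgt M)

    s : V → V
    s v = target (class v)

    -- The map s is compared with the involution `exchange` of the matching, which fixes every
    -- vertex on F: off F they agree, and on F they differ by `reversal`.
    sgn-s : sgn s ≈ ε κ * ∏ λ b → if flag b then - 1# else 1#
    sgn-s = ≈-trans (sgn-permuted reversal ω.tail tail-injective exchange s on off)
      (*-cong (ε-reversal κ rev (λ a → cong isSecond (φ-invariant a)))
              (sgn-swaps flag (src M) (tgt M) λ b f p → distinct (disjoint (b , true) (b , false) f f p)))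
      where
      distinct : ∀ {b : Fin ∣ ∁ F ∣} → (b , true) ≢ (b , false)
      distinct ()
      avoid : ∀ a α → flag (proj₁ α) ≡ true → tail M α ≢ ω.tail a
      avoid a α f p = edges-avoid (κ ⟨$⟩ˡ a) α (f , trans p (sym (head-κ a)))
      on : ∀ a → s (ω.tail a) ≡ exchange (ω.tail (reversal ⟨$⟩ʳ a))
      on a = trans (moved (class (ω.tail a))) (sym (swaps-fixed flag (src M) (tgt M) (avoid (reversal ⟨$⟩ʳ a))))
        where
        moved : (c : Class (ω.tail a)) → target c ≡ ω.tail (reversal ⟨$⟩ʳ a)
        moved (idle p _)        = contradiction (head-κ a) (p (κ ⟨$⟩ˡ a))
        moved (matched p _ _ _) = contradiction (head-κ a) (p (κ ⟨$⟩ˡ a))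
        moved (passing b p _ _ _) = cong (λ c → ω.tail (reversal ⟨$⟩ʳ c)) (tail-injective (trans (compatible b) p))
      off : ∀ v → (∀ a → ω.tail a ≢ v) → s v ≡ exchange v
      off v away = still (class v)
        where
        still : (c : Class v) → target c ≡ exchange v
        still (idle p q) = sym (swaps-fixed flag (src M) (tgt M) λ α f r → q α (f , r))
        still (matched p β (f , m) _) = trans (sym (swaps-matched flag (src M) (tgt M) disjoint β f)) (cong exchange m)
        still (passing a p _ _ _) = contradiction (trans (compatible a) p) (away (κ ⟨$⟩ʳ a))

    -- Each arc of F and each end of a matching edge is met at exactly one vertex.

    pick : Carrier → V → V → Carrier
    pick c k v = if does (k FinP.≟ v) then c else 1#

    pick-at : ∀ c {k v} → k ≡ v → pick c k v ≈ c
    pick-at c {k} refl rewrite dec-true (k FinP.≟ k) refl = ≈-refl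

    pick-off : ∀ c {k v} → k ≢ v → pick c k v ≈ 1#
    pick-off c {k} {v} k≢v rewrite dec-false (k FinP.≟ v) k≢v = ≈-refl

    ∏-pick : ∀ c k → ∏ (pick c k) ≈ c
    ∏-pick c k = ≈-trans (Fin∏.∏-single k λ v v≢k → pick-off c (v≢k ∘ sym)) (pick-at c {k} refl)

    edgePick : V → Arc ∣ ∁ F ∣ → Carrier
    edgePick v β = if flag (proj₁ β) then pick i (tail M β) v else 1#

    edgePick-at : ∀ {v} β → MatchedAt v β → edgePick v β ≈ i
    edgePick-at β (f , p) rewrite f = pick-at i p

    edgePick-off : ∀ {v} β → ¬ MatchedAt v β → edgePick v β ≈ 1#
    edgePick-off β absent with flag (proj₁ β)
    ... | true  = pick-off i λ p → absent (refl , p)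
    ... | false = ≈-refl

    θ-factors : ∀ {v} (c : Class v) → θ c ≈ ∏ (λ a → pick (- 1#) (ω.head a) v) * arcSum (edgePick v)
    θ-factors {v} (idle p q) = ≈-sym (≈-trans
      (*-cong (Fin∏.∏-trivial λ a → pick-off (- 1#) (p a)) (Arc∏.∏-trivial {z = edgePick v} λ β → edgePick-off β (q β)))
      (*-identityˡ 1#))
    θ-factors {v} (matched p β m unique) = ≈-sym (≈-trans
      (*-cong (Fin∏.∏-trivial λ a → pick-off (- 1#) (p a))
        (≈-trans (Arc∏.∏-single {z = edgePick v} β λ γ γ≢β → edgePick-off γ (γ≢β ∘ unique γ)) (edgePick-at β m)))
      (*-identityˡ i))
    θ-factors {v} (passing a p unique _ q) = ≈-sym (≈-trans
      (*-cong (≈-trans (Fin∏.∏-single {z = λ b → pick (- 1#) (ω.head b) v} a λ b b≢a → pick-off (- 1#) (b≢a ∘ unique b)) (pick-at (- 1#) p))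
        (Arc∏.∏-trivial {z = edgePick v} λ β → edgePick-off β (q β)))
      (*-identityʳ _))

    flagSigns : Fin ∣ ∁ F ∣ → Carrier
    flagSigns b = if flag b then - 1# else 1#

    -- Double counting: in place of the vertices, each arc of F is met once at its head, and each
    -- matching edge at both ends, where i * i = -1.
    ∏-θ : ∏ (λ v → θ (class v)) ≈ ∏ {∣ F ∣} (λ _ → - 1#) * ∏ flagSigns
    ∏-θ = ≈-trans (Fin∏.∏-cong {#V G} λ v → θ-factors (class v))
      (≈-trans (∑-distrib-+ (λ v → ∏ λ a → pick (- 1#) (ω.head a) v) (λ v → arcSum (edgePick v)))
      (*-cong
        (≈-trans (∑-comm λ v a → pick (- 1#) (ω.head a) v) (Fin∏.∏-cong {∣ F ∣} λ a → ∏-pick (- 1#) (ω.head a)))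
        (≈-trans (∑-comm λ v b → edgePick v (b , true) * edgePick v (b , false))
          (Fin∏.∏-cong {∣ ∁ F ∣} λ b → ≈-trans (∑-distrib-+ (λ v → edgePick v (b , true)) (λ v → edgePick v (b , false)))
            (both b)))))
      where
      both : ∀ b → ∏ (λ v → edgePick v (b , true)) * ∏ (λ v → edgePick v (b , false)) ≈ flagSigns b
      both b with flag b
      ... | true  = ≈-trans (*-cong (∏-pick i (src M b)) (∏-pick i (tgt M b))) i*i≈-1
      ... | false = ≈-trans (*-cong (Fin∏.∏-trivial {#V G} λ _ → ≈-refl) (Fin∏.∏-trivial {#V G} λ _ → ≈-refl)) (*-identityˡ 1#)

    ∏-square : ∀ {n} (z : Fin n → Carrier) → (∀ k → z k * z k ≈ 1#) → ∏ z * ∏ z ≈ 1#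
    ∏-square z square = ≈-trans (≈-sym (∑-distrib-+ z z)) (Fin∏.∏-trivial square)

    -- The signs from θ, one for each arc of F and one for each matching edge, recur in the sign of
    -- s and cancel as squares. The circuit sign alone remains.
    contribution-classified : (- 1#) ^ circuits κ * ∏ local ≈ contribution x
    contribution-classified = ≈-sym (begin
      contribution x
        ≈⟨ contribution-single x s (λ v → coefficient (class v)) (λ v → row-single-class (class v)) ⟩
      ∏ (λ v → coefficient (class v)) * sgn s
        ≈⟨ *-cong (≈-trans (Fin∏.∏-cong {#V G} λ v → coefficient-local (class v)) (∑-distrib-+ local (λ v → θ (class v)))) sgn-s ⟩
      (∏ local * ∏ (λ v → θ (class v))) * (ε κ * ∏ flagSigns)
        ≈⟨ *-cong (*-congˡ ∏-θ) (*-congʳ (ε-circuits κ)) ⟩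
      (∏ local * (m * ∏ flagSigns)) * ((m * (- 1#) ^ circuits κ) * ∏ flagSigns)
        ≈⟨ solve 4 (λ l m f c → (l :* (m :* f)) :* ((m :* c) :* f) := (c :* l) :* ((m :* m) :* (f :* f)))
             ≈-refl (∏ local) m (∏ flagSigns) ((- 1#) ^ circuits κ) ⟩
      ((- 1#) ^ circuits κ * ∏ local) * ((m * m) * (∏ flagSigns * ∏ flagSigns))
        ≈⟨ *-congˡ (≈-trans (*-cong (∏-square {∣ F ∣} (λ _ → - 1#) λ _ → -1*-1≈1) (∏-square flagSigns flag-square)) (*-identityˡ 1#)) ⟩
      ((- 1#) ^ circuits κ * ∏ local) * 1#
        ≈⟨ *-identityʳ _ ⟩
      (- 1#) ^ circuits κ * ∏ local ∎)
      where
      open import Relation.Binary.Reasoning.Setoid setoid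
      m : Carrier
      m = ∏ {∣ F ∣} (λ _ → - 1#)
      flag-square : ∀ b → flagSigns b * flagSigns b ≈ 1#
      flag-square b with flag b
      ... | true  = -1*-1≈1
      ... | false = *-identityˡ 1#

  all-or : ∀ {n} {A : Fin n → Set} {B : Set} → (∀ k → A k ⊎ B) → (∀ k → A k) ⊎ B
  all-or {zero}  h = inj₁ λ ()
  all-or {suc n} h with h zero | all-or (h ∘ suc)
  ... | inj₂ b | _      = inj₂ b
  ... | inj₁ _ | inj₂ b = inj₂ b
  ... | inj₁ a | inj₁ f = inj₁ λ { zero → a ; (suc k) → f k }

  -- Either every vertex is in one of the three classes or a single bad vertex makes both sides 0;
  -- no partial cancellation between colorings is needed.
  contribution-local : (- 1#) ^ circuits κ * ∏ local ≈ contribution x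
  contribution-local with all-or (λ v → [ inj₁ , (λ (p , q) → inj₂ (∏-zero v p , q)) ]′ (classify v))
  ... | inj₁ class     = Classified.contribution-classified class
  ... | inj₂ (p , q) = ≈-trans (*-congˡ p) (≈-trans (zeroʳ _) (≈-sym q))

-- Summation over subsets and colorings

module MixedPartition (K : CommutativeRing 0ℓ 0ℓ) (t i : CommutativeRing.Carrier K)
                      (i*i≈-1 : CommutativeRing._≈_ K (CommutativeRing._*_ K i i)
                                 (CommutativeRing.-_ K (CommutativeRing.1# K))) where
  open CommutativeRing K hiding (zero) renaming (refl to ≈-refl; sym to ≈-sym; trans to ≈-trans)
  open LinearAlgebra K using (∑; words)
  open Model.Form K t i using (weight-cong)
  open Signs.Products K using (module Fin∏)
  open Expansion K using (∑-scale; module Sums; module Determinant)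
  open Reindexing K using (∑-combine; ∑-twist)
  open LocalWeights K using (symmetric-factor; exterior-factor)

  module _ (G : Graph) (choice : ∀ F → Eulerian G F → PairedOrientation (G ↾ F)) where
    open Determinant G t using (contribution; charPoly-expansion)

    -- The partition function skips a subset that is not Eulerian, so all of its states have to
    -- vanish on the determinant side. For an Eulerian one, `∑-twist` translates colours relative to
    -- ω into states.
    term-contributions : ∀ F (eulerian : Dec (Eulerian G F)) →
      LinearAlgebra.term K (Model.Form.model K t i) G choice F eulerian
      ≈ ∑ (words (allFin 2) ∣ F ∣) λ φ → ∑ (words (allFin 2) ∣ ∁ F ∣) λ ψ → contribution (combine F φ ψ)
    term-contributions F (no ¬eulerian) = ≈-sym (Sums.listSum-ε (words (allFin 2) ∣ F ∣) λ φ →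
      Sums.listSum-ε (words (allFin 2) ∣ ∁ F ∣) λ ψ → Degrees.non-eulerian K G t F φ ψ ¬eulerian)
    term-contributions F (yes eulerian) with choice F eulerian
    ... | ω , pairing = ≈-trans
      (≈-sym (∑-scale _ (words (allFin 2) ∣ F ∣) _))
      (≈-trans
        (Sums.listSum-cong (words (allFin 2) ∣ F ∣) λ φ → ≈-trans
          (≈-sym (∑-scale _ (words (allFin 2) ∣ ∁ F ∣) _))
          (Sums.listSum-cong (words (allFin 2) ∣ ∁ F ∣) λ ψ → ≈-trans
            (*-congˡ (Fin∏.∏-cong {#V G} λ v →
              let scalars = exterior-factor (lookup φ) (λ a → lookup φ (CompatiblePairing.κ pairing ⟨$⟩ʳ a))
                              (EulerianOrientation.head ω) v
              in weight-cong (symmetric-factor (G ↾ ∁ F) ψ v) (proj₁ scalars) (proj₂ scalars)))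
            (Colored.contribution-local K t i i*i≈-1 G F ω pairing φ ψ)))
        (≈-sym (∑-twist ∣ F ∣ (EulerianOrientation.forward ω)
          λ φ → ∑ (words (allFin 2) ∣ ∁ F ∣) λ ψ → contribution (combine F φ ψ))))

    mixedPartition≈charPoly : LinearAlgebra.mixedPartition K (Model.Form.model K t i) G choice ≈ LinearAlgebra.charPoly K G t
    mixedPartition≈charPoly = ≈-trans
      (Sums.listSum-cong (words (outside ∷ inside ∷ []) (#E G)) λ F → term-contributions F (eulerian? G F))
      (≈-trans (≈-sym (∑-combine (#E G) contribution)) (≈-sym charPoly-expansion))

-- The imaginary unit

module ComplexUnit (R : CommutativeRing 0ℓ 0ℓ) where
  open CommutativeRing R renaming (sym to ≈-sym; trans to ≈-trans)
  open RingProperties ring using (-0#≈0#)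
  open AdjoinI R using (C; _≈ᶜ_; _*ᶜ_; -ᶜ_)

  𝕚 : C
  𝕚 = 0# , 1#

  𝕚*𝕚≈-1 : 𝕚 *ᶜ 𝕚 ≈ᶜ -ᶜ (1# , 0#)
  𝕚*𝕚≈-1 = ≈-trans (+-cong (zeroˡ 0#) (-‿cong (*-identityˡ 1#))) (+-identityˡ _)
         , ≈-trans (+-cong (zeroˡ 1#) (zeroʳ 1#)) (≈-trans (+-identityˡ 0#) (≈-sym -0#≈0#))

open Defs using (_≈_; ColorModel; mixedPartition; charPoly)

proposition10 : (t : ℂ) →
    Σ[ h ∈ ColorModel 2 1 ]
    ((G : Graph) →
    (choice : (F : Subset (#E G)) → Eulerian G F → PairedOrientation (G ↾ F)) →
    mixedPartition h G choice ≈ charPoly G t)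
proposition10 t = Model.Form.model complexRing t 𝕚
                , MixedPartition.mixedPartition≈charPoly complexRing t 𝕚 𝕚*𝕚≈-1
  where open ComplexUnit Reals.realRing
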